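{- Let $\alpha\approx -3.09997$ be a root of the equation $2\cdot 5^{\alpha}-6^{\alpha+1}+4\cdot 7^{\alpha}=0$. Let $n\ge 3$ and let $B_n\in\Omega_n$ be a polyomino chain having $n$ squares. Then $$\chi_\alpha(B_n)\le 3\cdot 6^\alpha n+\left(2\cdot 4^\alpha+2\cdot 5^\alpha+6^\alpha-4\cdot 7^\alpha\right),$$ with equality if and only if $B_n$ does not contain any segment of length 2.
   Context: For a graph $G$ and a nonzero real number $\alpha$, the general sum-connectivity index is $\chi_\alpha(G)=\sum_{uv\in E(G)}(d_u+d_v)^\alpha$, where $d_u$ is the degree of the vertex $u$. A polyomino system is a connected geometric figure obtained by concatenating congruent squares side to side in the plane so that the figure divides the plane into one infinite (external) region and a number of finite (internal) regions, all internal regions being congruent squares. Two squares are adjacent if they share a side. A polyomino chain is a polyomino system in which every square is adjacent to at most two other squares; the squares are arranged in a linear order in which exactly the consecutive squares are adjacent (so for $n\ge 2$ there are two terminal squares; the cyclic $2\times 2$ block of four squares is not considered a chain). A polyomino chain is identified with its graph: vertices are the corners of the squares, edges are the sides of the squares. Degrees are taken in this graph. A square adjacent to exactly one (respectively two) other square(s) is called terminal (respectively non-terminal). A kink is a non-terminal square having a vertex of degree 2. A linear chain is a polyomino chain without kinks. A segment is a maximal linear chain in a polyomino chain, including the kinks and/or terminal squares at its ends; its length is its number of squares. A segment is external if it contains a terminal square, and internal otherwise. $\Omega_n$ is the collection of all polyomino chains with $n$ squares in which no internal segment of length 3 has an edge connecting two vertices of degree 3. -}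

module Defs where

open import Algebra.Bundles using (RawMonoid; CommutativeRing)
import Algebra.Properties.Semiring.Exp as Exp
open import Data.Empty using (⊥-elim)
open import Data.Fin using (toℕ)
open import Data.Integer as ℤ using (ℤ; +_; -[1+_])
import Data.Integer.Properties as ℤₚ
open import Data.Integer.Solver using () renaming (module +-*-Solver to ℤ-Solver)
open import Data.List using (List; []; _∷_; foldr; length; filter; concatMap; deduplicate; lookup)
open import Data.List.Membership.Propositional using (_∈_; _∉_; find; lose)
open import Data.List.Membership.Propositional.Properties
  using (∈-concatMap⁺; ∈-concatMap⁻; ∈-deduplicate⁺; ∈-deduplicate⁻)
open import Data.List.Relation.Binary.Infix.Heterogeneous using (Infix)
open import Data.List.Relation.Unary.All as All using (All; []; _∷_)
open import Data.List.Relation.Unary.AllPairs using (AllPairs; []; _∷_)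
open import Data.List.Relation.Unary.Any using (Any; here; there; any?)
import Data.List.Relation.Unary.Unique.DecPropositional.Properties as Uniqueₚ
open import Data.List.Relation.Unary.Unique.Propositional using (Unique)
open import Data.Nat as ℕ using (ℕ; zero; suc)
import Data.Nat.Properties as ℕₚ
open import Data.Product using (∃-syntax; _×_; _,_; proj₁; proj₂; swap)
open import Data.Product.Properties using (≡-dec)
open import Data.Rational as ℚ using (ℚ; 0ℚ; 1ℚ; _/_; 1/_)
import Data.Rational.Properties as ℚₚ
open import Data.Rational.Literals using (fromℤ)
open import Data.Rational.Solver using (module +-*-Solver)
open import Data.Rational.Unnormalised as ℚᵘ using (mkℚᵘ)
import Data.Rational.Unnormalised.Properties as ℚᵘₚ
open import Data.Sum as Sum using (_⊎_; inj₁; inj₂)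
open import Function using (_⇔_)
open import Relation.Binary.Construct.Closure.ReflexiveTransitive using (Star)
open import Relation.Binary.Definitions using (DecidableEquality)
open import Relation.Binary.PropositionalEquality
open import Relation.Nullary using (¬_; Dec; yes; no; ¬?; _×-dec_; _⊎-dec_)

open Exp (CommutativeRing.semiring ℚₚ.+-*-commutativeRing) using (_^_; ^-assocʳ)

-- Real numbers as two-sided Dedekind cuts.
record ℝ : Set₁ where
  field
    L U         : ℚ → Set
    L-inhabited : ∃[ q ] L q
    U-inhabited : ∃[ q ] U q
    L-down      : ∀ {p q} → p ℚ.< q → L q → L p
    U-up        : ∀ {p q} → p ℚ.< q → U p → U q
    L-open      : ∀ {p} → L p → ∃[ q ] p ℚ.< q × L q
    U-open      : ∀ {q} → U q → ∃[ p ] p ℚ.< q × U p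
    disjoint    : ∀ {q} → L q → ¬ U q
    located     : ∀ {p q} → p ℚ.< q → L p ⊎ U q

open ℝ

private
  variable
    i j : ℤ
    m n : ℕ
    p q r : ℚ

L<U : ∀ x → L x p → U x q → p ℚ.< q
L<U {p} {q} x l u with ℚₚ.≤-total q p
... | inj₂ p≤q with p ℚ.≟ q
...   | yes refl = ⊥-elim (disjoint x l u)
...   | no  p≢q  = ℚₚ.≰⇒> λ q≤p → p≢q (ℚₚ.≤-antisym p≤q q≤p)
L<U {p} {q} x l u | inj₁ q≤p with L-open x l
... | r , p<r , lr = ⊥-elim (disjoint x (L-down x (ℚₚ.≤-<-trans q≤p p<r) lr) u)

/<⇒ : i / suc m ℚ.< j / suc n → i ℤ.* + suc n ℤ.< j ℤ.* + suc m
/<⇒ {i} {m} {j} {n} lt = ℚᵘₚ.drop-*<*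
  (ℚᵘₚ.<-respʳ-≃ (ℚₚ.toℚᵘ-fromℚᵘ (mkℚᵘ j n))
    (ℚᵘₚ.<-respˡ-≃ (ℚₚ.toℚᵘ-fromℚᵘ (mkℚᵘ i m)) (ℚₚ.toℚᵘ-mono-< lt)))

⇒/< : i ℤ.* + suc n ℤ.< j ℤ.* + suc m → i / suc m ℚ.< j / suc n
⇒/< {i} {n} {j} {m} lt = ℚₚ.toℚᵘ-cancel-<
  (ℚᵘₚ.<-respʳ-≃ (ℚᵘₚ.≃-sym (ℚₚ.toℚᵘ-fromℚᵘ (mkℚᵘ j n)))
    (ℚᵘₚ.<-respˡ-≃ (ℚᵘₚ.≃-sym (ℚₚ.toℚᵘ-fromℚᵘ (mkℚᵘ i m))) (ℚᵘ.*<* lt)))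

i<suc[i] : ∀ i → i ℤ.< ℤ.suc i
i<suc[i] i = ℤₚ.suc[i]≤j⇒i<j ℤₚ.≤-refl

/-step : ∀ k n → k / suc n ℚ.< ℤ.suc k / suc n
/-step k n = ⇒/< {k} {n} {ℤ.suc k} {n} (ℤₚ.*-monoʳ-<-pos (+ suc n) (i<suc[i] k))

above : ∀ q n → ∃[ t ] q ℚ.< + suc t / suc n
above q@(ℚ.mkℚ i d _) n = t , subst (ℚ._< + suc t / suc n) (ℚₚ.↥p/↧p≡p q)
  (⇒/< {i} {n} {+ suc t} {d} (begin-strict
    i ℤ.* + suc n              ≤⟨ ℤₚ.*-monoʳ-≤-nonNeg (+ suc n) (i≤∣i∣ i) ⟩
    + ℤ.∣ i ∣ ℤ.* + suc n      ≡⟨ ℤₚ.pos-* ℤ.∣ i ∣ (suc n) ⟨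
    + t                        <⟨ ℤ.+<+ (ℕₚ.n<1+n t) ⟩
    + suc t                    ≤⟨ ℤ.+≤+ (ℕₚ.m≤m*n (suc t) (suc d)) ⟩
    + (suc t ℕ.* suc d)        ≡⟨ ℤₚ.pos-* (suc t) (suc d) ⟩
    + suc t ℤ.* + suc d        ∎))
  where
  open ℤₚ.≤-Reasoning
  t = ℤ.∣ i ∣ ℕ.* suc n
  i≤∣i∣ : ∀ i → i ℤ.≤ + ℤ.∣ i ∣
  i≤∣i∣ (+ n)    = ℤₚ.≤-refl
  i≤∣i∣ -[1+ n ] = ℤ.-≤+

neg-/ : ∀ k n → (ℤ.- k) / suc n ≡ ℚ.- (k / suc n)
neg-/ k n = ℚₚ.toℚᵘ-injective (begin
  ℚ.toℚᵘ ((ℤ.- k) / suc n)    ≈⟨ ℚₚ.toℚᵘ-fromℚᵘ (mkℚᵘ (ℤ.- k) n) ⟩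
  ℚᵘ.- mkℚᵘ k n               ≈⟨ ℚᵘₚ.-‿cong (ℚₚ.toℚᵘ-fromℚᵘ (mkℚᵘ k n)) ⟨
  ℚᵘ.- ℚ.toℚᵘ (k / suc n)     ≈⟨ ℚₚ.toℚᵘ-homo‿- (k / suc n) ⟨
  ℚ.toℚᵘ (ℚ.- (k / suc n))    ∎)
  where open ℚᵘₚ.≃-Reasoning

neg-neg : ∀ p → ℚ.- (ℚ.- p) ≡ p
neg-neg = solve 1 (λ p → :- (:- p) := p) refl where open +-*-Solver

below : ∀ q n → ∃[ k ] k / suc n ℚ.< q
below q n with above (ℚ.- q) n
... | t , lt = ℤ.- + suc t , subst₂ ℚ._<_ (sym (neg-/ (+ suc t) n)) (neg-neg q) (ℚₚ.neg-antimono-< lt)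

search : ∀ x n f k → L x (k / suc n) → U x ((+ f ℤ.+ k) / suc n) →
         ∃[ k ] L x (k / suc n) × U x (ℤ.suc (ℤ.suc k) / suc n)
search x n zero    k l u =
  ⊥-elim (disjoint x l (subst (λ k → U x (k / suc n)) (ℤₚ.+-identityˡ k) u))
search x n (suc f) k l u with located x (/-step (ℤ.suc k) n)
... | inj₂ u′ = k , l , u′
... | inj₁ l′ = search x n f (ℤ.suc k) l′ (subst (λ k → U x (k / suc n)) (shift (+ f) k) u)
  where
  shift : ∀ f k → ℤ.suc f ℤ.+ k ≡ f ℤ.+ ℤ.suc k
  shift = solve 2 (λ f k → con (+ 1) :+ f :+ k := f :+ (con (+ 1) :+ k)) refl where open ℤ-Solver

∣j-i∣+i≡j : i ℤ.≤ j → + ℤ.∣ j ℤ.- i ∣ ℤ.+ i ≡ j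
∣j-i∣+i≡j {i} {j} i≤j = trans (cong (ℤ._+ i) (ℤₚ.0≤i⇒+∣i∣≡i (ℤₚ.i≤j⇒0≤j-i i≤j)))
    (solve 2 (λ i j → j :+ :- i :+ i := j) refl i j)
  where open ℤ-Solver

grid : ∀ x n → ∃[ k ] L x (k / suc n) × U x (ℤ.suc (ℤ.suc k) / suc n)
grid x n =
  let a , la  = L-inhabited x ; c , uc  = U-inhabited x
      i , i<a = below a n     ; j , c<j = above c n
      li = L-down x i<a la    ; uj = U-up x c<j uc
  in from i (+ suc j) li uj
  where
  from : ∀ i j → L x (i / suc n) → U x (j / suc n) →
         ∃[ k ] L x (k / suc n) × U x (ℤ.suc (ℤ.suc k) / suc n)
  from i j li uj = search x n ℤ.∣ j ℤ.- i ∣ i li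
    (subst (λ k → U x (k / suc n)) (sym (∣j-i∣+i≡j
      (ℤₚ.<⇒≤ (ℤₚ.*-cancelʳ-<-nonNeg {i} {j} (+ suc n) (/<⇒ {i} {n} {j} {n} (L<U x li uj)))))) uj)

/-+ : ∀ i j n → (i ℤ.+ j) / suc n ≡ i / suc n ℚ.+ j / suc n
/-+ i j n = ℚₚ.toℚᵘ-injective (begin
  ℚ.toℚᵘ ((i ℤ.+ j) / suc n)                    ≈⟨ ℚₚ.toℚᵘ-fromℚᵘ (mkℚᵘ (i ℤ.+ j) n) ⟩
  mkℚᵘ (i ℤ.+ j) n                              ≈⟨ ℚᵘ.*≡* (lem i j (+ suc n)) ⟩
  mkℚᵘ i n ℚᵘ.+ mkℚᵘ j n
    ≈⟨ ℚᵘₚ.+-cong (ℚₚ.toℚᵘ-fromℚᵘ (mkℚᵘ i n)) (ℚₚ.toℚᵘ-fromℚᵘ (mkℚᵘ j n)) ⟨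
  ℚ.toℚᵘ (i / suc n) ℚᵘ.+ ℚ.toℚᵘ (j / suc n)    ≈⟨ ℚₚ.toℚᵘ-homo-+ (i / suc n) (j / suc n) ⟨
  ℚ.toℚᵘ (i / suc n ℚ.+ j / suc n)              ∎)
  where
  open ℚᵘₚ.≃-Reasoning
  open ℤ-Solver
  lem : ∀ i j n → (i ℤ.+ j) ℤ.* (n ℤ.* n) ≡ (i ℤ.* n ℤ.+ j ℤ.* n) ℤ.* n
  lem = solve 3 (λ i j n → (i :+ j) :* (n :* n) := (i :* n :+ j :* n) :* n) refl

small : 0ℚ ℚ.< p → ∃[ n ] + 2 / suc n ℚ.< p
small {p@(ℚ.mkℚ (+ suc i) d _)} 0<p = k , subst (+ 2 / suc k ℚ.<_) (ℚₚ.↥p/↧p≡p p)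
  (⇒/< {+ 2} {d} {+ suc i} {k} (ℤ.+<+ (ℕₚ.<-≤-trans (ℕₚ.n<1+n (2 ℕ.* suc d))
    (ℕₚ.m≤n*m (suc k) (suc i)))))
  where k = 2 ℕ.* suc d
small {ℚ.mkℚ (+ zero) d _}  (ℚ.*<* (ℤ.+<+ ()))
small {ℚ.mkℚ -[1+ _ ] d _}  (ℚ.*<* ())

/-+-< : ∀ k j n {ε} → j / suc n ℚ.< ε → (k ℤ.+ j) / suc n ℚ.< k / suc n ℚ.+ ε
/-+-< k j n lt = subst (ℚ._< _) (sym (/-+ k j n)) (ℚₚ.+-monoʳ-< (k / suc n) lt)

suc-suc : ∀ k → ℤ.suc (ℤ.suc k) ≡ k ℤ.+ + 2
suc-suc k = trans (sym (ℤₚ.+-assoc (+ 1) (+ 1) k)) (ℤₚ.+-comm (+ 2) k)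

-- Every real lies in a rational interval of arbitrarily small width.
approx : ∀ x {ε} → 0ℚ ℚ.< ε → ∃[ q ] L x q × U x (q ℚ.+ ε)
approx x {ε} 0<ε =
  let n , lt = small 0<ε ; k , l , u = grid x n
  in k / suc n , l
     , U-up x (/-+-< k (+ 2) n lt) (subst (λ j → U x (j / suc n)) (suc-suc k) u)

fromℚ : ℚ → ℝ
fromℚ r = record
  { L           = ℚ._< r
  ; U           = r ℚ.<_
  ; L-inhabited = r ℚ.- 1ℚ , r-1<r
  ; U-inhabited = r ℚ.+ 1ℚ , r<r+1
  ; L-down      = ℚₚ.<-trans
  ; U-up        = λ p<q r<p → ℚₚ.<-trans r<p p<q
  ; L-open      = ℚₚ.<-dense
  ; U-open      = λ r<q → let s , r<s , s<q = ℚₚ.<-dense r<q in s , s<q , r<s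
  ; disjoint    = ℚₚ.<-asym
  ; located     = loc
  }
  where
  r-1<r : r ℚ.- 1ℚ ℚ.< r
  r-1<r = subst (r ℚ.- 1ℚ ℚ.<_) (ℚₚ.+-identityʳ r) (ℚₚ.+-monoʳ-< r (ℚₚ.negative⁻¹ (ℚ.- 1ℚ)))
  r<r+1 : r ℚ.< r ℚ.+ 1ℚ
  r<r+1 = subst (ℚ._< r ℚ.+ 1ℚ) (ℚₚ.+-identityʳ r) (ℚₚ.+-monoʳ-< r (ℚₚ.positive⁻¹ 1ℚ))
  loc : p ℚ.< q → (p ℚ.< r) ⊎ (r ℚ.< q)
  loc {p} p<q with p ℚ.<? r
  ... | yes p<r = inj₁ p<r
  ... | no  p≮r = inj₂ (ℚₚ.≤-<-trans (ℚₚ.≮⇒≥ p≮r) p<q)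

0<- : p ℚ.< q → 0ℚ ℚ.< q ℚ.- p
0<- {p} {q} p<q = subst (ℚ._< q ℚ.- p) (ℚₚ.+-inverseʳ p) (ℚₚ.+-monoˡ-< (ℚ.- p) p<q)

infix  8 -_
infixl 6 _+_ _-_
infix  4 _<_ _≤_ _≃_

_<_ _≤_ _≃_ : ℝ → ℝ → Set
x < y = ∃[ q ] U x q × L y q
x ≤ y = ∀ {q} → L x q → L y q
x ≃ y = x ≤ y × y ≤ x

-_ : ℝ → ℝ
- x = record
  { L           = λ q → U x (ℚ.- q)
  ; U           = λ q → L x (ℚ.- q)
  ; L-inhabited = let q , u = U-inhabited x in ℚ.- q , subst (U x) (sym (neg-neg q)) u
  ; U-inhabited = let q , l = L-inhabited x in ℚ.- q , subst (L x) (sym (neg-neg q)) l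
  ; L-down      = λ p<q → U-up x (ℚₚ.neg-antimono-< p<q)
  ; U-up        = λ p<q → L-down x (ℚₚ.neg-antimono-< p<q)
  ; L-open      = λ {p} u → let r , r<-p , u′ = U-open x u in
      ℚ.- r , subst (ℚ._< ℚ.- r) (neg-neg p) (ℚₚ.neg-antimono-< r<-p)
            , subst (U x) (sym (neg-neg r)) u′
  ; U-open      = λ {q} l → let r , -q<r , l′ = L-open x l in
      ℚ.- r , subst (ℚ.- r ℚ.<_) (neg-neg q) (ℚₚ.neg-antimono-< -q<r)
            , subst (L x) (sym (neg-neg r)) l′
  ; disjoint    = λ u l → disjoint x l u
  ; located     = λ p<q → Sum.swap (located x (ℚₚ.neg-antimono-< p<q))
  }

_+_ : ℝ → ℝ → ℝ
x + y = record
  { L           = Lower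
  ; U           = Upper
  ; L-inhabited = let a , la = L-inhabited x ; b , lb = L-inhabited y in
      a ℚ.+ b , a , b , la , lb , refl
  ; U-inhabited = let a , ua = U-inhabited x ; b , ub = U-inhabited y in
      a ℚ.+ b , a , b , ua , ub , refl
  ; L-down      = λ { {p} p<q (a , b , la , lb , refl) →
      a , p ℚ.- a , la , L-down y (subst (p ℚ.- a ℚ.<_) (cancel a b) (ℚₚ.+-monoˡ-< (ℚ.- a) p<q)) lb
        , split p a }
  ; U-up        = λ { {p} {q} p<q (a , b , ua , ub , refl) →
      a , q ℚ.- a , ua , U-up y (subst (ℚ._< q ℚ.- a) (cancel a b) (ℚₚ.+-monoˡ-< (ℚ.- a) p<q)) ub
        , split q a }
  ; L-open      = λ { (a , b , la , lb , refl) → let a′ , a<a′ , la′ = L-open x la in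
      a′ ℚ.+ b , ℚₚ.+-monoˡ-< b a<a′ , a′ , b , la′ , lb , refl }
  ; U-open      = λ { (a , b , ua , ub , refl) → let a′ , a′<a , ua′ = U-open x ua in
      a′ ℚ.+ b , ℚₚ.+-monoˡ-< b a′<a , a′ , b , ua′ , ub , refl }
  ; disjoint    = λ { (a , b , la , lb , refl) (c , d , uc , ud , e) →
      ℚₚ.<-irrefl e (ℚₚ.+-mono-< (L<U x la uc) (L<U y lb ud)) }
  ; located     = λ p<q →
      let s , p<s , s<q = ℚₚ.<-dense p<q
          a , la , ua   = approx x (0<- s<q)
      in Sum.map (λ lb → _ , _ , la , lb , split _ a)
                 (λ ub → _ , _ , ua , ub , split₃ _ s a)
                 (located y (ℚₚ.+-monoˡ-< (ℚ.- a) p<s))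
  }
  where
  open +-*-Solver
  Lower Upper : ℚ → Set
  Lower q = ∃[ a ] ∃[ b ] L x a × L y b × q ≡ a ℚ.+ b
  Upper q = ∃[ a ] ∃[ b ] U x a × U y b × q ≡ a ℚ.+ b
  cancel : ∀ a b → a ℚ.+ b ℚ.- a ≡ b
  cancel = solve 2 (λ a b → a :+ b :+ :- a := b) refl
  split : ∀ p a → p ≡ a ℚ.+ (p ℚ.- a)
  split = solve 2 (λ p a → p := a :+ (p :+ :- a)) refl
  split₃ : ∀ q s a → q ≡ (a ℚ.+ (q ℚ.- s)) ℚ.+ (s ℚ.- a)
  split₃ = solve 3 (λ q s a → q := (a :+ (q :+ :- s)) :+ (s :+ :- a)) refl

_-_ : ℝ → ℝ → ℝ
x - y = x + - y

infixr 8 _^ℤ_ _^ℝ_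

_^ℤ_ : (c : ℚ) → .{{ℚ.NonZero c}} → ℤ → ℚ
c ^ℤ (+ m)    = c ^ m
c ^ℤ -[1+ m ] = (1/ c) ^ suc m

0≤1 : 0ℚ ℚ.≤ 1ℚ
0≤1 = ℚₚ.nonNegative⁻¹ 1ℚ

*-mono-≤ : ∀ {p q r s} → 0ℚ ℚ.≤ p → 0ℚ ℚ.≤ s → p ℚ.≤ q → r ℚ.≤ s → p ℚ.* r ℚ.≤ q ℚ.* s
*-mono-≤ {p} {q} {r} {s} 0≤p 0≤s p≤q r≤s = ℚₚ.≤-trans
  (ℚₚ.*-monoˡ-≤-nonNeg p {{ℚ.nonNegative 0≤p}} r≤s)
  (ℚₚ.*-monoʳ-≤-nonNeg s {{ℚ.nonNegative 0≤s}} p≤q)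

0≤^ : ∀ n → 0ℚ ℚ.≤ p → 0ℚ ℚ.≤ p ^ n
0≤^ zero    0≤p = 0≤1
0≤^ {p} (suc n) 0≤p = subst (ℚ._≤ p ℚ.* p ^ n) (ℚₚ.*-zeroˡ 0ℚ) (*-mono-≤ ℚₚ.≤-refl (0≤^ n 0≤p) 0≤p (0≤^ n 0≤p))

^-mono-≤ : ∀ n → 0ℚ ℚ.≤ p → p ℚ.≤ q → p ^ n ℚ.≤ q ^ n
^-mono-≤ zero    0≤p p≤q = ℚₚ.≤-refl
^-mono-≤ (suc n) 0≤p p≤q =
  *-mono-≤ 0≤p (0≤^ n (ℚₚ.≤-trans 0≤p p≤q)) p≤q (^-mono-≤ n 0≤p p≤q)

^-mono-< : ∀ n → 0ℚ ℚ.≤ p → p ℚ.< q → p ^ suc n ℚ.< q ^ suc n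
^-mono-< {p} {q} n 0≤p p<q = ℚₚ.≤-<-trans
  (ℚₚ.*-monoˡ-≤-nonNeg p {{ℚ.nonNegative 0≤p}} (^-mono-≤ n 0≤p (ℚₚ.<⇒≤ p<q)))
  (ℚₚ.*-monoˡ-<-pos (q ^ n) {{ℚ.positive (0<^ n (ℚₚ.≤-<-trans 0≤p p<q))}} p<q)
  where
  0<^ : ∀ n → 0ℚ ℚ.< q → 0ℚ ℚ.< q ^ n
  0<^ zero    0<q = ℚₚ.positive⁻¹ 1ℚ
  0<^ (suc n) 0<q = ℚₚ.positive⁻¹ (q ℚ.* q ^ n)
    {{ℚₚ.pos*pos⇒pos q {{ℚ.positive 0<q}} (q ^ n) {{ℚ.positive (0<^ n 0<q)}}}}

module _ (c : ℚ) .{{_ : ℚ.Positive c}} where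

  private instance
    c≢0 : ℚ.NonZero c
    c≢0 = ℚₚ.pos⇒nonZero c

  ^ℤ-suc : ∀ k → c ^ℤ ℤ.suc k ≡ c ℚ.* c ^ℤ k
  ^ℤ-suc (+ m)         = refl
  ^ℤ-suc -[1+ zero ]   = sym (trans (cong (c ℚ.*_) (ℚₚ.*-identityʳ (1/ c))) (ℚₚ.*-inverseʳ c))
  ^ℤ-suc -[1+ suc m ]  = sym (trans (sym (ℚₚ.*-assoc c (1/ c) ((1/ c) ^ suc m)))
    (trans (cong (ℚ._* (1/ c) ^ suc m) (ℚₚ.*-inverseʳ c)) (ℚₚ.*-identityˡ _)))

  ^ℤ-* : ∀ k n → (c ^ℤ k) ^ suc n ≡ c ^ℤ (k ℤ.* + suc n)
  ^ℤ-* (+ m)    n = trans (^-assocʳ c m (suc n)) (cong (c ^ℤ_) (ℤₚ.pos-* m (suc n)))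
  ^ℤ-* -[1+ m ] n = ^-assocʳ (1/ c) (suc m) (suc n)

  0≤^ℤ : ∀ k → 0ℚ ℚ.≤ c ^ℤ k
  0≤^ℤ (+ m)    = 0≤^ m (ℚₚ.nonNegative⁻¹ c {{ℚₚ.pos⇒nonNeg c}})
  0≤^ℤ -[1+ m ] = 0≤^ (suc m) (ℚₚ.<⇒≤ (ℚₚ.positive⁻¹ (1/ c) {{ℚₚ.1/pos⇒pos c}}))

  ^ℤ-mono-≤ : 1ℚ ℚ.≤ c → i ℤ.≤ j → c ^ℤ i ℚ.≤ c ^ℤ j
  ^ℤ-mono-≤ {i} {j} 1≤c i≤j = subst (λ k → c ^ℤ i ℚ.≤ c ^ℤ k) (∣j-i∣+i≡j i≤j) (grow ℤ.∣ j ℤ.- i ∣)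
    where
    step : ∀ k → c ^ℤ k ℚ.≤ c ^ℤ ℤ.suc k
    step k = subst₂ ℚ._≤_ (ℚₚ.*-identityˡ _) (sym (^ℤ-suc k))
      (ℚₚ.*-monoʳ-≤-nonNeg (c ^ℤ k) {{ℚ.nonNegative (0≤^ℤ k)}} 1≤c)
    grow : ∀ f → c ^ℤ i ℚ.≤ c ^ℤ (+ f ℤ.+ i)
    grow zero    = ℚₚ.≤-reflexive (cong (c ^ℤ_) (sym (ℤₚ.+-identityˡ i)))
    grow (suc f) = ℚₚ.≤-trans (grow f)
      (subst (λ k → c ^ℤ (+ f ℤ.+ i) ℚ.≤ c ^ℤ k) (sym (ℤₚ.+-assoc (+ 1) (+ f) i)) (step (+ f ℤ.+ i)))

-- A multiplicative form of Bernoulli's inequality.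
bernoulli : ∀ {s t} → 0ℚ ℚ.≤ s → s ℚ.≤ t → ∀ n →
            s ^ n ℚ.* (s ℚ.+ fromℤ (+ n) ℚ.* (t ℚ.- s)) ℚ.≤ s ℚ.* t ^ n
bernoulli {s} {t} 0≤s s≤t zero = ℚₚ.≤-reflexive
  (solve 2 (λ s d → con 1ℚ :* (s :+ con 0ℚ :* d) := s :* con 1ℚ) refl s (t ℚ.- s))
  where open +-*-Solver
bernoulli {s} {t} 0≤s s≤t (suc n) = begin
  s ℚ.* s ^ n ℚ.* (s ℚ.+ fromℤ (+ suc n) ℚ.* d)
    ≡⟨ cong (λ z → s ℚ.* s ^ n ℚ.* (s ℚ.+ z ℚ.* d)) suc-N ⟩
  s ℚ.* s ^ n ℚ.* (s ℚ.+ (1ℚ ℚ.+ N) ℚ.* d)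
    ≡⟨ solve 4 (λ s u N d → s :* u :* (s :+ (con 1ℚ :+ N) :* d)
                         := u :* (s :* (s :+ (con 1ℚ :+ N) :* d))) refl s (s ^ n) N d ⟩
  s ^ n ℚ.* (s ℚ.* (s ℚ.+ (1ℚ ℚ.+ N) ℚ.* d))
    ≤⟨ ℚₚ.*-monoˡ-≤-nonNeg (s ^ n) {{ℚ.nonNegative (0≤^ n 0≤s)}} le ⟩
  s ^ n ℚ.* (t ℚ.* (s ℚ.+ N ℚ.* d))
    ≡⟨ solve 3 (λ u t z → u :* (t :* z) := t :* (u :* z)) refl (s ^ n) t (s ℚ.+ N ℚ.* d) ⟩
  t ℚ.* (s ^ n ℚ.* (s ℚ.+ N ℚ.* d))
    ≤⟨ ℚₚ.*-monoˡ-≤-nonNeg t {{ℚ.nonNegative (ℚₚ.≤-trans 0≤s s≤t)}} (bernoulli 0≤s s≤t n) ⟩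
  t ℚ.* (s ℚ.* t ^ n)
    ≡⟨ solve 3 (λ s t u → t :* (s :* u) := s :* (t :* u)) refl s t (t ^ n) ⟩
  s ℚ.* (t ℚ.* t ^ n) ∎
  where
  open +-*-Solver
  open ℚₚ.≤-Reasoning
  d = t ℚ.- s
  N = fromℤ (+ n)
  suc-N : fromℤ (+ suc n) ≡ 1ℚ ℚ.+ N
  suc-N = trans (sym (ℚₚ.↥p/↧p≡p (fromℤ (+ suc n))))
    (trans (/-+ (+ 1) (+ n) 0) (cong (1ℚ ℚ.+_) (ℚₚ.↥p/↧p≡p N)))
  0≤d : 0ℚ ℚ.≤ d
  0≤d = subst (ℚ._≤ d) (ℚₚ.+-inverseʳ s) (ℚₚ.+-monoˡ-≤ (ℚ.- s) s≤t)
  le : s ℚ.* (s ℚ.+ (1ℚ ℚ.+ N) ℚ.* d) ℚ.≤ t ℚ.* (s ℚ.+ N ℚ.* d)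
  le = subst₂ ℚ._≤_ (ℚₚ.+-identityʳ _)
    (solve 3 (λ s t N → s :* (s :+ (con 1ℚ :+ N) :* (t :+ :- s)) :+ N :* ((t :+ :- s) :* (t :+ :- s))
                     := t :* (s :+ N :* (t :+ :- s))) refl s t N)
    (ℚₚ.+-monoʳ-≤ (s ℚ.* (s ℚ.+ (1ℚ ℚ.+ N) ℚ.* d)) (ℚₚ.nonNegative⁻¹ (N ℚ.* (d ℚ.* d))
      {{ℚₚ.nonNeg*nonNeg⇒nonNeg N (d ℚ.* d) {{ℚₚ.nonNeg*nonNeg⇒nonNeg d {{ℚ.nonNegative 0≤d}} d {{ℚ.nonNegative 0≤d}}}}}}))

power-gap : ∀ {s t} e k → .{{_ : ℚ.Positive s}} .{{_ : ℚ.Positive (t ℚ.- s)}} .{{_ : ℚ.NonZero (t ℚ.- s)}} →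
  s ℚ.≤ t → s ℚ.* e ℚ.* 1/ (t ℚ.- s) ℚ.< fromℤ (+ suc k) →
  e ℚ.* s ^ suc k ℚ.≤ t ^ suc k
power-gap {s} {t} e k s≤t lt = ℚₚ.*-cancelˡ-≤-pos s (begin
  s ℚ.* (e ℚ.* s ^ suc k)              ≡⟨ shuffle s e (s ^ suc k) ⟩
  s ^ suc k ℚ.* (s ℚ.* e)              ≤⟨ ℚₚ.*-monoˡ-≤-nonNeg (s ^ suc k) {{ℚ.nonNegative (0≤^ (suc k) 0≤s)}} se≤ ⟩
  s ^ suc k ℚ.* (s ℚ.+ N ℚ.* d)        ≤⟨ bernoulli 0≤s s≤t (suc k) ⟩
  s ℚ.* t ^ suc k                      ∎)
  where
  open ℚₚ.≤-Reasoning
  d = t ℚ.- s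
  N = fromℤ (+ suc k)
  0≤s : 0ℚ ℚ.≤ s
  0≤s = ℚₚ.<⇒≤ (ℚₚ.positive⁻¹ s)
  shuffle : ∀ s e u → s ℚ.* (e ℚ.* u) ≡ u ℚ.* (s ℚ.* e)
  shuffle = solve 3 (λ s e u → s :* (e :* u) := u :* (s :* e)) refl where open +-*-Solver
  se≤ : s ℚ.* e ℚ.≤ s ℚ.+ N ℚ.* d
  se≤ = begin
    s ℚ.* e                      ≡⟨ ℚₚ.*-identityʳ (s ℚ.* e) ⟨
    s ℚ.* e ℚ.* 1ℚ               ≡⟨ cong (s ℚ.* e ℚ.*_) (ℚₚ.*-inverseˡ d) ⟨
    s ℚ.* e ℚ.* (1/ d ℚ.* d)     ≡⟨ ℚₚ.*-assoc (s ℚ.* e) (1/ d) d ⟨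
    s ℚ.* e ℚ.* 1/ d ℚ.* d       <⟨ ℚₚ.*-monoˡ-<-pos d lt ⟩
    N ℚ.* d                      ≡⟨ ℚₚ.+-identityˡ (N ℚ.* d) ⟨
    0ℚ ℚ.+ N ℚ.* d               <⟨ ℚₚ.+-monoˡ-< (N ℚ.* d) (ℚₚ.positive⁻¹ s) ⟩
    s ℚ.+ N ℚ.* d                ∎

^-outgrows : ∀ {s t} e → 0ℚ ℚ.< s → s ℚ.< t → ∃[ n ] e ℚ.* s ^ suc n ℚ.≤ t ^ suc n
^-outgrows {s} {t} e 0<s s<t =
  let n , lt = above (s ℚ.* e ℚ.* 1/ d) 0
  in n , power-gap e n (ℚₚ.<⇒≤ s<t) (subst (s ℚ.* e ℚ.* 1/ d ℚ.<_) (ℚₚ.↥p/↧p≡p (fromℤ (+ suc n))) lt)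
  where
  d = t ℚ.- s
  instance
    s>0 : ℚ.Positive s
    s>0 = ℚ.positive 0<s
    d>0 : ℚ.Positive d
    d>0 = ℚ.positive (0<- s<t)
    d≢0 : ℚ.NonZero d
    d≢0 = ℚₚ.pos⇒nonZero d

-- For c ≥ 1, c ^ α is the cut determined by the rational powers c ^ (m / n)
-- with m / n below, respectively above, α; a rational a ≥ 0 is compared with
-- c ^ (m / n) by comparing a ^ n with c ^ m.  Passing from a to the rationals
-- strictly below (above) it makes the cut open.
power : (c : ℚ) .{{_ : ℚ.Positive c}} → 1ℚ ℚ.≤ c → ℝ → ℝ
power c 1≤c α = record
  { L           = Lower
  ; U           = Upper
  ; L-inhabited = ℚ.- 1ℚ , below-0 (ℚₚ.negative⁻¹ (ℚ.- 1ℚ))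
  ; U-inhabited = let k , _ , u = grid α 0 ; b = c ^ℤ ℤ.suc (ℤ.suc k) in
      b ℚ.+ 1ℚ , b , b<b+1 b , 0≤^ℤ c (ℤ.suc (ℤ.suc k)) , ℤ.suc (ℤ.suc k) , 0 , u
               , ℚₚ.≤-reflexive (sym (ℚₚ.*-identityʳ b))
  ; L-down      = λ { p<q (a , q<a , rest) → a , ℚₚ.<-trans p<q q<a , rest }
  ; U-up        = λ { p<q (b , b<p , rest) → b , ℚₚ.<-trans b<p p<q , rest }
  ; L-open      = λ { (a , p<a , rest) → let r , p<r , r<a = ℚₚ.<-dense p<a in
      r , p<r , a , r<a , rest }
  ; U-open      = λ { (b , b<q , rest) → let r , b<r , r<q = ℚₚ.<-dense b<q in
      r , r<q , b , b<r , rest }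
  ; disjoint    = disj
  ; located     = loc
  }
  where
  instance
    c≢0 : ℚ.NonZero c
    c≢0 = ℚₚ.pos⇒nonZero c
  Lower Upper : ℚ → Set
  Lower q = ∃[ a ] q ℚ.< a × 0ℚ ℚ.≤ a ×
            ∃[ m ] ∃[ n ] L α (m / suc n) × a ^ suc n ℚ.≤ c ^ℤ m
  Upper q = ∃[ b ] b ℚ.< q × 0ℚ ℚ.≤ b ×
            ∃[ m ] ∃[ n ] U α (m / suc n) × c ^ℤ m ℚ.≤ b ^ suc n
  b<b+1 : ∀ b → b ℚ.< b ℚ.+ 1ℚ
  b<b+1 b = subst (ℚ._< b ℚ.+ 1ℚ) (ℚₚ.+-identityʳ b) (ℚₚ.+-monoʳ-< b (ℚₚ.positive⁻¹ 1ℚ))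
  below-0 : p ℚ.< 0ℚ → Lower p
  below-0 p<0 = let k , l , _ = grid α 0 in
    0ℚ , p<0 , ℚₚ.≤-refl , k , 0 , l , 0≤^ℤ c k
  disj : Lower p → ¬ Upper p
  disj (a , p<a , 0≤a , m , n , l , a≤) (b , b<p , 0≤b , m′ , n′ , u , ≤b) =
    ℚₚ.<-irrefl refl (begin-strict
      b ^ (suc n ℕ.* suc n′)       <⟨ ^-mono-< (n′ ℕ.+ n ℕ.* suc n′) 0≤b (ℚₚ.<-trans b<p p<a) ⟩
      a ^ (suc n ℕ.* suc n′)       ≡⟨ ^-assocʳ a (suc n) (suc n′) ⟨
      (a ^ suc n) ^ suc n′         ≤⟨ ^-mono-≤ (suc n′) (0≤^ (suc n) 0≤a) a≤ ⟩
      (c ^ℤ m) ^ suc n′            ≡⟨ ^ℤ-* c m n′ ⟩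
      c ^ℤ (m ℤ.* + suc n′)        ≤⟨ ^ℤ-mono-≤ c 1≤c (ℤₚ.<⇒≤ (/<⇒ {m} {n} {m′} {n′} (L<U α l u))) ⟩
      c ^ℤ (m′ ℤ.* + suc n)        ≡⟨ ^ℤ-* c m′ n ⟨
      (c ^ℤ m′) ^ suc n            ≤⟨ ^-mono-≤ (suc n) (0≤^ℤ c m′) ≤b ⟩
      (b ^ suc n′) ^ suc n         ≡⟨ ^-assocʳ b (suc n′) (suc n) ⟩
      b ^ (suc n′ ℕ.* suc n)       ≡⟨ cong (b ^_) (ℕₚ.*-comm (suc n′) (suc n)) ⟩
      b ^ (suc n ℕ.* suc n′)       ∎)
    where open ℚₚ.≤-Reasoning
  from-0 : 0ℚ ℚ.≤ p → p ℚ.< q → Lower p ⊎ Upper q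
  from-0 {p} {q} 0≤p p<q =
    let t , p<t , t<q = ℚₚ.<-dense p<q
        s , p<s , s<t = ℚₚ.<-dense p<t
        0<s           = ℚₚ.≤-<-trans 0≤p p<s
        n , cc≤       = ^-outgrows (c ℚ.* c) 0<s s<t
        k , l , u     = grid α n
    in compare p<s t<q (ℚₚ.<⇒≤ 0<s) (ℚₚ.<⇒≤ (ℚₚ.<-trans 0<s s<t)) n cc≤ k l u
    where
    compare : ∀ {s t} → p ℚ.< s → t ℚ.< q → 0ℚ ℚ.≤ s → 0ℚ ℚ.≤ t →
              ∀ n → c ℚ.* c ℚ.* s ^ suc n ℚ.≤ t ^ suc n →
              ∀ k → L α (k / suc n) → U α (ℤ.suc (ℤ.suc k) / suc n) → Lower p ⊎ Upper q
    compare {s} {t} p<s t<q 0≤s 0≤t n cc≤ k l u with ℚₚ.≤-total (s ^ suc n) (c ^ℤ k)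
    ... | inj₁ s≤ = inj₁ (s , p<s , 0≤s , k , n , l , s≤)
    ... | inj₂ ≤s = inj₂ (t , t<q , 0≤t , ℤ.suc (ℤ.suc k) , n , u , (begin
      c ^ℤ ℤ.suc (ℤ.suc k)          ≡⟨ trans (^ℤ-suc c (ℤ.suc k)) (cong (c ℚ.*_) (^ℤ-suc c k)) ⟩
      c ℚ.* (c ℚ.* c ^ℤ k)          ≡⟨ ℚₚ.*-assoc c c _ ⟨
      c ℚ.* c ℚ.* c ^ℤ k            ≤⟨ ℚₚ.*-monoˡ-≤-nonNeg (c ℚ.* c) {{cc≥0}} ≤s ⟩
      c ℚ.* c ℚ.* s ^ suc n         ≤⟨ cc≤ ⟩
      t ^ suc n                     ∎))
      where
      open ℚₚ.≤-Reasoning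
      cc≥0 = ℚₚ.nonNeg*nonNeg⇒nonNeg c {{ℚₚ.pos⇒nonNeg c}} c {{ℚₚ.pos⇒nonNeg c}}
  loc : p ℚ.< q → Lower p ⊎ Upper q
  loc {p} p<q with p ℚ.<? 0ℚ
  ... | yes p<0 = inj₁ (below-0 p<0)
  ... | no  p≮0 = from-0 (ℚₚ.≮⇒≥ p≮0) p<q

-- The value at base 0 is a placeholder: no edge has end-degree sum 0.
_^ℝ_ : ℕ → ℝ → ℝ
zero  ^ℝ α = fromℚ 0ℚ
suc b ^ℝ α = power (fromℤ (+ suc b)) (ℚ.*≤* (ℤ.+≤+ (ℕ.s≤s ℕ.z≤n))) α

ℝ-+-rawMonoid : RawMonoid _ _
ℝ-+-rawMonoid = record { Carrier = ℝ ; _≈_ = _≃_ ; _∙_ = _+_ ; ε = fromℚ 0ℚ }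

open import Algebra.Definitions.RawMonoid ℝ-+-rawMonoid public using () renaming (_×_ to _·_)

∑ : ∀ {A : Set} → List A → (A → ℝ) → ℝ
∑ xs f = foldr (λ a s → f a + s) (fromℚ 0ℚ) xs

record Graph : Set₁ where
  field
    V        : Set
    _≟_      : DecidableEquality V
    vertices : List V
    edges    : List (V × V)
    unique   : Unique vertices
    ends     : All (λ (u , v) → u ∈ vertices × v ∈ vertices) edges
    loopless : All (λ (u , v) → u ≢ v) edges
    -- No edge is listed twice, in either orientation.
    simple   : AllPairs (λ e f → e ≢ f × e ≢ swap f) edges

  degree : V → ℕ
  degree v = length (filter (λ (u , w) → (v ≟ u) ⊎-dec (v ≟ w)) edges)

open Graph using (degree)

χ : ℝ → Graph → ℝ
χ α G = ∑ (Graph.edges G) λ (u , v) → (degree G u ℕ.+ degree G v) ^ℝ α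

Point Cell Side : Set
Point = ℤ × ℤ
-- Congruent squares joined side to side all lie in one square grid; (x , y) is
-- the unit square [x , x + 1] × [y , y + 1].
Cell  = ℤ × ℤ
Side  = Point × Point

_≟ₚ_ : DecidableEquality Point
_≟ₚ_ = ≡-dec ℤ._≟_ ℤ._≟_

_≟ₛ_ : DecidableEquality Side
_≟ₛ_ = ≡-dec _≟ₚ_ _≟ₚ_

open import Data.List.Membership.DecPropositional _≟ₛ_ using () renaming (_∈?_ to _∈ₛ?_)

east north : Point → Point
east  (x , y) = ℤ.suc x , y
north (x , y) = x , ℤ.suc y

corners : Cell → List Point
corners c = c ∷ east c ∷ north c ∷ east (north c) ∷ []

sides : Cell → List Side
sides c = (c , east c) ∷ (c , north c) ∷
          (north c , east (north c)) ∷ (east c , north (east c)) ∷ []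

figure : List Cell → List Side
figure P = deduplicate _≟ₛ_ (concatMap sides P)

polyominoGraph : List Cell → Graph
polyominoGraph P = record
  { V        = Point
  ; _≟_      = _≟ₚ_
  ; vertices = deduplicate _≟ₚ_ (concatMap corners P)
  ; edges    = figure P
  ; unique   = Uniqueₚ.deduplicate-! _≟ₚ_ (concatMap corners P)
  ; ends     = All.tabulate λ s∈ →
      let c , c∈P , s∈c = find (∈-concatMap⁻ sides {P} (∈-deduplicate⁻ _≟ₛ_ (concatMap sides P) s∈))
          u∈c , v∈c     = ends-in c s∈c
      in ∈-deduplicate⁺ _≟ₚ_ (∈-concatMap⁺ corners {P} (lose c∈P u∈c))
       , ∈-deduplicate⁺ _≟ₚ_ (∈-concatMap⁺ corners {P} (lose c∈P v∈c))
  ; loopless = All.map oriented⇒≢ all-oriented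
  ; simple   = distinct all-oriented (Uniqueₚ.deduplicate-! _≟ₛ_ (concatMap sides P))
  }
  where
  ends-in : ∀ c {u v} → (u , v) ∈ sides c → u ∈ corners c × v ∈ corners c
  ends-in c (here refl)                         = here refl , there (here refl)
  ends-in c (there (here refl))                 = here refl , there (there (here refl))
  ends-in c (there (there (here refl)))         =
    there (there (here refl)) , there (there (there (here refl)))
  ends-in c (there (there (there (here refl)))) =
    there (here refl) , there (there (there (here refl)))

  Oriented : Side → Set
  Oriented (u , v) = v ≡ east u ⊎ v ≡ north u

  oriented : ∀ c {s} → s ∈ sides c → Oriented s
  oriented c (here refl)                         = inj₁ refl
  oriented c (there (here refl))                 = inj₂ refl
  oriented c (there (there (here refl)))         = inj₁ refl
  oriented c (there (there (there (here refl)))) = inj₂ refl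

  all-oriented : All Oriented (figure P)
  all-oriented = All.tabulate λ s∈ →
    let c , _ , s∈c = find (∈-concatMap⁻ sides {P} (∈-deduplicate⁻ _≟ₛ_ (concatMap sides P) s∈))
    in oriented c s∈c

  oriented⇒< : ∀ {u v} → Oriented (u , v) →
               proj₁ u ℤ.+ proj₂ u ℤ.< proj₁ v ℤ.+ proj₂ v
  oriented⇒< {x , y} (inj₁ refl) = ℤₚ.+-monoˡ-< y (i<suc[i] x)
  oriented⇒< {x , y} (inj₂ refl) = ℤₚ.+-monoʳ-< x (i<suc[i] y)

  oriented⇒≢ : ∀ {s} → Oriented s → proj₁ s ≢ proj₂ s
  oriented⇒≢ o refl = ℤₚ.<-irrefl refl (oriented⇒< o)

  distinct : ∀ {xs} → All Oriented xs → Unique xs → AllPairs (λ e f → e ≢ f × e ≢ swap f) xs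
  distinct []       []       = []
  distinct (o ∷ os) (d ∷ ds) =
    All.zipWith (λ (o′ , e≢f) → e≢f , λ { refl → ℤₚ.<-asym (oriented⇒< o) (oriented⇒< o′) }) (os , d)
    ∷ distinct os ds

Adjacent : Cell → Cell → Set
Adjacent c d = c ≢ d × Any (_∈ sides d) (sides c)

adjacent? : ∀ c d → Dec (Adjacent c d)
adjacent? c d = ¬? (c ≟ₚ d) ×-dec any? (_∈ₛ? sides d) (sides c)

neighbours : List Cell → Cell → List Cell
neighbours P c = filter (adjacent? c) P

-- Two unit squares of the grid meet along a side that is not drawn.  The
-- regions of the plane cut out by the figure are the classes of the
-- equivalence relation generated by this relation.
Open : List Cell → Cell → Cell → Set
Open P c d = ∃[ s ] s ∈ sides c × s ∈ sides d × s ∉ figure P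

SameRegion : List Cell → Cell → Cell → Set
SameRegion P = Star (Open P)

-- Every square of P is a region on its own, since all its sides are drawn; so
-- the internal regions are exactly the squares of P as soon as the remaining
-- squares of the grid form a single region.
record IsPolyominoSystem (P : List Cell) : Set where
  field
    unique    : Unique P
    connected : ∀ {c d} → c ∈ P → d ∈ P → Star (λ a b → Adjacent a b × b ∈ P) c d
    external  : ∀ {c d} → c ∉ P → d ∉ P → SameRegion P c d

-- The squares are listed in their linear order.
record IsPolyominoChain (P : List Cell) : Set where
  field
    isSystem      : IsPolyominoSystem P
    at-most-two   : ∀ {c} → c ∈ P → length (neighbours P c) ℕ.≤ 2
    linear-order  : ∀ i j → Adjacent (lookup P i) (lookup P j) ⇔
                            (toℕ j ≡ suc (toℕ i) ⊎ toℕ i ≡ suc (toℕ j))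

Terminal NonTerminal Kink : List Cell → Cell → Set
Terminal    P c = c ∈ P × length (neighbours P c) ≡ 1
NonTerminal P c = c ∈ P × length (neighbours P c) ≡ 2
Kink        P c = NonTerminal P c × Any (λ v → degree (polyominoGraph P) v ≡ 2) (corners c)

-- Kinks are those of S considered as a chain by itself.
IsLinearChain : List Cell → Set
IsLinearChain S = IsPolyominoChain S × (∀ c → ¬ Kink S c)

-- The squares of P are pairwise distinct, so a run of consecutive squares of P
-- is determined by the list of its squares.
IsSegment : List Cell → List Cell → Set
IsSegment P S = Infix _≡_ S P × IsLinearChain S ×
                (∀ T → Infix _≡_ T P → IsLinearChain T → Infix _≡_ S T → T ≡ S)

External Internal : List Cell → List Cell → Set
External P S = Any (Terminal P) S
Internal P S = ¬ External P S

Ω : ℕ → List Cell → Set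
Ω n P = IsPolyominoChain P × length P ≡ n ×
  (∀ S → IsSegment P S → Internal P S → length S ≡ 3 →
     ¬ Any (λ (u , v) → degree (polyominoGraph P) u ≡ 3 × degree (polyominoGraph P) v ≡ 3)
           (figure S))

{-# OPTIONS --safe #-}

-- Read the chain as a walk that goes straight or turns in each non-terminal
-- square; the kinks are the turns.  Two squares meeting only in a corner would
-- enclose a square (a parity argument along the ray from a cell), so the degree of
-- a vertex is one plus the number of consecutive squares around it, and the sides
-- of a square have weights depending only on the turns in it and its two
-- neighbours.  Turns to the same side are excluded at distance 1 by the linear
-- order and at distance 2 by Ω.
--
-- The equation for α says 5^α + 2·7^α = 3·6^α.  So with u = 6^α − 7^α and
-- z = 7^α − 8^α an isolated kink changes the index by nothing, whereas two
-- consecutive kinks cost u + z and a kink next to a terminal square costs u.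
-- Since α < −1, u and z are positive, and these are exactly the configurations
-- producing segments of length 2.

module Submission where

open import Data.Integer using (+_; -[1+_])
open import Data.List using (List; length)
open import Data.Nat as ℕ using (ℕ)
open import Data.Product using (∃-syntax; _×_)
open import Data.Rational using (1ℚ; _/_)
open import Function using (_⇔_)
open import Relation.Binary.PropositionalEquality using (_≡_)
open import Relation.Nullary using (¬_)
open import Defs

open import Algebra.Bundles using (AbelianGroup; CommutativeMonoid; CommutativeRing)
import Algebra.Properties.CommutativeSemiring.Exp as CExp
import Algebra.Properties.Monoid.Mult as Mult
import Algebra.Properties.Semiring.Exp as Exp
import Algebra.Solver.CommutativeMonoid as CMSolver
open import Algebra.Structures using (IsAbelianGroup)
open import Data.Bool using (Bool; true; false; _∧_; _∨_; _xor_; if_then_else_)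
open import Data.Bool.Properties using (∧-zeroʳ; ∨-comm; xor-same; xor-comm; xor-identityʳ)
open import Data.Bool.Solver using (module xor-∧-Solver)
open import Data.Empty using (⊥; ⊥-elim)
open import Data.Fin using (toℕ; zero; suc)
open import Data.Integer as ℤ using (ℤ)
import Data.Integer.Properties as ℤₚ
open import Data.Integer.Solver using () renaming (module +-*-Solver to ℤ-Solver)
open import Data.List using ([]; _∷_; _++_; _∷ʳ_; _∷ʳ′_; concatMap; filter; foldr; initLast; lookup; map)
open import Data.List.Membership.DecPropositional _≟ₚ_ using (_∈?_)
open import Data.List.Membership.DecPropositional _≟ₛ_ using () renaming (_∈?_ to _∈ₛ?_)
open import Data.List.Membership.Propositional using (_∈_; _∉_; find; lose)
open import Data.List.Membership.Propositional.Properties using (∈-++⁺ˡ; ∈-++⁺ʳ; ∈-++⁻; ∈-concatMap⁺; ∈-concatMap⁻; ∈-deduplicate⁺; ∈-deduplicate⁻; ∈-filter⁺; ∈-filter⁻; ∈-map⁺; ∈-map⁻)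
open import Data.List.Membership.Propositional.Properties.WithK using (unique∧set⇒bag)
open import Data.List.Properties using (++-assoc; ++-identityʳ; filter-++; foldr-cong; length-++; length-map; ∷-injectiveˡ; ∷-injectiveʳ)
open import Data.List.Relation.Binary.BagAndSetEquality using (∼bag⇒↭)
open import Data.List.Relation.Binary.Infix.Heterogeneous using (Infix; MkView; fromView; toView)
open import Data.List.Relation.Binary.Permutation.Propositional using (_↭_)
open import Data.List.Relation.Binary.Permutation.Propositional.Properties using (↭-length)
open import Data.List.Relation.Binary.Pointwise using (Pointwise-≡⇒≡; ≡⇒Pointwise-≡)
open import Data.List.Relation.Unary.All as All using ([]; _∷_)
open import Data.List.Relation.Unary.AllPairs using ([]; _∷_)
open import Data.List.Relation.Unary.Any using (Any; here; there)
open import Data.List.Relation.Unary.Linked using (Linked; []; [-]; _∷_)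
import Data.List.Relation.Unary.Unique.DecPropositional.Properties as Uniqueₚ
open import Data.List.Relation.Unary.Unique.Propositional using (Unique)
import Data.List.Relation.Unary.Unique.Propositional.Properties as Unique-Properties
open import Data.Nat using (zero; suc)
import Data.Nat.Properties as ℕₚ
open import Data.Nat.Solver using () renaming (module +-*-Solver to ℕ-Solver)
open import Data.Product using (_,_; map₂; proj₁; proj₂)
open import Data.Rational as ℚ using (ℚ; 0ℚ; 1/_)
open import Data.Rational.Literals using (fromℤ)
import Data.Rational.Properties as ℚₚ
open import Data.Rational.Solver using () renaming (module +-*-Solver to ℚ-Solver)
import Data.Rational.Unnormalised as ℚᵘ
import Data.Rational.Unnormalised.Properties as ℚᵘₚ
open import Data.Sum as Sum using (_⊎_; inj₁; inj₂)
open import Data.Unit using (⊤; tt)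
open import Function using (Equivalence; mk⇔)
open import Level using (0ℓ)
import Level
open import Relation.Binary.Construct.Closure.ReflexiveTransitive using (Star; _◅_; _◅◅_) renaming (ε to nil; map to Star-map; reverse to Star-reverse)
open import Relation.Binary.PropositionalEquality using (_≢_; ≢-sym; refl; sym; trans; cong; cong₂; subst; subst₂; module ≡-Reasoning)
import Relation.Binary.Reasoning.Setoid as SetoidReasoning
open import Relation.Binary.Structures using (IsEquivalence)
open import Relation.Nullary using (yes; no; does; _⊎-dec_)
open import Relation.Nullary.Decidable using (dec-true; dec-false; from-yes)
open import Relation.Unary using (Decidable)

open Graph using (degree)
open ℝ
open Exp (CommutativeRing.semiring ℚₚ.+-*-commutativeRing) using (_^_)
open CExp (CommutativeRing.commutativeSemiring ℚₚ.+-*-commutativeRing) using (^-distrib-*)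

-- That an isolated kink costs nothing holds only after summing over three squares: it takes `u`
-- away before itself, adds `3u` in its own square, and takes away `2u` after it. The induction
-- along the chain therefore carries a boundary correction that depends on the flags of two
-- neighbouring squares. The corrections are placed on opposite sides of the equation, so that
-- everything happens in a commutative monoid, where the solver applies. Inverses come in once, at
-- the end.
--
-- Order and equality of Dedekind reals are not decidable. The equality case is read off the Boolean
-- word of kinks instead: this word decides whether the loss is positive or zero, and independently
-- whether there is a segment of length 2.
--
-- Degrees depend on squares that are absent, diagonal ones included. This is why corner contacts
-- must be excluded, and the connectedness of the exterior is what excludes them. Conversely a
-- segment must be a polyomino chain by itself, so the exterior of a straight row has to be shown
-- connected.
--
-- At least three squares are needed: two squares form a segment of length 2, and yet their loss is
-- zero.

bit : Bool → ℕ
bit false = 0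
bit true  = 1

headBit : List Bool → Bool
headBit []      = false
headBit (k ∷ _) = k

-- Sum and loss of a word of kink flags

module Loss {c} {Carrier : Set c} (_∙_ : Carrier → Carrier → Carrier) (ε : Carrier) where

  -- The bound minus the index: v for each pair of consecutive kinks, u for a
  -- kink next to a terminal square.  The first flag is that of the square before.
  lossFrom : Carrier → Carrier → Bool → List Bool → Carrier
  lossFrom u v k₋ []       = if k₋ then u else ε
  lossFrom u v k₋ (k ∷ ks) = (if k₋ ∧ k then v else ε) ∙ lossFrom u v k ks

  loss : Carrier → Carrier → List Bool → Carrier
  loss u v ks = (if headBit ks then u else ε) ∙ lossFrom u v false ks

module Contributions {c ℓ} (M : CommutativeMonoid c ℓ) where

  open CommutativeMonoid M renaming (refl to ≈-refl; sym to ≈-sym; trans to ≈-trans)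
  open SetoidReasoning setoid
  open CMSolver M
  open Loss _∙_ ε

  -- The contribution of a non-terminal square, not counting the side it shares
  -- with its successor; the flags say whether its predecessor, the square
  -- itself and its successor are kinks.
  inner : (ℕ → Carrier) → Bool → Bool → Bool → Carrier
  inner f k₋ false k₊ = f (6 ℕ.+ bit k₋) ∙ (f (6 ℕ.+ bit (k₋ ∨ k₊)) ∙ f (6 ℕ.+ bit (k₋ ∧ k₊)))
  inner f k₋ true  k₊ = f (7 ℕ.+ bit k₋) ∙ (f (5 ℕ.+ bit k₋) ∙ f (5 ℕ.+ bit k₊))

  lastSum : (ℕ → Carrier) → Bool → Carrier
  lastSum f k₋ = f (6 ℕ.+ bit k₋) ∙ (f 5 ∙ (f (5 ℕ.+ bit k₋) ∙ f 4))

  sumFrom : (ℕ → Carrier) → Bool → List Bool → Carrier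
  sumFrom f k₋ []       = lastSum f k₋
  sumFrom f k₋ (k ∷ ks) = inner f k₋ k (headBit ks) ∙ sumFrom f k ks

  firstSum : (ℕ → Carrier) → Bool → Carrier
  firstSum f k = f 4 ∙ (f 5 ∙ f (5 ℕ.+ bit k))

  total : (ℕ → Carrier) → List Bool → Carrier
  total f ks = firstSum f (headBit ks) ∙ sumFrom f false ks

  module _ {f g : ℕ → Carrier} (f≈g : ∀ n → f n ≈ g n) where

    sumFrom-cong : ∀ k₋ ks → sumFrom f k₋ ks ≈ sumFrom g k₋ ks
    sumFrom-cong k₋ []           = ∙-cong (f≈g _) (∙-cong (f≈g _) (∙-cong (f≈g _) (f≈g _)))
    sumFrom-cong k₋ (false ∷ ks) =
      ∙-cong (∙-cong (f≈g _) (∙-cong (f≈g _) (f≈g _))) (sumFrom-cong false ks)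
    sumFrom-cong k₋ (true ∷ ks)  =
      ∙-cong (∙-cong (f≈g _) (∙-cong (f≈g _) (f≈g _))) (sumFrom-cong true ks)

    total-cong : ∀ ks → total f ks ≈ total g ks
    total-cong ks = ∙-cong (∙-cong (f≈g _) (∙-cong (f≈g _) (f≈g _))) (sumFrom-cong false ks)

  -- With f 5 - f 6 = 2 (f 6 - f 7), the free parameters are f 4, w = f 8,
  -- z = f 7 - f 8 and u = f 6 - f 7.
  module _ (f : ℕ → Carrier) (w z u : Carrier) where

    profile : ℕ → Carrier
    profile 5 = w ∙ z ∙ u ∙ u ∙ u
    profile 6 = w ∙ z ∙ u
    profile 7 = w ∙ z
    profile 8 = w
    profile n = f n

    private
      six : Carrier
      six = profile 6

    -- The value of a remainder in which every side has weight `six`, apart from the last square: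
    -- its two sides of weight `profile 5` exceed `six` by `u ∙ u` each, and its end side has weight
    -- `f 4`.
    base : ℕ → Carrier
    base zero    = six ∙ (six ∙ (six ∙ (f 4 ∙ (u ∙ u ∙ u ∙ u))))
    base (suc m) = six ∙ (six ∙ (six ∙ base m))

    -- The boundary correction at the cut between a square and its successor. After a kink followed
    -- by a non-kink the remainder is `u ∙ u` too small; before a kink preceded by a non-kink it is
    -- `u` too large. Equal flags are in balance.
    surplus deficit : Bool → Bool → Carrier
    surplus true  false = u ∙ u
    surplus _     _     = ε
    deficit false true  = u
    deficit _     _     = ε

    private
      variable
        n : ℕ

      s5 s6 : Expr n → Expr n → Expr n → Expr n
      s5 w z u = (((w ⊕ z) ⊕ u) ⊕ u) ⊕ u
      s6 w z u = (w ⊕ z) ⊕ u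

      s7 : Expr n → Expr n → Expr n
      s7 w z = w ⊕ z

    -- The solver cannot use the hypothesis `ih`. Each case therefore first regroups the left side
    -- so that the left side of `ih` stands as one block, replaces the block, and normalises again.
    sumFrom-step : ∀ k₋ k k₊ {B L R} → B ∙ L ∙ surplus k k₊ ≈ R ∙ deficit k k₊ →
      (inner profile k₋ k k₊ ∙ B) ∙ ((if k₋ ∧ k then u ∙ z else ε) ∙ L) ∙ surplus k₋ k
        ≈ six ∙ (six ∙ (six ∙ R)) ∙ deficit k₋ k
    sumFrom-step false false false {B} {L} {R} ih = ≈-trans
      (solve 5 (λ w z u B L → (((s6 w z u ⊕ (s6 w z u ⊕ s6 w z u)) ⊕ B) ⊕ ((id) ⊕ L)) ⊕ (id)
        ⊜ (s6 w z u ⊕ (s6 w z u ⊕ s6 w z u)) ⊕ ((B ⊕ L) ⊕ (id))) ≈-refl w z u B L)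
      (≈-trans (∙-congˡ ih)
      (solve 4 (λ w z u R → (s6 w z u ⊕ (s6 w z u ⊕ s6 w z u)) ⊕ (R ⊕ (id))
        ⊜ (s6 w z u ⊕ (s6 w z u ⊕ (s6 w z u ⊕ R))) ⊕ (id)) ≈-refl w z u R))
    sumFrom-step false false true  {B} {L} {R} ih = ≈-trans
      (solve 5 (λ w z u B L → (((s6 w z u ⊕ (s7 w z ⊕ s6 w z u)) ⊕ B) ⊕ ((id) ⊕ L)) ⊕ (id)
        ⊜ (s7 w z ⊕ (s6 w z u ⊕ s6 w z u)) ⊕ ((B ⊕ L) ⊕ (id))) ≈-refl w z u B L)
      (≈-trans (∙-congˡ ih)
      (solve 4 (λ w z u R → (s7 w z ⊕ (s6 w z u ⊕ s6 w z u)) ⊕ (R ⊕ (u))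
        ⊜ (s6 w z u ⊕ (s6 w z u ⊕ (s6 w z u ⊕ R))) ⊕ (id)) ≈-refl w z u R))
    sumFrom-step false true  false {B} {L} {R} ih = ≈-trans
      (solve 5 (λ w z u B L → (((s7 w z ⊕ (s5 w z u ⊕ s5 w z u)) ⊕ B) ⊕ ((id) ⊕ L)) ⊕ (id)
        ⊜ ((s6 w z u ⊕ u) ⊕ (s6 w z u ⊕ s6 w z u)) ⊕ ((B ⊕ L) ⊕ (u ⊕ u))) ≈-refl w z u B L)
      (≈-trans (∙-congˡ ih)
      (solve 4 (λ w z u R → ((s6 w z u ⊕ u) ⊕ (s6 w z u ⊕ s6 w z u)) ⊕ (R ⊕ (id))
        ⊜ (s6 w z u ⊕ (s6 w z u ⊕ (s6 w z u ⊕ R))) ⊕ (u)) ≈-refl w z u R))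
    sumFrom-step false true  true  {B} {L} {R} ih = ≈-trans
      (solve 5 (λ w z u B L → (((s7 w z ⊕ (s5 w z u ⊕ s6 w z u)) ⊕ B) ⊕ ((id) ⊕ L)) ⊕ (id)
        ⊜ ((s6 w z u ⊕ u) ⊕ (s6 w z u ⊕ s6 w z u)) ⊕ ((B ⊕ L) ⊕ (id))) ≈-refl w z u B L)
      (≈-trans (∙-congˡ ih)
      (solve 4 (λ w z u R → ((s6 w z u ⊕ u) ⊕ (s6 w z u ⊕ s6 w z u)) ⊕ (R ⊕ (id))
        ⊜ (s6 w z u ⊕ (s6 w z u ⊕ (s6 w z u ⊕ R))) ⊕ (u)) ≈-refl w z u R))
    sumFrom-step true  false false {B} {L} {R} ih = ≈-trans
      (solve 5 (λ w z u B L → (((s7 w z ⊕ (s7 w z ⊕ s6 w z u)) ⊕ B) ⊕ ((id) ⊕ L)) ⊕ (u ⊕ u)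
        ⊜ (s6 w z u ⊕ (s6 w z u ⊕ s6 w z u)) ⊕ ((B ⊕ L) ⊕ (id))) ≈-refl w z u B L)
      (≈-trans (∙-congˡ ih)
      (solve 4 (λ w z u R → (s6 w z u ⊕ (s6 w z u ⊕ s6 w z u)) ⊕ (R ⊕ (id))
        ⊜ (s6 w z u ⊕ (s6 w z u ⊕ (s6 w z u ⊕ R))) ⊕ (id)) ≈-refl w z u R))
    sumFrom-step true  false true  {B} {L} {R} ih = ≈-trans
      (solve 5 (λ w z u B L → (((s7 w z ⊕ (s7 w z ⊕ s7 w z)) ⊕ B) ⊕ ((id) ⊕ L)) ⊕ (u ⊕ u)
        ⊜ (s7 w z ⊕ (s6 w z u ⊕ s6 w z u)) ⊕ ((B ⊕ L) ⊕ (id))) ≈-refl w z u B L)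
      (≈-trans (∙-congˡ ih)
      (solve 4 (λ w z u R → (s7 w z ⊕ (s6 w z u ⊕ s6 w z u)) ⊕ (R ⊕ (u))
        ⊜ (s6 w z u ⊕ (s6 w z u ⊕ (s6 w z u ⊕ R))) ⊕ (id)) ≈-refl w z u R))
    sumFrom-step true  true  false {B} {L} {R} ih = ≈-trans
      (solve 5 (λ w z u B L → (((w ⊕ (s6 w z u ⊕ s5 w z u)) ⊕ B) ⊕ ((u ⊕ z) ⊕ L)) ⊕ (id)
        ⊜ (s6 w z u ⊕ (s6 w z u ⊕ s6 w z u)) ⊕ ((B ⊕ L) ⊕ (u ⊕ u))) ≈-refl w z u B L)
      (≈-trans (∙-congˡ ih)
      (solve 4 (λ w z u R → (s6 w z u ⊕ (s6 w z u ⊕ s6 w z u)) ⊕ (R ⊕ (id))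
        ⊜ (s6 w z u ⊕ (s6 w z u ⊕ (s6 w z u ⊕ R))) ⊕ (id)) ≈-refl w z u R))
    sumFrom-step true  true  true  {B} {L} {R} ih = ≈-trans
      (solve 5 (λ w z u B L → (((w ⊕ (s6 w z u ⊕ s6 w z u)) ⊕ B) ⊕ ((u ⊕ z) ⊕ L)) ⊕ (id)
        ⊜ (s6 w z u ⊕ (s6 w z u ⊕ s6 w z u)) ⊕ ((B ⊕ L) ⊕ (id))) ≈-refl w z u B L)
      (≈-trans (∙-congˡ ih)
      (solve 4 (λ w z u R → (s6 w z u ⊕ (s6 w z u ⊕ s6 w z u)) ⊕ (R ⊕ (id))
        ⊜ (s6 w z u ⊕ (s6 w z u ⊕ (s6 w z u ⊕ R))) ⊕ (id)) ≈-refl w z u R))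

    sumFrom-base : ∀ k₋ ks → sumFrom profile k₋ ks ∙ lossFrom u (u ∙ z) k₋ ks ∙ surplus k₋ (headBit ks)
                             ≈ base (length ks) ∙ deficit k₋ (headBit ks)
    sumFrom-base false [] = solve 4 (λ w z u f →
      ((s6 w z u ⊕ (s5 w z u ⊕ (s5 w z u ⊕ f))) ⊕ id) ⊕ id
      ⊜ (s6 w z u ⊕ (s6 w z u ⊕ (s6 w z u ⊕ (f ⊕ (((u ⊕ u) ⊕ u) ⊕ u))))) ⊕ id) ≈-refl w z u (f 4)
    sumFrom-base true  [] = solve 4 (λ w z u f →
      ((s7 w z ⊕ (s5 w z u ⊕ (s6 w z u ⊕ f))) ⊕ u) ⊕ (u ⊕ u)
      ⊜ (s6 w z u ⊕ (s6 w z u ⊕ (s6 w z u ⊕ (f ⊕ (((u ⊕ u) ⊕ u) ⊕ u))))) ⊕ id) ≈-refl w z u (f 4)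
    sumFrom-base k₋ (k ∷ ks) = sumFrom-step k₋ k (headBit ks) (sumFrom-base k ks)

    total-base : ∀ ks → total profile ks ∙ loss u (u ∙ z) ks
                        ≈ f 4 ∙ (six ∙ (six ∙ (u ∙ u ∙ u ∙ u))) ∙ base (length ks)
    total-base ks with headBit ks | sumFrom-base false ks
    ... | false | ih = ≈-trans
      (solve 6 (λ w z u f B L → ((f ⊕ (s5 w z u ⊕ s5 w z u)) ⊕ B) ⊕ (id ⊕ L)
        ⊜ (f ⊕ (s6 w z u ⊕ (s6 w z u ⊕ (((u ⊕ u) ⊕ u) ⊕ u)))) ⊕ ((B ⊕ L) ⊕ id)) ≈-refl w z u (f 4) _ _)
      (∙-congˡ (≈-trans ih (identityʳ _)))
    ... | true  | ih = ≈-trans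
      (solve 6 (λ w z u f B L → ((f ⊕ (s5 w z u ⊕ s6 w z u)) ⊕ B) ⊕ (u ⊕ L)
        ⊜ (f ⊕ ((s6 w z u ⊕ (s6 w z u ⊕ ((u ⊕ u) ⊕ u))))) ⊕ ((B ⊕ L) ⊕ id)) ≈-refl w z u (f 4) _ _)
      (≈-trans (∙-congˡ ih)
      (solve 5 (λ w z u f R → (f ⊕ ((s6 w z u ⊕ (s6 w z u ⊕ ((u ⊕ u) ⊕ u))))) ⊕ (R ⊕ u)
        ⊜ (f ⊕ (s6 w z u ⊕ (s6 w z u ⊕ (((u ⊕ u) ⊕ u) ⊕ u)))) ⊕ R) ≈-refl w z u (f 4) _))

    open Mult monoid using (×-congʳ; ×-congˡ; ×-homo-+; ×-assocˡ) renaming (_×_ to _×ᴹ_)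

    base-· : ∀ m → base m ≈ (3 ℕ.* suc m) ×ᴹ six ∙ (f 4 ∙ (u ∙ u ∙ u ∙ u))
    base-· m = ≈-trans (go m) (∙-congʳ (≈-trans (×-assocˡ six (suc m) 3) (×-congˡ (ℕₚ.*-comm (suc m) 3))))
      where
      go : ∀ m → base m ≈ suc m ×ᴹ (3 ×ᴹ six) ∙ (f 4 ∙ (u ∙ u ∙ u ∙ u))
      go zero    = solve 2 (λ s r → s ⊕ (s ⊕ (s ⊕ r)) ⊜ ((s ⊕ (s ⊕ (s ⊕ id))) ⊕ id) ⊕ r) ≈-refl six _
      go (suc m) = ≈-trans (∙-congˡ (∙-congˡ (∙-congˡ (go m))))
        (solve 3 (λ s t r → s ⊕ (s ⊕ (s ⊕ (t ⊕ r))) ⊜ ((s ⊕ (s ⊕ (s ⊕ id))) ⊕ t) ⊕ r) ≈-refl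
          six (suc m ×ᴹ (3 ×ᴹ six)) _)

    -- The two terminal squares leave an excess of `2 ×ᴹ f 4` and eight `u`, minus one `six`, over
    -- three sides of weight `six` per square. Eight `u` equal twice `profile 5` plus twice `six`
    -- minus four times `profile 7`; the last term is kept on the left to avoid inverses.
    total-bound : ∀ ks → (total profile ks ∙ loss u (u ∙ z) ks) ∙ 4 ×ᴹ profile 7
      ≈ (3 ℕ.* suc (suc (length ks))) ×ᴹ six ∙ (2 ×ᴹ f 4 ∙ 2 ×ᴹ profile 5 ∙ six)
    total-bound ks = ≈-trans (∙-congʳ (≈-trans (total-base ks) (∙-congˡ (base-· (length ks)))))
      (≈-trans (solve 5 (λ w z u f n →
          ((f ⊕ (s6 w z u ⊕ (s6 w z u ⊕ (((u ⊕ u) ⊕ u) ⊕ u)))) ⊕ (n ⊕ (f ⊕ (((u ⊕ u) ⊕ u) ⊕ u))))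
            ⊕ (s7 w z ⊕ (s7 w z ⊕ (s7 w z ⊕ (s7 w z ⊕ id))))
          ⊜ ((s6 w z u ⊕ (s6 w z u ⊕ (s6 w z u ⊕ id))) ⊕ n)
            ⊕ (((f ⊕ (f ⊕ id)) ⊕ (s5 w z u ⊕ (s5 w z u ⊕ id))) ⊕ s6 w z u))
          ≈-refl w z u (f 4) ((3 ℕ.* suc (length ks)) ×ᴹ six))
        (∙-congʳ (≈-trans (≈-sym (×-homo-+ six 3 (3 ℕ.* suc (length ks))))
          (×-congˡ (sym (ℕₚ.*-suc 3 (suc (length ks))))))))

module _ {c ℓ} (G : AbelianGroup c ℓ) where

  open AbelianGroup G renaming (_-_ to _⊝_; refl to ≈-refl; sym to ≈-sym; trans to ≈-trans)
  open Contributions commutativeMonoid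
  open Loss _∙_ ε
  open Mult monoid using (×-congʳ; ×-congˡ; ×-homo-+; ×-assocˡ) renaming (_×_ to _×ᴹ_)
  open CMSolver commutativeMonoid
  open SetoidReasoning setoid

  private
    cancel : ∀ x y → x ∙ (y ∙ x ⁻¹) ≈ y
    cancel x y = ≈-trans (solve 3 (λ x y x⁻ → x ⊕ (y ⊕ x⁻) ⊜ y ⊕ (x ⊕ x⁻)) ≈-refl x y (x ⁻¹))
      (≈-trans (∙-congˡ (inverseʳ x)) (identityʳ y))

    move : ∀ {x y z t} → x ∙ y ≈ z ∙ t → x ≈ z ∙ (t ⊝ y)
    move {x} {y} {z} {t} eq = begin
      x                     ≈⟨ cancel y x ⟨
      y ∙ (x ∙ y ⁻¹)        ≈⟨ solve 3 (λ y x y⁻ → y ⊕ (x ⊕ y⁻) ⊜ (x ⊕ y) ⊕ y⁻) ≈-refl y x (y ⁻¹) ⟩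
      x ∙ y ∙ y ⁻¹          ≈⟨ ∙-congʳ eq ⟩
      z ∙ t ∙ y ⁻¹          ≈⟨ assoc z t (y ⁻¹) ⟩
      z ∙ (t ⊝ y)           ∎

  total+loss≈bound : ∀ (f : ℕ → Carrier) → f 5 ∙ 2 ×ᴹ f 7 ≈ 3 ×ᴹ f 6 → ∀ ks →
    let u = f 6 ⊝ f 7 ; z = f 7 ⊝ f 8 in
    total f ks ∙ loss u (u ∙ z) ks
      ≈ (3 ℕ.* suc (suc (length ks))) ×ᴹ f 6 ∙ (2 ×ᴹ f 4 ∙ 2 ×ᴹ f 5 ∙ f 6 ⊝ 4 ×ᴹ f 7)
  total+loss≈bound f eq ks = begin
    total f ks ∙ loss u (u ∙ z) ks
      ≈⟨ ∙-congʳ (total-cong f≈p ks) ⟩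
    total p ks ∙ loss u (u ∙ z) ks
      ≈⟨ move (total-bound f (f 8) z u ks) ⟩
    N ×ᴹ p 6 ∙ (2 ×ᴹ f 4 ∙ 2 ×ᴹ p 5 ∙ p 6 ⊝ 4 ×ᴹ p 7)
      ≈⟨ ∙-cong (×-congʳ N (≈-sym p6)) (∙-cong (∙-cong (∙-congˡ (×-congʳ 2 (≈-sym p5))) (≈-sym p6)) (⁻¹-cong (×-congʳ 4 (≈-sym p7)))) ⟩
    N ×ᴹ f 6 ∙ (2 ×ᴹ f 4 ∙ 2 ×ᴹ f 5 ∙ f 6 ⊝ 4 ×ᴹ f 7) ∎
    where
    u = f 6 ⊝ f 7
    z = f 7 ⊝ f 8
    N = 3 ℕ.* suc (suc (length ks))
    p = profile f (f 8) z u
    p7 : f 7 ≈ p 7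
    p7 = ≈-sym (cancel (f 8) (f 7))
    p6 : f 6 ≈ p 6
    p6 = ≈-trans (≈-sym (cancel (f 7) (f 6))) (∙-congʳ p7)
    -- Here the equation for the weights enters: it makes `f 5` equal to `f 6` plus two `u`.
    p5 : f 5 ≈ p 5
    p5 = begin
      f 5                                          ≈⟨ move′ ⟩
      3 ×ᴹ f 6 ⊝ 2 ×ᴹ f 7                            ≈⟨ ∙-congʳ (×-congʳ 3 p6) ⟩
      3 ×ᴹ p 6 ⊝ 2 ×ᴹ f 7                            ≈⟨ ∙-congˡ (⁻¹-cong (×-congʳ 2 p7)) ⟩
      3 ×ᴹ p 6 ⊝ 2 ×ᴹ p 7                            ≈⟨ ∙-congʳ (solve 2 (λ s u → (s ⊕ u) ⊕ ((s ⊕ u) ⊕ ((s ⊕ u) ⊕ id)) ⊜ (s ⊕ (s ⊕ id)) ⊕ (((s ⊕ u) ⊕ u) ⊕ u)) ≈-refl (p 7) u) ⟩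
      2 ×ᴹ p 7 ∙ p 5 ⊝ 2 ×ᴹ p 7                      ≈⟨ assoc _ _ _ ⟩
      2 ×ᴹ p 7 ∙ (p 5 ⊝ 2 ×ᴹ p 7)                    ≈⟨ cancel _ _ ⟩
      p 5                                          ∎
      where
      move′ : f 5 ≈ 3 ×ᴹ f 6 ⊝ 2 ×ᴹ f 7
      move′ = ≈-trans (move (≈-trans eq (≈-sym (identityˡ _)))) (identityˡ _)
    f≈p : ∀ n → f n ≈ p n
    f≈p 0 = ≈-refl
    f≈p 1 = ≈-refl
    f≈p 2 = ≈-refl
    f≈p 3 = ≈-refl
    f≈p 4 = ≈-refl
    f≈p 5 = p5
    f≈p 6 = p6
    f≈p 7 = p7
    f≈p 8 = ≈-refl
    f≈p (suc (suc (suc (suc (suc (suc (suc (suc (suc _))))))))) = ≈-refl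

-- Dedekind reals as an ordered abelian group

0ᴿ : ℝ
0ᴿ = fromℚ 0ℚ

-- The order is defined through lower cuts, whereas negation exchanges the cuts. Locatedness carries
-- inclusions from one kind of cut to the other.
≤⇒U⊇ : ∀ x y → x ≤ y → ∀ {q} → U y q → U x q
≤⇒U⊇ x y x≤y u with U-open y u
... | q′ , q′<q , u′ with located x q′<q
...   | inj₁ l = ⊥-elim (disjoint y (x≤y l) u′)
...   | inj₂ v = v

U⊇⇒≤ : ∀ x y → (∀ {q} → U y q → U x q) → x ≤ y
U⊇⇒≤ x y U⊇ l with L-open x l
... | q′ , q<q′ , l′ with located y q<q′
...   | inj₁ m = m
...   | inj₂ u = ⊥-elim (disjoint x l′ (U⊇ u))

<⇒≤ : ∀ x y → x < y → x ≤ y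
<⇒≤ x y (_ , u , l) l′ = L-down y (L<U x l′ u) l

<⇒≱ : ∀ x y → x < y → ¬ (y ≤ x)
<⇒≱ x y (_ , u , l) y≤x = disjoint x (y≤x l) u

+-mono-≤ : ∀ x x′ y y′ → x ≤ x′ → y ≤ y′ → x + y ≤ x′ + y′
+-mono-≤ _ _ _ _ x≤ y≤ (a , b , la , lb , e) = a , b , x≤ la , y≤ lb , e

+-assoc-≤ : ∀ x y z → (x + y) + z ≤ x + (y + z)
+-assoc-≤ x y z (_ , c , (a , b , la , lb , refl) , lc , refl) =
  a , b ℚ.+ c , la , (b , c , lb , lc , refl) , ℚₚ.+-assoc a b c

+-assoc-≥ : ∀ x y z → x + (y + z) ≤ (x + y) + z
+-assoc-≥ x y z (a , _ , la , (b , c , lb , lc , refl) , refl) =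
  a ℚ.+ b , c , (a , b , la , lb , refl) , lc , sym (ℚₚ.+-assoc a b c)

+-comm-≤ : ∀ x y → x + y ≤ y + x
+-comm-≤ x y (a , b , la , lb , refl) = b , a , lb , la , ℚₚ.+-comm a b

p+q-p : ∀ p q → q ≡ p ℚ.+ (q ℚ.- p)
p+q-p = solve 2 (λ p q → q := p :+ (q :+ :- p)) refl where open ℚ-Solver

p<q⇒p-q<0 : ∀ {p q} → p ℚ.< q → p ℚ.- q ℚ.< 0ℚ
p<q⇒p-q<0 {p} {q} p<q = subst (p ℚ.- q ℚ.<_) (ℚₚ.+-inverseʳ q) (ℚₚ.+-monoˡ-< (ℚ.- q) p<q)

+-identityˡ-≤ : ∀ x → 0ᴿ + x ≤ x
+-identityˡ-≤ x (a , b , a<0 , lb , refl) =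
  L-down x (subst (a ℚ.+ b ℚ.<_) (ℚₚ.+-identityˡ b) (ℚₚ.+-monoˡ-< b a<0)) lb

+-identityˡ-≥ : ∀ x → x ≤ 0ᴿ + x
+-identityˡ-≥ x {q} l with L-open x l
... | q′ , q<q′ , l′ = q ℚ.- q′ , q′ , p<q⇒p-q<0 q<q′ , l′ , trans (p+q-p q′ q) (ℚₚ.+-comm q′ _)

+-inverseʳ-≤ : ∀ x → x + - x ≤ 0ᴿ
+-inverseʳ-≤ x (a , b , la , ub , refl) =
  subst (a ℚ.+ b ℚ.<_) (ℚₚ.+-inverseˡ b) (ℚₚ.+-monoˡ-< b (L<U x la ub))

+-inverseʳ-≥ : ∀ x → 0ᴿ ≤ x + - x
+-inverseʳ-≥ x {q} q<0 =
  -- With width `ℚ.- q` the two ends of the approximating interval are `a` and `a ℚ.- q`, whose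
  -- difference is exactly `q`.
  let a , la , ua = approx x (ℚₚ.neg-antimono-< q<0)
  in a , q ℚ.- a , la , subst (U x) (lem a q) ua , p+q-p a q
  where
  lem : ∀ a q → a ℚ.+ ℚ.- q ≡ ℚ.- (q ℚ.- a)
  lem = solve 2 (λ a q → a :+ :- q := :- (q :+ :- a)) refl where open ℚ-Solver

≃-isEquivalence : IsEquivalence _≃_
≃-isEquivalence = record
  { refl  = λ {x} → ≃-refl x
  ; sym   = λ {x} {y} → ≃-sym x y
  ; trans = λ {x} {y} {z} → ≃-trans x y z
  }
  where
  ≃-refl : ∀ x → x ≃ x
  ≃-refl x = (λ l → l) , (λ l → l)
  ≃-sym : ∀ x y → x ≃ y → y ≃ x
  ≃-sym x y (x≤y , y≤x) = y≤x , x≤y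
  ≃-trans : ∀ x y z → x ≃ y → y ≃ z → x ≃ z
  ≃-trans x y z (x≤y , y≤x) (y≤z , z≤y) = (λ l → y≤z (x≤y l)) , (λ l → y≤x (z≤y l))

+-cong : ∀ x x′ y y′ → x ≃ x′ → y ≃ y′ → x + y ≃ x′ + y′
+-cong x x′ y y′ (x≤ , x≥) (y≤ , y≥) = +-mono-≤ x x′ y y′ x≤ y≤ , +-mono-≤ x′ x y′ y x≥ y≥

+-identityʳ : ∀ x → x + 0ᴿ ≃ x
+-identityʳ x = (λ l → +-identityˡ-≤ x (+-comm-≤ x 0ᴿ l)) , (λ l → +-comm-≤ 0ᴿ x (+-identityˡ-≥ x l))

+-inverseˡ : ∀ x → - x + x ≃ 0ᴿ
+-inverseˡ x = (λ l → +-inverseʳ-≤ x (+-comm-≤ (- x) x l)) , (λ l → +-comm-≤ x (- x) (+-inverseʳ-≥ x l))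

-‿cong : ∀ x y → x ≃ y → - x ≃ - y
-‿cong x y (x≤y , y≤x) = ≤⇒U⊇ y x y≤x , ≤⇒U⊇ x y x≤y

ℝ-+-abelianGroup : AbelianGroup (Level.suc 0ℓ) 0ℓ
ℝ-+-abelianGroup = record
  { Carrier = ℝ ; _≈_ = _≃_ ; _∙_ = _+_ ; ε = 0ᴿ ; _⁻¹ = -_
  ; isAbelianGroup = record
    { isGroup = record
      { isMonoid = record
        { isSemigroup = record
          { isMagma = record
            { isEquivalence = ≃-isEquivalence
            ; ∙-cong        = λ {x} {x′} {y} {y′} → +-cong x x′ y y′
            }
          ; assoc = λ x y z → +-assoc-≤ x y z , +-assoc-≥ x y z
          }
        ; identity = (λ x → +-identityˡ-≤ x , +-identityˡ-≥ x) , +-identityʳ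
        }
      ; inverse = +-inverseˡ , (λ x → +-inverseʳ-≤ x , +-inverseʳ-≥ x)
      ; ⁻¹-cong = λ {x} {y} → -‿cong x y
      }
    ; comm = λ x y → +-comm-≤ x y , +-comm-≤ y x
    }
  }

-- A rational `q` of the lower cut of `x` gives `q ℚ.+ q` as a sum of two elements of the lower cut
-- of `y`. They cannot both be below `q`.
double-cancel-≤ : ∀ x y → x + x ≤ y + y → x ≤ y
double-cancel-≤ x y xx≤yy l with L-open x l
... | q , p<q , lq with xx≤yy (q , q , lq , lq , refl)
...   | a , b , la , lb , q+q≡a+b with ℚₚ.≤-total q a
...     | inj₁ q≤a = L-down y (ℚₚ.<-≤-trans p<q q≤a) la
...     | inj₂ a≤q = L-down y (ℚₚ.<-≤-trans p<q (ℚₚ.≮⇒≥ λ b<q →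
  ℚₚ.<-irrefl (sym q+q≡a+b) (ℚₚ.+-mono-≤-< a≤q b<q))) lb

-- Repeated addition, recursive as _·_ on ℝ.
infixr 7 _⊗_
_⊗_ : ℕ → ℚ → ℚ
zero  ⊗ q = 0ℚ
suc m ⊗ q = q ℚ.+ m ⊗ q

⊗≡* : ∀ m q → m ⊗ q ≡ fromℤ (+ m) ℚ.* q
⊗≡* zero    q = sym (ℚₚ.*-zeroˡ q)
⊗≡* (suc m) q = trans (cong (q ℚ.+_) (⊗≡* m q)) (trans
  (solve 2 (λ q m → q :+ m :* q := (con 1ℚ :+ m) :* q) refl q (fromℤ (+ m)))
  (cong (ℚ._* q) (sym suc-m)))
  where
  open ℚ-Solver
  suc-m : fromℤ (+ suc m) ≡ 1ℚ ℚ.+ fromℤ (+ m)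
  suc-m = trans (sym (ℚₚ.↥p/↧p≡p (fromℤ (+ suc m))))
    (trans (/-+ (+ 1) (+ m) 0) (cong (1ℚ ℚ.+_) (ℚₚ.↥p/↧p≡p (fromℤ (+ m)))))

p-q<r : ∀ {p q r} → p ℚ.< q ℚ.+ r → p ℚ.- q ℚ.< r
p-q<r {p} {q} {r} p<q+r = subst (p ℚ.- q ℚ.<_) (lem q r) (ℚₚ.+-monoˡ-< (ℚ.- q) p<q+r)
  where
  lem : ∀ q r → q ℚ.+ r ℚ.- q ≡ r
  lem = solve 2 (λ q r → q :+ r :+ :- q := r) refl where open ℚ-Solver

r<p-q : ∀ {p q r} → q ℚ.+ r ℚ.< p → r ℚ.< p ℚ.- q
r<p-q {p} {q} {r} q+r<p = subst (ℚ._< p ℚ.- q) (lem q r) (ℚₚ.+-monoˡ-< (ℚ.- q) q+r<p)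
  where
  lem : ∀ q r → q ℚ.+ r ℚ.- q ≡ r
  lem = solve 2 (λ q r → q :+ r :+ :- q := r) refl where open ℚ-Solver

-- Strictness of `r ℚ.< m ⊗ q` is what the empty sum needs: its lower cut consists of the negative
-- rationals.
L-· : ∀ x m {q r} → L x q → r ℚ.< m ⊗ q → L (m · x) r
L-· x zero    l r<0 = r<0
L-· x (suc m) {q} {r} l r<  = q , r ℚ.- q , l , L-· x m l (p-q<r {r} {q} r<) , p+q-p q r

U-· : ∀ x m {q r} → U x q → m ⊗ q ℚ.< r → U (m · x) r
U-· x zero    u 0<r = 0<r
U-· x (suc m) {q} {r} u <r  = q , r ℚ.- q , u , U-· x m u (r<p-q {r} {q} <r) , p+q-p q r

-- Real powers

n/n≡1 : ∀ n → + suc n / suc n ≡ 1ℚ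
n/n≡1 n = ℚₚ.toℚᵘ-injective (ℚᵘₚ.≃-trans (ℚₚ.toℚᵘ-fromℚᵘ (ℚᵘ.mkℚᵘ (+ suc n) n))
  (ℚᵘ.*≡* (ℤₚ.*-comm (+ suc n) (+ 1))))

/-shift : ∀ m n → (m ℤ.- + suc n) / suc n ≡ m / suc n ℚ.- 1ℚ
/-shift m n = trans (/-+ m (ℤ.- + suc n) n)
  (cong (m / suc n ℚ.+_) (trans (neg-/ (+ suc n) n) (cong ℚ.-_ (n/n≡1 n))))

s+1-1 : ∀ s → s ℚ.+ 1ℚ ℚ.- 1ℚ ≡ s
s+1-1 = solve 1 (λ s → s :+ con 1ℚ :+ :- con 1ℚ := s) refl where open ℚ-Solver

L-shift : ∀ x m n → L (x + fromℚ 1ℚ) (m / suc n) → L x ((m ℤ.- + suc n) / suc n)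
L-shift x m n (s , t , ls , t<1 , eq) = L-down x
  (subst₂ ℚ._<_ (sym (trans (/-shift m n) (cong (ℚ._- 1ℚ) eq))) (s+1-1 s)
    (ℚₚ.+-monoˡ-< (ℚ.- 1ℚ) (ℚₚ.+-monoʳ-< s t<1))) ls

U-shift : ∀ x m n → U (x + fromℚ 1ℚ) (m / suc n) → U x ((m ℤ.- + suc n) / suc n)
U-shift x m n (s , t , us , 1<t , eq) = U-up x
  (subst₂ ℚ._<_ (s+1-1 s) (sym (trans (/-shift m n) (cong (ℚ._- 1ℚ) eq)))
    (ℚₚ.+-monoˡ-< (ℚ.- 1ℚ) (ℚₚ.+-monoʳ-< s 1<t))) us

nonNeg-* : ∀ {p q} → 0ℚ ℚ.≤ p → 0ℚ ℚ.≤ q → 0ℚ ℚ.≤ p ℚ.* q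
nonNeg-* {p} {q} 0≤p 0≤q = ℚₚ.nonNegative⁻¹ (p ℚ.* q)
  {{ℚₚ.nonNeg*nonNeg⇒nonNeg p {{ℚ.nonNegative 0≤p}} q {{ℚ.nonNegative 0≤q}}}}

module _ (c : ℚ) .{{_ : ℚ.Positive c}} where

  private instance
    c≢0 : ℚ.NonZero c
    c≢0 = ℚₚ.pos⇒nonZero c

  0≤1/ : 0ℚ ℚ.≤ 1/ c
  0≤1/ = ℚₚ.<⇒≤ (ℚₚ.positive⁻¹ (1/ c) {{ℚₚ.1/pos⇒pos c}})

  *-1/-cancel : ∀ q → c ℚ.* (q ℚ.* 1/ c) ≡ q
  *-1/-cancel q = trans (solve 3 (λ c q d → c :* (q :* d) := q :* (c :* d)) refl c q (1/ c))
    (trans (cong (q ℚ.*_) (ℚₚ.*-inverseʳ c)) (ℚₚ.*-identityʳ q))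
    where open ℚ-Solver

  ^ℤ-+ : ∀ m k → c ^ℤ (m ℤ.+ + k) ≡ c ^ℤ m ℚ.* c ^ k
  ^ℤ-+ m zero    = trans (cong (c ^ℤ_) (ℤₚ.+-identityʳ m)) (sym (ℚₚ.*-identityʳ _))
  ^ℤ-+ m (suc k) = begin
    c ^ℤ (m ℤ.+ + suc k)            ≡⟨ cong (c ^ℤ_) (solve 2 (λ m k → m :+ (con (+ 1) :+ k) := con (+ 1) :+ (m :+ k)) refl m (+ k)) ⟩
    c ^ℤ ℤ.suc (m ℤ.+ + k)          ≡⟨ ^ℤ-suc c (m ℤ.+ + k) ⟩
    c ℚ.* c ^ℤ (m ℤ.+ + k)          ≡⟨ cong (c ℚ.*_) (^ℤ-+ m k) ⟩
    c ℚ.* (c ^ℤ m ℚ.* c ^ k)        ≡⟨ swap-* c (c ^ℤ m) (c ^ k) ⟩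
    c ^ℤ m ℚ.* (c ℚ.* c ^ k)        ∎
    where
    open ≡-Reasoning
    open ℤ-Solver
    swap-* : ∀ a b d → a ℚ.* (b ℚ.* d) ≡ b ℚ.* (a ℚ.* d)
    swap-* = ℚ-Solver.solve 3 (λ a b d → a ℚ-Solver.:* (b ℚ-Solver.:* d) ℚ-Solver.:= b ℚ-Solver.:* (a ℚ-Solver.:* d)) refl

  ^ℤ-− : ∀ m k → c ^ℤ (m ℤ.- + k) ≡ c ^ℤ m ℚ.* (1/ c) ^ k
  ^ℤ-− m k = begin
    c ^ℤ (m ℤ.- + k)                                    ≡⟨ ℚₚ.*-identityʳ _ ⟨
    c ^ℤ (m ℤ.- + k) ℚ.* 1ℚ                             ≡⟨ cong (c ^ℤ (m ℤ.- + k) ℚ.*_) (cancel k) ⟨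
    c ^ℤ (m ℤ.- + k) ℚ.* (c ^ k ℚ.* (1/ c) ^ k)         ≡⟨ ℚₚ.*-assoc (c ^ℤ (m ℤ.- + k)) (c ^ k) ((1/ c) ^ k) ⟨
    c ^ℤ (m ℤ.- + k) ℚ.* c ^ k ℚ.* (1/ c) ^ k           ≡⟨ cong (ℚ._* (1/ c) ^ k) (^ℤ-+ (m ℤ.- + k) k) ⟨
    c ^ℤ (m ℤ.- + k ℤ.+ + k) ℚ.* (1/ c) ^ k             ≡⟨ cong (λ j → c ^ℤ j ℚ.* (1/ c) ^ k) (solve 2 (λ m k → m :+ :- k :+ k := m) refl m (+ k)) ⟩
    c ^ℤ m ℚ.* (1/ c) ^ k                               ∎
    where
    open ≡-Reasoning
    open ℤ-Solver
    1^ : ∀ k → 1ℚ ^ k ≡ 1ℚ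
    1^ zero    = refl
    1^ (suc k) = trans (ℚₚ.*-identityˡ _) (1^ k)
    cancel : ∀ k → c ^ k ℚ.* (1/ c) ^ k ≡ 1ℚ
    cancel k = trans (sym (^-distrib-* c (1/ c) k)) (trans (cong (_^ k) (ℚₚ.*-inverseʳ c)) (1^ k))

module _ (b : ℕ) (1≤c : 1ℚ ℚ.≤ fromℤ (+ suc b)) (x : ℝ) where

  private
    c = fromℤ (+ suc b)

  ⊗-1/ : ∀ q → suc b ⊗ (q ℚ.* 1/ c) ≡ q
  ⊗-1/ q = trans (⊗≡* (suc b) (q ℚ.* 1/ c)) (*-1/-cancel c q)

  /c-mono-< : ∀ {p q} → p ℚ.< q → p ℚ.* 1/ c ℚ.< q ℚ.* 1/ c
  /c-mono-< = ℚₚ.*-monoˡ-<-pos (1/ c) {{ℚₚ.1/pos⇒pos c}}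

  -- If `a ^ suc n` is at most `c ^ℤ m`, then dividing by `c ^ suc n` shows that `a` divided by `c`
  -- belongs to the exponent `m / suc n` lowered by 1. The intermediate `q′` leaves room for the
  -- strict inequality in `L-·`.
  power-suc-≤ : power c 1≤c (x + fromℚ 1ℚ) ≤ suc b · power c 1≤c x
  power-suc-≤ {q} (a , q<a , 0≤a , m , n , l , a^≤) =
    let q′ , q<q′ , q′<a = ℚₚ.<-dense q<a in
    L-· (power c 1≤c x) (suc b)
      (a ℚ.* 1/ c , /c-mono-< q′<a , nonNeg-* 0≤a (0≤1/ c) , m ℤ.- + suc n , n , L-shift x m n l ,
        subst₂ ℚ._≤_ (sym (^-distrib-* a (1/ c) (suc n))) (sym (^ℤ-− c m (suc n)))
          (ℚₚ.*-monoʳ-≤-nonNeg ((1/ c) ^ suc n) {{ℚ.nonNegative (0≤^ (suc n) (0≤1/ c))}} a^≤))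
      (subst (q ℚ.<_) (sym (⊗-1/ q′)) q<q′)

  -- Done on upper cuts: a member of the lower cut of the multiple would come as a sum of different
  -- rationals, whereas an upper bound of the power is a single rational to be divided by `c`.
  power-suc-≥ : suc b · power c 1≤c x ≤ power c 1≤c (x + fromℚ 1ℚ)
  power-suc-≥ = U⊇⇒≤ (suc b · power c 1≤c x) (power c 1≤c (x + fromℚ 1ℚ))
    λ { {q} (a , a<q , 0≤a , m , n , u , ≤a^) →
      let q′ , a<q′ , q′<q = ℚₚ.<-dense a<q in
      U-· (power c 1≤c x) (suc b)
        (a ℚ.* 1/ c , /c-mono-< a<q′ , nonNeg-* 0≤a (0≤1/ c) , m ℤ.- + suc n , n , U-shift x m n u ,
          subst₂ ℚ._≤_ (sym (^ℤ-− c m (suc n))) (sym (^-distrib-* a (1/ c) (suc n)))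
            (ℚₚ.*-monoʳ-≤-nonNeg ((1/ c) ^ suc n) {{ℚ.nonNegative (0≤^ (suc n) (0≤1/ c))}} ≤a^))
        (subst (ℚ._< q) (sym (⊗-1/ q′)) q′<q) }

  power-suc : power c 1≤c (x + fromℚ 1ℚ) ≃ suc b · power c 1≤c x
  power-suc = power-suc-≤ , power-suc-≥

-- A uniform ratio `ρ` above 1 becomes an additive gap as soon as `x` exceeds a positive `l`: the
-- gap is at least `(ρ ℚ.- 1ℚ) ℚ.* l`, and `x` is approximated to that width.
scaled⇒< : ∀ x y {ρ l} → 1ℚ ℚ.< ρ → (∀ {q} → L x q → L y (ρ ℚ.* q)) → 0ℚ ℚ.< l → L x l → x < y
scaled⇒< x y {ρ} {l} 1<ρ scale 0<l ll = from-approx (approx x 0<ε)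
  where
  ε : ℚ
  ε = (ρ ℚ.- 1ℚ) ℚ.* l
  ρ-1>0 : ℚ.Positive (ρ ℚ.- 1ℚ)
  ρ-1>0 = ℚ.positive (0<- 1<ρ)
  0<ε : 0ℚ ℚ.< ε
  0<ε = ℚₚ.positive⁻¹ ε {{ℚₚ.pos*pos⇒pos (ρ ℚ.- 1ℚ) {{ρ-1>0}} l {{ℚ.positive 0<l}}}}
  q+[ρ-1]q : ∀ q ρ → q ℚ.+ (ρ ℚ.- 1ℚ) ℚ.* q ≡ ρ ℚ.* q
  q+[ρ-1]q = solve 2 (λ q ρ → q :+ (ρ :+ :- con 1ℚ) :* q := ρ :* q) refl where open ℚ-Solver
  ε-gap : ∀ {q q′} → l ℚ.≤ q → q ℚ.< q′ → q ℚ.+ ε ℚ.< ρ ℚ.* q′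
  ε-gap {q} {q′} l≤q q<q′ = begin-strict
    q ℚ.+ ε                         ≤⟨ ℚₚ.+-monoʳ-≤ q (ℚₚ.*-monoˡ-≤-nonNeg (ρ ℚ.- 1ℚ) {{ℚₚ.pos⇒nonNeg (ρ ℚ.- 1ℚ) {{ρ-1>0}}}} l≤q) ⟩
    q ℚ.+ (ρ ℚ.- 1ℚ) ℚ.* q          ≡⟨ q+[ρ-1]q q ρ ⟩
    ρ ℚ.* q                         <⟨ ℚₚ.*-monoʳ-<-pos ρ {{ℚ.positive (ℚₚ.<-trans (ℚₚ.positive⁻¹ 1ℚ) 1<ρ)}} q<q′ ⟩
    ρ ℚ.* q′                        ∎
    where open ℚₚ.≤-Reasoning
  at : ∀ {q} → l ℚ.≤ q → L x q → U x (q ℚ.+ ε) → x < y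
  at {q} l≤q lq uq =
    let q′ , q<q′ , lq′ = L-open x lq
    in q ℚ.+ ε , uq , L-down y (ε-gap l≤q q<q′) (scale lq′)
  from-approx : ∃[ q ] L x q × U x (q ℚ.+ ε) → x < y
  from-approx (q , lq , uq) with l ℚ.≤? q
  ... | yes l≤q = at l≤q lq uq
  -- An approximation below `l` is replaced by `l` itself, which also lies in the lower cut.
  ... | no  l≰q = at ℚₚ.≤-refl ll (U-up x (ℚₚ.+-monoˡ-< ε (ℚₚ.≰⇒> l≰q)) uq)

module _ (p r : ℚ) .{{_ : ℚ.Positive p}} .{{_ : ℚ.Positive r}}
         (1≤p : 1ℚ ℚ.≤ p) (1≤r : 1ℚ ℚ.≤ r) (p<r : p ℚ.< r) where

  private
    instance
      p≢0 : ℚ.NonZero p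
      p≢0 = ℚₚ.pos⇒nonZero p
      r≢0 : ℚ.NonZero r
      r≢0 = ℚₚ.pos⇒nonZero r

    ρ : ℚ
    ρ = r ℚ.* 1/ p

    1<ρ : 1ℚ ℚ.< ρ
    1<ρ = subst (ℚ._< ρ) (ℚₚ.*-inverseʳ p) (ℚₚ.*-monoˡ-<-pos (1/ p) {{ℚₚ.1/pos⇒pos p}} p<r)

    0≤ρ : 0ℚ ℚ.≤ ρ
    0≤ρ = ℚₚ.≤-trans 0≤1 (ℚₚ.<⇒≤ 1<ρ)

  1/-antimono-≤ : 1/ r ℚ.≤ 1/ p
  1/-antimono-≤ = ℚₚ.*-cancelˡ-≤-pos r (subst₂ ℚ._≤_ (sym (ℚₚ.*-inverseʳ r)) refl (ℚₚ.<⇒≤ 1<ρ))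

  ^ℤ-antimono-≤ : ∀ {k} → k ℤ.≤ + 0 → r ^ℤ k ℚ.≤ p ^ℤ k
  ^ℤ-antimono-≤ {+ zero}   _ = ℚₚ.≤-refl
  ^ℤ-antimono-≤ { -[1+ k ] } _ = ^-mono-≤ (suc k) (0≤1/ r) 1/-antimono-≤
  ^ℤ-antimono-≤ {+ suc _} (ℤ.+≤+ ())

  -- For exponents of at most -1 the quotient of the two powers is at least `ρ`, the rational
  -- quotient of the bases. This is why -1, and not 0, is the bound on the exponent: no irrational
  -- ratio is needed. In the computation `m ℤ.+ + N` is not positive, so the larger base gives the
  -- smaller power.
  power-scale : ∀ x → U x (-[1+ 0 ] / 1) → ∀ {q} → L (power r 1≤r x) q → L (power p 1≤p x) (ρ ℚ.* q)
  power-scale x u {q} (a , q<a , 0≤a , m , n , l , a^≤) =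
    (ρ ℚ.* a , ℚₚ.*-monoʳ-<-pos ρ {{ρ>0}} q<a , nonNeg-* 0≤ρ 0≤a , m , n , l , (begin
      (ρ ℚ.* a) ^ N                               ≡⟨ ^-distrib-* ρ a N ⟩
      ρ ^ N ℚ.* a ^ N                             ≤⟨ ℚₚ.*-monoˡ-≤-nonNeg (ρ ^ N) {{ℚ.nonNegative (0≤^ N 0≤ρ)}} a^≤ ⟩
      ρ ^ N ℚ.* r ^ℤ m                            ≡⟨ cong (ℚ._* r ^ℤ m) (^-distrib-* r (1/ p) N) ⟩
      r ^ N ℚ.* (1/ p) ^ N ℚ.* r ^ℤ m             ≡⟨ rotate (r ^ N) ((1/ p) ^ N) (r ^ℤ m) ⟩
      r ^ℤ m ℚ.* r ^ N ℚ.* (1/ p) ^ N             ≡⟨ cong (ℚ._* (1/ p) ^ N) (^ℤ-+ r m N) ⟨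
      r ^ℤ (m ℤ.+ + N) ℚ.* (1/ p) ^ N             ≤⟨ ℚₚ.*-monoʳ-≤-nonNeg ((1/ p) ^ N) {{ℚ.nonNegative (0≤^ N (0≤1/ p))}} (^ℤ-antimono-≤ m+N≤0) ⟩
      p ^ℤ (m ℤ.+ + N) ℚ.* (1/ p) ^ N             ≡⟨ ^ℤ-− p (m ℤ.+ + N) N ⟨
      p ^ℤ (m ℤ.+ + N ℤ.- + N)                    ≡⟨ cong (p ^ℤ_) (m+k-k m (+ N)) ⟩
      p ^ℤ m                                      ∎))
    where
    open ℚₚ.≤-Reasoning
    N = suc n
    ρ>0 : ℚ.Positive ρ
    ρ>0 = ℚ.positive (ℚₚ.<-trans (ℚₚ.positive⁻¹ 1ℚ) 1<ρ)
    rotate : ∀ a b c → a ℚ.* b ℚ.* c ≡ c ℚ.* a ℚ.* b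
    rotate = solve 3 (λ a b c → a :* b :* c := c :* a :* b) refl where open ℚ-Solver
    m+k-k : ∀ m k → m ℤ.+ k ℤ.- k ≡ m
    m+k-k = solve 2 (λ m k → m :+ k :+ :- k := m) refl where open ℤ-Solver
    m+N≤0 : m ℤ.+ + N ℤ.≤ + 0
    m+N≤0 = subst (m ℤ.+ + N ℤ.≤_) (ℤₚ.+-inverseˡ (+ N)) (ℤₚ.+-monoˡ-≤ (+ N)
      (subst₂ ℤ._≤_ (ℤₚ.*-identityʳ m) (ℤₚ.-1*i≡-i (+ N)) (ℤₚ.<⇒≤ (/<⇒ {m} {n} { -[1+ 0 ] } {0} (L<U x l u)))))

  power-positive : ∀ x → ∃[ l ] 0ℚ ℚ.< l × L (power r 1≤r x) l
  power-positive x =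
    let k , lk , _    = grid x 0
        l , 0<l , l<a = ℚₚ.<-dense (0<^ℤ k)
    in l , 0<l , r ^ℤ k , l<a , 0≤^ℤ r k , k , 0 , lk , ℚₚ.≤-reflexive (ℚₚ.*-identityʳ (r ^ℤ k))
    where
    0<^ : ∀ {q} → 0ℚ ℚ.< q → ∀ n → 0ℚ ℚ.< q ^ n
    0<^ {q} 0<q zero    = ℚₚ.positive⁻¹ 1ℚ
    0<^ {q} 0<q (suc n) = ℚₚ.positive⁻¹ (q ℚ.* q ^ n)
      {{ℚₚ.pos*pos⇒pos q {{ℚ.positive 0<q}} (q ^ n) {{ℚ.positive (0<^ 0<q n)}}}}
    0<^ℤ : ∀ k → 0ℚ ℚ.< r ^ℤ k
    0<^ℤ (+ m)    = 0<^ (ℚₚ.positive⁻¹ r) m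
    0<^ℤ -[1+ m ] = 0<^ (ℚₚ.positive⁻¹ (1/ r) {{ℚₚ.1/pos⇒pos r}}) (suc m)

  power-antimono-< : ∀ x → U x (-[1+ 0 ] / 1) → power r 1≤r x < power p 1≤p x
  power-antimono-< x u =
    let l , 0<l , ll = power-positive x
    in scaled⇒< (power r 1≤r x) (power p 1≤p x) 1<ρ (power-scale x u) 0<l ll

-- The square grid

data Dir : Set where
  eastward northward westward southward : Dir

left opp right : Dir → Dir
left eastward = northward
left northward = westward
left westward = southward
left southward = eastward
opp d = left (left d)
right d = left (opp d)

left-right : ∀ d → left (right d) ≡ d
left-right eastward = refl
left-right northward = refl
left-right westward = refl
left-right southward = refl

move : Dir → Cell → Cell
move eastward (x , y) = ℤ.suc x , y
move northward (x , y) = x , ℤ.suc y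
move westward (x , y) = ℤ.pred x , y
move southward (x , y) = x , ℤ.pred y

move-opp : ∀ d c → move (opp d) (move d c) ≡ c
move-opp eastward (x , y) = cong (_, y) (ℤₚ.pred-suc x)
move-opp northward (x , y) = cong (x ,_) (ℤₚ.pred-suc y)
move-opp westward (x , y) = cong (_, y) (ℤₚ.suc-pred x)
move-opp southward (x , y) = cong (x ,_) (ℤₚ.suc-pred y)

opp-opp : ∀ d → opp (opp d) ≡ d
opp-opp = left-right

move-left-comm : ∀ d c → move d (move (left d) c) ≡ move (left d) (move d c)
move-left-comm eastward _ = refl
move-left-comm northward _ = refl
move-left-comm westward _ = refl
move-left-comm southward _ = refl

move-right-comm : ∀ d c → move d (move (right d) c) ≡ move (right d) (move d c)
move-right-comm d c = sym (subst (λ e → move (right d) (move e c) ≡ move e (move (right d) c))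
  (left-right d) (move-left-comm (right d) c))

move-injective : ∀ d {b c} → move d b ≡ move d c → b ≡ c
move-injective d {b} {c} eq = trans (sym (move-opp d b)) (trans (cong (move (opp d)) eq) (move-opp d c))

i≢suc[i] : ∀ {i} → i ≢ ℤ.suc i
i≢suc[i] {i} = ℤₚ.i≢suc[i] {i}

i≢pred[i] : ∀ {i} → i ≢ ℤ.pred i
i≢pred[i] {i} eq = i≢suc[i] (sym (trans (cong ℤ.suc eq) (ℤₚ.suc-pred i)))

suc≢pred : ∀ {i} → ℤ.suc i ≢ ℤ.pred i
suc≢pred {i} eq = ℤₚ.<-irrefl (sym eq) (ℤₚ.<-trans
  (subst (ℤ.pred i ℤ.<_) (ℤₚ.suc-pred i) (i<suc[i] (ℤ.pred i))) (i<suc[i] i))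

move≢ : ∀ d {c} → c ≢ move d c
move≢ eastward eq = i≢suc[i] (cong proj₁ eq)
move≢ northward eq = i≢suc[i] (cong proj₂ eq)
move≢ westward eq = i≢pred[i] (cong proj₁ eq)
move≢ southward eq = i≢pred[i] (cong proj₂ eq)

move-direction : ∀ d e {c} → move d c ≡ move e c → d ≡ e
move-direction eastward eastward eq = refl
move-direction eastward northward eq = ⊥-elim (i≢suc[i] (sym (cong proj₁ eq)))
move-direction eastward westward {x , _} eq = ⊥-elim (suc≢pred {x} (cong proj₁ eq))
move-direction eastward southward eq = ⊥-elim (i≢suc[i] (sym (cong proj₁ eq)))
move-direction northward eastward eq = ⊥-elim (i≢suc[i] (cong proj₁ eq))
move-direction northward northward eq = refl
move-direction northward westward eq = ⊥-elim (i≢pred[i] (cong proj₁ eq))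
move-direction northward southward {_ , y} eq = ⊥-elim (suc≢pred {y} (cong proj₂ eq))
move-direction westward eastward {x , _} eq = ⊥-elim (suc≢pred {x} (sym (cong proj₁ eq)))
move-direction westward northward eq = ⊥-elim (i≢pred[i] (sym (cong proj₁ eq)))
move-direction westward westward eq = refl
move-direction westward southward eq = ⊥-elim (i≢pred[i] (sym (cong proj₁ eq)))
move-direction southward eastward eq = ⊥-elim (i≢suc[i] (cong proj₁ eq))
move-direction southward northward {_ , y} eq = ⊥-elim (suc≢pred {y} (sym (cong proj₂ eq)))
move-direction southward westward eq = ⊥-elim (i≢pred[i] (cong proj₁ eq))
move-direction southward southward eq = refl

side : Cell → Dir → Side
side c southward = c , east c
side c westward = c , north c
side c northward = north c , east (north c)
side c eastward = east c , north (east c)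

side∈sides : ∀ c d → side c d ∈ sides c
side∈sides c southward = here refl
side∈sides c westward = there (here refl)
side∈sides c northward = there (there (here refl))
side∈sides c eastward = there (there (there (here refl)))

∈sides⇒side : ∀ c {s} → s ∈ sides c → ∃[ d ] s ≡ side c d
∈sides⇒side c (here eq)                         = southward , eq
∈sides⇒side c (there (here eq))                 = westward , eq
∈sides⇒side c (there (there (here eq)))         = northward , eq
∈sides⇒side c (there (there (there (here eq)))) = eastward , eq

side-move : ∀ d c → side c d ≡ side (move d c) (opp d)
side-move eastward c = refl
side-move northward c = refl
side-move westward c = cong (λ b → b , north b) (sym (move-opp westward c))
side-move southward c = cong (λ b → b , east b) (sym (move-opp southward c))

side-injective : ∀ d {b c} → side b d ≡ side c d → b ≡ c
side-injective eastward eq = move-injective eastward (cong proj₁ eq)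
side-injective northward eq = move-injective northward (cong proj₁ eq)
side-injective westward eq = cong proj₁ eq
side-injective southward eq = cong proj₁ eq

horizontal≢vertical : ∀ {b c : Point} → (b , east b) ≢ (c , north c)
horizontal≢vertical eq with cong proj₁ eq
... | refl = i≢suc[i] (sym (cong proj₁ (cong proj₂ eq)))

-- A side has exactly two names, one from each of the two cells that it separates.
side-≡ : ∀ d e {b c} → side b d ≡ side c e → (b ≡ c × d ≡ e) ⊎ (c ≡ move d b × e ≡ opp d)
side-≡ eastward eastward eq = inj₁ (side-injective eastward eq , refl)
side-≡ northward northward eq = inj₁ (side-injective northward eq , refl)
side-≡ westward westward eq = inj₁ (side-injective westward eq , refl)
side-≡ southward southward eq = inj₁ (side-injective southward eq , refl)
side-≡ eastward westward eq = inj₂ (sym (cong proj₁ eq) , refl)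
side-≡ northward southward eq = inj₂ (sym (cong proj₁ eq) , refl)
side-≡ westward eastward {b} {c} eq = inj₂ (trans (sym (move-opp eastward c)) (sym (cong (λ s → move westward (proj₁ s)) eq)) , refl)
side-≡ southward northward {b} {c} eq = inj₂ (trans (sym (move-opp northward c)) (sym (cong (λ s → move southward (proj₁ s)) eq)) , refl)
side-≡ eastward northward eq = ⊥-elim (horizontal≢vertical (sym eq))
side-≡ eastward southward eq = ⊥-elim (horizontal≢vertical (sym eq))
side-≡ westward northward eq = ⊥-elim (horizontal≢vertical (sym eq))
side-≡ westward southward eq = ⊥-elim (horizontal≢vertical (sym eq))
side-≡ northward eastward eq = ⊥-elim (horizontal≢vertical eq)
side-≡ northward westward eq = ⊥-elim (horizontal≢vertical eq)
side-≡ southward eastward eq = ⊥-elim (horizontal≢vertical eq)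
side-≡ southward westward eq = ⊥-elim (horizontal≢vertical eq)

common-side : ∀ {b c s} → s ∈ sides b → s ∈ sides c → b ≡ c ⊎ (∃[ d ] c ≡ move d b × s ≡ side b d)
common-side {b} {c} s∈b s∈c with ∈sides⇒side b s∈b | ∈sides⇒side c s∈c
... | d , refl | e , eq with side-≡ d e eq
...   | inj₁ (b≡c , _) = inj₁ b≡c
...   | inj₂ (c≡ , _)  = inj₂ (d , c≡ , refl)

Adjacent⇒move : ∀ {b c} → Adjacent b c → ∃[ d ] c ≡ move d b
Adjacent⇒move (b≢c , any) with find any
... | s , s∈b , s∈c with common-side s∈b s∈c
...   | inj₁ b≡c          = ⊥-elim (b≢c b≡c)
...   | inj₂ (d , c≡ , _) = d , c≡

move⇒Adjacent : ∀ d {c} → Adjacent c (move d c)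
move⇒Adjacent d {c} = move≢ d , lose (side∈sides c d)
  (subst (_∈ sides (move d c)) (sym (side-move d c)) (side∈sides (move d c) (opp d)))

Adjacent-sym : ∀ {b c} → Adjacent b c → Adjacent c b
Adjacent-sym {b} adj with Adjacent⇒move adj
... | d , refl = subst (Adjacent (move d b)) (move-opp d b) (move⇒Adjacent (opp d))

∈figure⁺ : ∀ {P c s} → c ∈ P → s ∈ sides c → s ∈ figure P
∈figure⁺ {P} c∈P s∈c = ∈-deduplicate⁺ _≟ₛ_ (∈-concatMap⁺ sides {P} (lose c∈P s∈c))

∈figure⁻ : ∀ {P s} → s ∈ figure P → ∃[ c ] c ∈ P × s ∈ sides c
∈figure⁻ {P} s∈ = find (∈-concatMap⁻ sides {P} (∈-deduplicate⁻ _≟ₛ_ (concatMap sides P) s∈))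

Open⇒move : ∀ {P b c} → Open P b c → b ∉ P × (b ≡ c ⊎ ∃[ d ] c ≡ move d b)
Open⇒move (s , s∈b , s∈c , s∉) with common-side s∈b s∈c
... | inj₁ b≡c          = (λ b∈P → s∉ (∈figure⁺ b∈P s∈b)) , inj₁ b≡c
... | inj₂ (d , c≡ , _) = (λ b∈P → s∉ (∈figure⁺ b∈P s∈b)) , inj₂ (d , c≡)

-- Squares meeting only in a corner

lt : ℤ → ℤ → Bool
lt x y = does (x ℤ.<? y)

lt-suc : ∀ x y → x ≢ y → lt x y ≡ lt x (ℤ.suc y)
lt-suc x y x≢y with x ℤ.<? y
... | yes x<y = sym (dec-true (x ℤ.<? ℤ.suc y) (ℤₚ.<-trans x<y (i<suc[i] y)))
... | no  x≮y = sym (dec-false (x ℤ.<? ℤ.suc y) λ x<1+y →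
  x≢y (ℤₚ.≤-antisym (subst (x ℤ.≤_) (ℤₚ.pred-suc y) (ℤₚ.i<j⇒i≤pred[j] x<1+y)) (ℤₚ.≮⇒≥ x≮y)))

lt-suc-suc : ∀ x y → lt (ℤ.suc x) (ℤ.suc y) ≡ lt x y
lt-suc-suc x y with x ℤ.<? y
... | yes x<y = dec-true (ℤ.suc x ℤ.<? ℤ.suc y) (ℤₚ.+-monoʳ-< (+ 1) x<y)
... | no  x≮y = dec-false (ℤ.suc x ℤ.<? ℤ.suc y) λ 1+x<1+y →
  x≮y (ℤₚ.suc[i]≤j⇒i<j (subst (ℤ.suc x ℤ.≤_) (ℤₚ.pred-suc y) (ℤₚ.i<j⇒i≤pred[j] 1+x<1+y)))

suc-lt : ∀ x y → ℤ.suc x ≢ y → lt x y ≡ lt (ℤ.suc x) y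
suc-lt x y 1+x≢y = trans (sym (lt-suc-suc x y)) (sym (lt-suc _ _ 1+x≢y))

lt-irrefl : ∀ x → lt x x ≡ false
lt-irrefl x = dec-false (x ℤ.<? x) (ℤₚ.<-irrefl refl)

lt-step : ∀ x → lt x (ℤ.suc x) ≡ true
lt-step x = dec-true (x ℤ.<? ℤ.suc x) (i<suc[i] x)

step-lt : ∀ x → lt (ℤ.suc x) x ≡ false
step-lt x = dec-false (ℤ.suc x ℤ.<? x) (ℤₚ.<-asym (i<suc[i] x))

≡⇒xor≡false : ∀ {a b} → a ≡ b → a xor b ≡ false
≡⇒xor≡false {a} refl = xor-same a

xor≡false⇒≡ : ∀ {a b} → a xor b ≡ false → a ≡ b
xor≡false⇒≡ {false} eq = sym eq
xor≡false⇒≡ {true}  {true} _ = refl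

-- Whether the ray going east from the centre of a cell crosses a curve that
-- passes from row q to row q′ in column p.
cross : Cell → ℤ → ℤ → ℤ → Bool
cross (x , y) p q q′ = lt x p ∧ (lt y q xor lt y q′)

crossStep : Cell → Cell → Cell → Bool
crossStep X (p , q) (_ , q′) = cross X p q q′

-- The cells of the row north of (x , y), strictly east of column x.
onRay : ℤ → ℤ → Cell → Bool
onRay x y (p , q) = lt x p ∧ (lt y q xor lt (ℤ.suc y) q)

cross-flat : ∀ X p q → cross X p q q ≡ false
cross-flat (x , y) p q = trans (cong (lt x p ∧_) (xor-same (lt y q))) (∧-zeroʳ (lt x p))

cross-swap : ∀ X p q q′ → cross X p q q′ ≡ cross X p q′ q
cross-swap (x , y) p q q′ = cong (lt x p ∧_) (xor-comm (lt y q) (lt y q′))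

module _ (x y : ℤ) where

  -- Moving the origin of the ray one column east matters only for a step in column `ℤ.suc x`, and
  -- an upward step from row `q` meets the ray only if `y` is `q`. Then the curve passes through the
  -- new origin, which is excluded.
  cross-east : ∀ p q → (p , q) ≢ (ℤ.suc x , y) →
    cross (x , y) p q (ℤ.suc q) ≡ cross (ℤ.suc x , y) p q (ℤ.suc q)
  cross-east p q a≢ with ℤ.suc x ℤ.≟ p
  ... | no  1+x≢p = cong (_∧ (lt y q xor lt y (ℤ.suc q))) (suc-lt x p 1+x≢p)
  ... | yes refl  = trans (zeroed (lt x (ℤ.suc x))) (sym (zeroed (lt (ℤ.suc x) (ℤ.suc x))))
    where
    zeroed : ∀ b → b ∧ (lt y q xor lt y (ℤ.suc q)) ≡ false
    zeroed b = trans (cong (b ∧_) (≡⇒xor≡false (lt-suc y q λ { refl → a≢ refl }))) (∧-zeroʳ b)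

  crossStep-east : ∀ d a → a ≢ (ℤ.suc x , y) → move d a ≢ (ℤ.suc x , y) →
    crossStep (x , y) a (move d a) ≡ crossStep (ℤ.suc x , y) a (move d a)
  crossStep-east eastward (p , q) _ _ = trans (cross-flat (x , y) p q) (sym (cross-flat (ℤ.suc x , y) p q))
  crossStep-east westward (p , q) _ _ = trans (cross-flat (x , y) p q) (sym (cross-flat (ℤ.suc x , y) p q))
  crossStep-east northward (p , q) a≢ _ = cross-east p q a≢
  crossStep-east southward (p , q) _ b≢ = trans (cross-swap (x , y) p q (ℤ.pred q))
    (trans (subst (λ t → cross (x , y) p (ℤ.pred q) t ≡ cross (ℤ.suc x , y) p (ℤ.pred q) t) (ℤₚ.suc-pred q)
      (cross-east p (ℤ.pred q) b≢)) (cross-swap (ℤ.suc x , y) p (ℤ.pred q) q))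

  -- The strip between the rays from `(x , y)` and from `(x , ℤ.suc y)` contains just the cells
  -- marked by `onRay`. A vertical step that crosses exactly one of the rays enters or leaves the
  -- strip.
  cross-north : ∀ p q q′ →
    cross (x , y) p q q′ xor cross (x , ℤ.suc y) p q q′ ≡ onRay x y (p , q) xor onRay x y (p , q′)
  cross-north p q q′ = solve 5 (λ c a b d e → c :* (a :+ b) :+ c :* (d :+ e) := c :* (a :+ d) :+ c :* (b :+ e)) refl
    (lt x p) (lt y q) (lt y q′) (lt (ℤ.suc y) q) (lt (ℤ.suc y) q′)
    where open xor-∧-Solver

  onRay-east : ∀ p q → (p ≢ x ⊎ q ≢ ℤ.suc y) → onRay x y (p , q) ≡ onRay x y (ℤ.suc p , q)
  onRay-east p q p≢x⊎q≢1+y with ℤ.suc y ℤ.≟ q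
  ... | no  1+y≢q = trans (zeroed (lt x p)) (sym (zeroed (lt x (ℤ.suc p))))
    where
    zeroed : ∀ b → b ∧ (lt y q xor lt (ℤ.suc y) q) ≡ false
    zeroed b = trans (cong (b ∧_) (≡⇒xor≡false (suc-lt y q 1+y≢q))) (∧-zeroʳ b)
  ... | yes refl with p≢x⊎q≢1+y
  ...   | inj₁ p≢x = cong (_∧ _) (lt-suc x p (≢-sym p≢x))
  ...   | inj₂ q≢  = ⊥-elim (q≢ refl)

  -- Horizontal steps cross no ray, but can enter the strip through its western end, between
  -- `(x , ℤ.suc y)` and `(ℤ.suc x , ℤ.suc y)`. It suffices that the curve avoids one of these two
  -- cells, hence the choice in `e`.
  crossStep-north : ∀ e → e ≡ (x , ℤ.suc y) ⊎ e ≡ (ℤ.suc x , ℤ.suc y) → ∀ d a → a ≢ e → move d a ≢ e →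
    crossStep (x , y) a (move d a) xor crossStep (x , ℤ.suc y) a (move d a)
      ≡ onRay x y a xor onRay x y (move d a)
  crossStep-north e e≡ northward (p , q) _ _ = cross-north p q (ℤ.suc q)
  crossStep-north e e≡ southward (p , q) _ _ = cross-north p q (ℤ.pred q)
  crossStep-north e e≡ eastward (p , q) a≢e b≢e = trans
    (cong₂ _xor_ (cross-flat (x , y) p q) (cross-flat (x , ℤ.suc y) p q))
    (sym (≡⇒xor≡false (onRay-east p q (off e≡))))
    where
    off : e ≡ (x , ℤ.suc y) ⊎ e ≡ (ℤ.suc x , ℤ.suc y) → p ≢ x ⊎ q ≢ ℤ.suc y
    off e≡ with q ℤ.≟ ℤ.suc y | e≡
    ... | no q≢    | _         = inj₂ q≢
    ... | yes refl | inj₁ refl = inj₁ λ { refl → a≢e refl }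
    ... | yes refl | inj₂ refl = inj₁ λ { refl → b≢e refl }
  crossStep-north e e≡ westward (p , q) a≢e b≢e = trans
    (cong₂ _xor_ (cross-flat (x , y) p q) (cross-flat (x , ℤ.suc y) p q))
    (sym (≡⇒xor≡false (sym (subst (λ t → onRay x y (ℤ.pred p , q) ≡ onRay x y (t , q)) (ℤₚ.suc-pred p)
      (onRay-east (ℤ.pred p) q (off e≡))))))
    where
    off : e ≡ (x , ℤ.suc y) ⊎ e ≡ (ℤ.suc x , ℤ.suc y) → ℤ.pred p ≢ x ⊎ q ≢ ℤ.suc y
    off e≡ with q ℤ.≟ ℤ.suc y | e≡
    ... | no q≢    | _         = inj₂ q≢
    ... | yes refl | inj₁ refl = inj₁ λ { refl → b≢e refl }
    ... | yes refl | inj₂ refl = inj₁ λ { refl → a≢e (cong (_, ℤ.suc y) (sym (ℤₚ.suc-pred p))) }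

  -- A diagonal step from row q to row q + 1 between the columns p and p + 1
  -- counts as passing in column p + 1.
  cross-diagonal-east : ∀ p q → (y ≡ q → x ≢ p) →
    cross (x , y) (ℤ.suc p) q (ℤ.suc q) ≡ cross (ℤ.suc x , y) (ℤ.suc p) q (ℤ.suc q)
  cross-diagonal-east p q off with x ℤ.≟ p
  ... | no  x≢p  = cong (_∧ _) (trans (sym (lt-suc x p x≢p)) (sym (lt-suc-suc x p)))
  ... | yes refl = trans (zeroed (lt x (ℤ.suc x))) (sym (zeroed (lt (ℤ.suc x) (ℤ.suc x))))
    where
    zeroed : ∀ b → b ∧ (lt y q xor lt y (ℤ.suc q)) ≡ false
    zeroed b = trans (cong (b ∧_) (≡⇒xor≡false (lt-suc y q λ y≡q → off y≡q refl))) (∧-zeroʳ b)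

  cross-diagonal-north : ∀ p q → (p , q) ≢ (x , ℤ.suc y) →
    cross (x , y) (ℤ.suc p) q (ℤ.suc q) xor cross (x , ℤ.suc y) (ℤ.suc p) q (ℤ.suc q)
      ≡ onRay x y (p , q) xor onRay x y (ℤ.suc p , ℤ.suc q)
  cross-diagonal-north p q a≢ = trans (cross-north (ℤ.suc p) q (ℤ.suc q))
    (cong (_xor onRay x y (ℤ.suc p , ℤ.suc q)) (sym (onRay-east p q off)))
    where
    off : p ≢ x ⊎ q ≢ ℤ.suc y
    off with p ℤ.≟ x
    ... | no  p≢x  = inj₁ p≢x
    ... | yes refl = inj₂ λ { refl → a≢ refl }

  cross-antidiagonal-north : ∀ p q → (p , ℤ.suc q) ≢ (x , ℤ.suc y) →
    cross (x , y) (ℤ.suc p) q (ℤ.suc q) xor cross (x , ℤ.suc y) (ℤ.suc p) q (ℤ.suc q)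
      ≡ onRay x y (ℤ.suc p , q) xor onRay x y (p , ℤ.suc q)
  cross-antidiagonal-north p q b≢ = trans (cross-north (ℤ.suc p) q (ℤ.suc q))
    (cong (onRay x y (ℤ.suc p , q) xor_) (sym (onRay-east p (ℤ.suc q) off)))
    where
    off : p ≢ x ⊎ ℤ.suc q ≢ ℤ.suc y
    off with p ℤ.≟ x
    ... | no  p≢x  = inj₁ p≢x
    ... | yes refl = inj₂ λ eq → b≢ (cong (x ,_) eq)

xor-telescope : ∀ a b c → (a xor b) xor (b xor c) ≡ a xor c
xor-telescope = solve 3 (λ a b c → (a :+ b) :+ (b :+ c) := a :+ c) refl where open xor-∧-Solver

xor-interchange : ∀ a b c d → (a xor b) xor (c xor d) ≡ (a xor c) xor (b xor d)
xor-interchange = solve 4 (λ a b c d → (a :+ b) :+ (c :+ d) := (a :+ c) :+ (b :+ d)) refl where open xor-∧-Solver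

module Path (P : List Cell) where

  PathIn : Cell → Cell → Set
  PathIn = Star (λ a b → Adjacent a b × b ∈ P)

  crossings : Cell → ∀ {a b} → PathIn a b → Bool
  crossings X nil                     = false
  crossings X (_◅_ {a} {b} _ path) = crossStep X a b xor crossings X path

  crossings-east : ∀ x y → (ℤ.suc x , y) ∉ P → ∀ {a b} → a ∈ P → (path : PathIn a b) →
    crossings (x , y) path ≡ crossings (ℤ.suc x , y) path
  crossings-east x y ∉P a∈P nil = refl
  crossings-east x y ∉P a∈P ((adj , b∈P) ◅ path) with Adjacent⇒move adj
  ... | d , refl = cong₂ _xor_
    (crossStep-east x y d _ (λ { refl → ∉P a∈P }) (λ eq → ∉P (subst (_∈ P) eq b∈P)))
    (crossings-east x y ∉P b∈P path)

  crossings-north : ∀ x y e → e ≡ (x , ℤ.suc y) ⊎ e ≡ (ℤ.suc x , ℤ.suc y) → e ∉ P →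
    ∀ {a b} → a ∈ P → (path : PathIn a b) →
    crossings (x , y) path xor crossings (x , ℤ.suc y) path ≡ onRay x y a xor onRay x y b
  crossings-north x y e e≡ ∉P {a} a∈P nil = sym (xor-same (onRay x y a))
  crossings-north x y e e≡ ∉P {a} {c} a∈P (_◅_ {j = b} (adj , b∈P) path) with Adjacent⇒move adj
  ... | d , refl = trans
    (xor-interchange (crossStep (x , y) a b) (crossings (x , y) path) (crossStep (x , ℤ.suc y) a b) (crossings (x , ℤ.suc y) path))
    (trans (cong₂ _xor_
      (crossStep-north x y e e≡ d a (λ { refl → ∉P a∈P }) (λ eq → ∉P (subst (_∈ P) eq b∈P)))
      (crossings-north x y e e≡ ∉P b∈P path))
    (xor-telescope (onRay x y a) (onRay x y b) (onRay x y c)))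

  -- The curve closed up by a diagonal step between the rows q and q + 1 and the
  -- columns p and p + 1; its winding parity is constant off P.
  module _ {a b} (a∈P : a ∈ P) (path : PathIn a b) (p q : ℤ) where

    parity : Cell → Bool
    parity X = crossings X path xor cross X (ℤ.suc p) q (ℤ.suc q)

    -- What depends on the closing step only: a move between two cells off `P` must not pass through
    -- it. Both kinds of diagonal satisfy this because their ends lie in `P`.
    module _ (east-ok : ∀ x y → (x , y) ∉ P → (ℤ.suc x , y) ∉ P → y ≡ q → x ≢ p)
             (north-ok : ∀ x y → (x , ℤ.suc y) ∉ P →
                cross (x , y) (ℤ.suc p) q (ℤ.suc q) xor cross (x , ℤ.suc y) (ℤ.suc p) q (ℤ.suc q)
                  ≡ onRay x y a xor onRay x y b) where

      parity-east : ∀ X → X ∉ P → move eastward X ∉ P → parity X ≡ parity (move eastward X)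
      parity-east (x , y) X∉ X′∉ = cong₂ _xor_ (crossings-east x y X′∉ a∈P path)
        (cross-diagonal-east x y p q (east-ok x y X∉ X′∉))

      parity-north : ∀ X → X ∉ P → move northward X ∉ P → parity X ≡ parity (move northward X)
      parity-north (x , y) X∉ X′∉ = xor≡false⇒≡ (trans
        (xor-interchange (crossings (x , y) path) (cross (x , y) (ℤ.suc p) q (ℤ.suc q)) (crossings (x , ℤ.suc y) path) (cross (x , ℤ.suc y) (ℤ.suc p) q (ℤ.suc q)))
        (≡⇒xor≡false (trans (crossings-north x y _ (inj₁ refl) X′∉ a∈P path) (sym (north-ok x y X′∉)))))

      parity-move : ∀ d X → X ∉ P → move d X ∉ P → parity X ≡ parity (move d X)
      parity-move eastward X X∉ X′∉ = parity-east X X∉ X′∉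
      parity-move northward X X∉ X′∉ = parity-north X X∉ X′∉
      parity-move westward X X∉ X′∉ = sym (trans
        (parity-east (move westward X) X′∉ (subst (_∉ P) (sym (move-opp westward X)) X∉)) (cong parity (move-opp westward X)))
      parity-move southward X X∉ X′∉ = sym (trans
        (parity-north (move southward X) X′∉ (subst (_∉ P) (sym (move-opp southward X)) X∉)) (cong parity (move-opp southward X)))

      parity-region : ∀ {X Y} → SameRegion P X Y → Y ∉ P → parity X ≡ parity Y
      parity-region nil _ = refl
      parity-region (open₁ ◅ rest) Y∉ with Open⇒move open₁
      ... | X∉ , inj₁ refl       = parity-region rest Y∉
      ... | X∉ , inj₂ (d , refl) = trans (parity-move d _ X∉ (start∉ rest)) (parity-region rest Y∉)
        where
        start∉ : ∀ {X} → SameRegion P X _ → X ∉ P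
        start∉ nil           = Y∉
        start∉ (open₂ ◅ _) = proj₁ (Open⇒move open₂)

module _ {P : List Cell} (sys : IsPolyominoSystem P) where

  open IsPolyominoSystem sys
  open Path P

  -- The path from `m` to its north-eastern neighbour, closed by the diagonal, separates the other
  -- two cells of the block. They lie in one exterior region, so their parities agree; computed
  -- along the path, the parities differ.
  no-diagonal : ∀ m → m ∈ P → move northward (move eastward m) ∈ P → move eastward m ∉ P → move northward m ∉ P → ⊥
  no-diagonal m@(p , q) m∈ ne∈ e∉ n∉ = absurd (trans (sym parity-e) (trans same parity-n))
    where
    path = connected m∈ ne∈
    same : parity m∈ path p q (move eastward m) ≡ parity m∈ path p q (move northward m)
    same = parity-region m∈ path p q
      (λ { x y X∉ _ refl refl → X∉ m∈ })
      (λ x y X′∉ → cross-diagonal-north x y p q λ { refl → X′∉ m∈ })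
      (external e∉ n∉) n∉
    crossing : crossings (move eastward m) path xor crossings (move northward m) path ≡ true
    -- The two cells are compared via the rays from `m` itself: the path starts outside the strip
    -- north of `m` and ends inside it.
    crossing = trans (cong (_xor crossings (move northward m) path) (sym (crossings-east p q e∉ m∈ path)))
      (trans (crossings-north p q (move northward m) (inj₁ refl) n∉ m∈ path)
      (cong₂ _xor_ (cong (_∧ (lt q q xor lt (ℤ.suc q) q)) (lt-irrefl p))
        (cong₂ _∧_ (lt-step p) (cong₂ _xor_ (lt-step q) (lt-irrefl (ℤ.suc q))))))
    parity-e : parity m∈ path p q (move eastward m) ≡ crossings (move eastward m) path
    parity-e = trans (cong (λ b → crossings (move eastward m) path xor (b ∧ _)) (lt-irrefl (ℤ.suc p))) (xor-identityʳ _)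
    parity-n : parity m∈ path p q (move northward m) ≡ crossings (move northward m) path
    parity-n = trans (cong (crossings (move northward m) path xor_)
      (trans (cong (lt p (ℤ.suc p) ∧_) (cong₂ _xor_ (step-lt q) (lt-irrefl (ℤ.suc q)))) (∧-zeroʳ _))) (xor-identityʳ _)
    absurd : crossings (move eastward m) path ≡ crossings (move northward m) path → ⊥
    absurd eq with trans (sym crossing) (≡⇒xor≡false eq)
    ... | ()

  -- The mirror image, with the roles exchanged: here the path crosses the rays from the two free
  -- cells equally often modulo 2, and the closing step crosses only the ray from `m`.
  no-antidiagonal : ∀ m → move eastward m ∈ P → move northward m ∈ P → m ∉ P → move northward (move eastward m) ∉ P → ⊥
  no-antidiagonal m@(p , q) e∈ n∈ m∉ ne∉ = absurd (trans (sym parity-m) (trans same parity-ne))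
    where
    path = connected e∈ n∈
    same : parity e∈ path p q m ≡ parity e∈ path p q (move northward (move eastward m))
    same = parity-region e∈ path p q
      (λ { x y _ X′∉ refl refl → X′∉ e∈ })
      (λ x y X′∉ → cross-antidiagonal-north x y p q λ eq → X′∉ (subst (_∈ P) eq n∈))
      (external m∉ ne∉) ne∉
    crossing : crossings m path ≡ crossings (move northward (move eastward m)) path
    crossing = trans (xor≡false⇒≡ (trans (crossings-north p q (move northward (move eastward m)) (inj₂ refl) ne∉ e∈ path)
      (cong₂ _xor_ (trans (cong (lt p (ℤ.suc p) ∧_) (cong₂ _xor_ (lt-irrefl q) (step-lt q))) (∧-zeroʳ _))
        (cong (_∧ (lt q (ℤ.suc q) xor lt (ℤ.suc q) (ℤ.suc q))) (lt-irrefl p)))))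
      (crossings-east p (ℤ.suc q) ne∉ e∈ path)
    parity-m : parity e∈ path p q m ≡ crossings m path xor true
    parity-m = cong (crossings m path xor_) (cong₂ _∧_ (lt-step p) (cong₂ _xor_ (lt-irrefl q) (lt-step q)))
    parity-ne : parity e∈ path p q (move northward (move eastward m)) ≡ crossings (move northward (move eastward m)) path
    parity-ne = trans (cong (λ b → crossings (move northward (move eastward m)) path xor (b ∧ _)) (lt-irrefl (ℤ.suc p))) (xor-identityʳ _)
    absurd : crossings m path xor true ≡ crossings (move northward (move eastward m)) path → ⊥
    absurd eq = not-self _ (trans eq (sym crossing))
      where
      not-self : ∀ b → b xor true ≡ b → ⊥
      not-self false ()
      not-self true  ()

  -- Squares meeting only in a corner would enclose one of the two other
  -- squares at that corner.
  diagonal : ∀ d c → c ∈ P → move (left d) (move d c) ∈ P → move d c ∈ P ⊎ move (left d) c ∈ P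
  diagonal d c c∈ x∈ with move d c ∈? P | move (left d) c ∈? P
  ... | yes d∈ | _       = inj₁ d∈
  ... | no  _  | yes l∈  = inj₂ l∈
  ... | no  d∉ | no  l∉  = ⊥-elim (contradictory d c∈ x∈ d∉ l∉)
    where
    contradictory : ∀ d {c} → c ∈ P → move (left d) (move d c) ∈ P → move d c ∉ P → move (left d) c ∉ P → ⊥
    -- The four headings reduce to the two kinds of diagonal once the block is named by its
    -- south-western cell.
    contradictory eastward c∈ x∈ d∉ l∉ = no-diagonal _ c∈ x∈ d∉ l∉
    contradictory northward {c} c∈ x∈ d∉ l∉ = no-antidiagonal (move westward c)
      (subst (_∈ P) (sym (move-opp westward c)) c∈) x∈ l∉ (subst (λ b → move northward b ∉ P) (sym (move-opp westward c)) d∉)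
    contradictory westward {c} c∈ x∈ d∉ l∉ = no-diagonal (move southward (move westward c)) x∈
      (subst (_∈ P) (sym (trans (cong (move northward) (move-opp westward (move southward c))) (move-opp southward c))) c∈)
      (subst (_∉ P) (sym (move-opp westward (move southward c))) l∉)
      (subst (_∉ P) (sym (move-opp southward (move westward c))) d∉)
    contradictory southward {c} c∈ x∈ d∉ l∉ = no-antidiagonal (move southward c) x∈
      (subst (_∈ P) (sym (move-opp southward c)) c∈) d∉
      (subst (_∉ P) (sym (cong (move eastward) (move-opp southward c))) l∉)

-- Degrees

private
  variable
    A : Set
    xs ys : List A

unique-⊆⊇⇒↭ : Unique xs → Unique ys → (∀ {x} → x ∈ xs → x ∈ ys) → (∀ {x} → x ∈ ys → x ∈ xs) → xs ↭ ys
unique-⊆⊇⇒↭ xs! ys! ⊆ ⊇ = ∼bag⇒↭ (unique∧set⇒bag xs! ys! (mk⇔ ⊆ ⊇))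

length-filter : ∀ {p} {Q : A → Set p} (Q? : Decidable Q) x xs →
  length (filter Q? (x ∷ xs)) ≡ bit (does (Q? x)) ℕ.+ length (filter Q? xs)
length-filter Q? x xs with does (Q? x)
... | false = refl
... | true  = refl

figure-unique : ∀ P → Unique (figure P)
figure-unique P = Uniqueₚ.deduplicate-! _≟ₛ_ _

module _ (P : List Cell) where

  mem : Cell → Bool
  mem c = does (c ∈? P)

  ∈⇒mem : ∀ {c} → c ∈ P → mem c ≡ true
  ∈⇒mem {c} = dec-true (c ∈? P)

  ∉⇒mem : ∀ {c} → c ∉ P → mem c ≡ false
  ∉⇒mem {c} = dec-false (c ∈? P)

  side∈figure : ∀ c d → does (side c d ∈ₛ? figure P) ≡ mem c ∨ mem (move d c)
  side∈figure c d with c ∈? P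
  ... | yes c∈ = dec-true (side c d ∈ₛ? figure P) (∈figure⁺ c∈ (side∈sides c d))
  ... | no  c∉ with move d c ∈? P
  ...   | yes d∈ = dec-true (side c d ∈ₛ? figure P) (∈figure⁺ d∈
    (subst (_∈ sides (move d c)) (sym (side-move d c)) (side∈sides (move d c) (opp d))))
  ...   | no  d∉ = dec-false (side c d ∈ₛ? figure P) λ s∈ → absurd (∈figure⁻ {P} s∈)
    where
    absurd : ¬ (∃[ b ] b ∈ P × side c d ∈ sides b)
    absurd (b , b∈ , s∈b) with common-side (side∈sides c d) s∈b
    ... | inj₁ refl = c∉ b∈
    ... | inj₂ (e , refl , eq) with side-≡ d e eq
    ...   | inj₁ (_ , refl)  = d∉ b∈
    ...   | inj₂ (c≡ , _) = move≢ d c≡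

  star : Point → List Side
  star v = side v southward ∷ side v westward ∷ side (move westward v) southward ∷ side (move southward v) westward ∷ []

  star-unique : ∀ v → Unique (star v)
  star-unique v = (S≢W ∷ (λ eq → move≢ westward (side-injective southward eq)) ∷ S≢W ∷ [])
                ∷ ((λ eq → S≢W (sym eq)) ∷ (λ eq → move≢ southward (side-injective westward eq)) ∷ [])
                ∷ (S≢W ∷ []) ∷ [] ∷ []
    where
    S≢W : ∀ {b c} → side b southward ≢ side c westward
    S≢W = horizontal≢vertical

  Incident : Point → Side → Set
  Incident v (u , w) = v ≡ u ⊎ v ≡ w

  star-incident : ∀ v {s} → s ∈ star v → Incident v s
  star-incident v (here refl)                         = inj₁ refl
  star-incident v (there (here refl))                 = inj₁ refl
  star-incident v (there (there (here refl)))         = inj₂ (sym (move-opp westward v))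
  star-incident v (there (there (there (here refl)))) = inj₂ (sym (move-opp southward v))

  incident-star : ∀ {v} c d → Incident v (side c d) → side c d ∈ star v
  incident-star c southward (inj₁ refl) = here refl
  incident-star c westward (inj₁ refl) = there (here refl)
  incident-star c northward (inj₁ refl) = here refl
  incident-star c eastward (inj₁ refl) = there (here refl)
  incident-star c southward (inj₂ refl) = there (there (here (cong (λ b → side b southward) (sym (move-opp eastward c)))))
  incident-star c westward (inj₂ refl) = there (there (there (here (cong (λ b → side b westward) (sym (move-opp northward c))))))
  incident-star c northward (inj₂ refl) = there (there (here (cong (λ b → side b southward) (sym (move-opp eastward (north c))))))
  incident-star c eastward (inj₂ refl) = there (there (there (here (cong (λ b → side b westward) (sym (move-opp northward (east c)))))))

  -- The flags tell which of the four squares around a vertex are present,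
  -- counterclockwise from the north-east.
  quadrants : Bool → Bool → Bool → Bool → ℕ
  quadrants a b c d = bit (a ∨ d) ℕ.+ (bit (a ∨ b) ℕ.+ (bit (b ∨ c) ℕ.+ (bit (d ∨ c) ℕ.+ 0)))

  quadrants-rotate : ∀ a b c d → quadrants a b c d ≡ quadrants b c d a
  quadrants-rotate a b c d rewrite ∨-comm b a | ∨-comm d c =
    solve 4 (λ p q r s → p :+ (q :+ (r :+ (s :+ con 0))) := q :+ (r :+ (s :+ (p :+ con 0)))) refl
      (bit (a ∨ d)) (bit (a ∨ b)) (bit (b ∨ c)) (bit (c ∨ d))
    where open ℕ-Solver

  -- The drawn sides that are incident with `v` and the sides of `star v` that are drawn are the
  -- same sides. The latter form a list of four, each drawn if one of its two cells is present.
  degree-quadrants : ∀ v → degree (polyominoGraph P) v ≡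
    quadrants (mem v) (mem (move westward v)) (mem (move southward (move westward v))) (mem (move southward v))
  degree-quadrants v = trans (↭-length (unique-⊆⊇⇒↭
      (Unique-Properties.filter⁺ incident? (figure-unique P))
      (Unique-Properties.filter⁺ drawn? (star-unique v)) ⊆ ⊇))
    (trans (length-filter drawn? _ _) (cong₂ ℕ._+_ (cong bit (side∈figure v southward))
    (trans (length-filter drawn? _ _) (cong₂ ℕ._+_ (cong bit (side∈figure v westward))
    (trans (length-filter drawn? _ _) (cong₂ ℕ._+_ (cong bit (side∈figure (move westward v) southward))
    (trans (length-filter drawn? _ _) (cong₂ ℕ._+_ (cong bit (side∈figure (move southward v) westward)) refl))))))))
    where
    incident? : Decidable (Incident v)
    incident? (u , w) = (v ≟ₚ u) ⊎-dec (v ≟ₚ w)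
    drawn? : Decidable (_∈ figure P)
    drawn? s = s ∈ₛ? figure P
    ⊆ : ∀ {s} → s ∈ filter incident? (figure P) → s ∈ filter drawn? (star v)
    ⊆ s∈ with ∈-filter⁻ incident? {xs = figure P} s∈
    ... | s∈fig , inc with ∈figure⁻ {P} s∈fig
    ...   | c , _ , s∈c with ∈sides⇒side c s∈c
    ...     | d , refl = ∈-filter⁺ drawn? (incident-star c d inc) s∈fig
    ⊇ : ∀ {s} → s ∈ filter drawn? (star v) → s ∈ filter incident? (figure P)
    ⊇ s∈ with ∈-filter⁻ drawn? {xs = star v} s∈
    ... | s∈star , s∈fig = ∈-filter⁺ incident? s∈fig (star-incident v s∈star)

  -- The corner at the left end of the side through which a walk heading in
  -- direction d enters c.
  corner : Cell → Dir → Point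
  corner c northward = c
  corner c eastward = north c
  corner c southward = east (north c)
  corner c westward = east c

  deg : Cell → Dir → ℕ
  deg c d = degree (polyominoGraph P) (corner c d)

  cornerDegree : (back left backLeft : Bool) → ℕ
  cornerDegree b l bl = 2 ℕ.+ (bit (l ∨ bl) ℕ.+ bit (b ∨ bl))

  cornerDegree-cong : ∀ {n b l bl b′ l′ bl′} → n ≡ cornerDegree b l bl → b ≡ b′ → l ≡ l′ → bl ≡ bl′ →
    n ≡ cornerDegree b′ l′ bl′
  cornerDegree-cong eq refl refl refl = eq

  quadrants-true : ∀ b l bl → quadrants true l bl b ≡ cornerDegree b l bl
  quadrants-true b l bl = cong (λ n → 2 ℕ.+ (bit (l ∨ bl) ℕ.+ n)) (ℕₚ.+-identityʳ _)

  module _ {c} (c∈ : c ∈ P) where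

    quadrants-corner : ∀ d → deg c d ≡ quadrants true (mem (move (left d) c))
      (mem (move (left d) (move (opp d) c))) (mem (move (opp d) c))
    quadrants-corner northward rewrite degree-quadrants c | ∈⇒mem c∈ = refl
    quadrants-corner eastward rewrite degree-quadrants (north c) | move-opp northward c | move-opp northward (move westward c) | ∈⇒mem c∈ =
      sym (quadrants-rotate true (mem (move northward c)) (mem (move northward (move westward c))) (mem (move westward c)))
    quadrants-corner southward rewrite degree-quadrants (east (north c))
      | trans (cong (move southward) (move-opp eastward (north c))) (move-opp northward c)
      | move-opp eastward (north c) | move-opp northward (east c) | ∈⇒mem c∈ =
      sym (trans (quadrants-rotate true (mem (move eastward c)) (mem (move eastward (move northward c))) (mem (move northward c)))
        (quadrants-rotate (mem (move eastward c)) (mem (move eastward (move northward c))) (mem (move northward c)) true))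
    quadrants-corner westward rewrite degree-quadrants (east c) | cong (move southward) (move-opp eastward c) | move-opp eastward c | ∈⇒mem c∈ =
      quadrants-rotate (mem (move eastward c)) true (mem (move southward c)) (mem (move southward (move eastward c)))

    degree-corner : ∀ d → deg c d ≡ cornerDegree (mem (move (opp d) c)) (mem (move (left d) c))
      (mem (move (left d) (move (opp d) c)))
    degree-corner d = trans (quadrants-corner d) (quadrants-true
      (mem (move (opp d) c)) (mem (move (left d) c)) (mem (move (left d) (move (opp d) c))))

  endDegrees : Side → ℕ
  endDegrees (u , v) = degree (polyominoGraph P) u ℕ.+ degree (polyominoGraph P) v

  endDegrees-side : ∀ c d → endDegrees (side c d) ≡ deg c (right d) ℕ.+ deg c (opp d)
  endDegrees-side c eastward = ℕₚ.+-comm (deg c westward) (deg c southward)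
  endDegrees-side c northward = refl
  endDegrees-side c westward = refl
  endDegrees-side c southward = ℕₚ.+-comm (deg c northward) (deg c westward)

  -- Seen with heading `d`, the corners indexed by `d`, `left d`, `opp d` and `right d` are the
  -- back-left, back-right, front-right and front-left ones.
  module Corners {c} (c∈ : c ∈ P) (d : Dir) where

    front-left front-right back-left back-right : Cell
    front-left  = move (left d) (move d c)
    front-right = move (right d) (move d c)
    back-left   = move (left d) (move (opp d) c)
    back-right  = move (right d) (move (opp d) c)

    deg-backLeft : deg c d ≡ cornerDegree (mem (move (opp d) c)) (mem (move (left d) c)) (mem back-left)
    deg-backLeft = degree-corner c∈ d

    deg-backRight : deg c (left d) ≡
      cornerDegree (mem (move (right d) c)) (mem (move (opp d) c)) (mem back-right)
    deg-backRight = trans (degree-corner c∈ (left d))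
      (cong (λ x → cornerDegree (mem (move (right d) c)) (mem (move (opp d) c)) (mem x)) (move-left-comm (opp d) c))

    deg-frontLeft : deg c (right d) ≡
      cornerDegree (mem (move (left d) c)) (mem (move d c)) (mem front-left)
    deg-frontLeft = trans (degree-corner c∈ (right d)) (trans
      (cong₂ (λ x y → cornerDegree (mem (move (left y) c)) (mem (move x c)) (mem (move x (move (left y) c))))
        (left-right d) (left-right d))
      (cong (λ x → cornerDegree (mem (move (left d) c)) (mem (move d c)) (mem x)) (move-left-comm d c)))

    deg-frontRight : deg c (opp d) ≡
      cornerDegree (mem (move d c)) (mem (move (right d) c)) (mem front-right)
    deg-frontRight = trans (degree-corner c∈ (opp d))
      (cong (λ x → cornerDegree (mem (move x c)) (mem (move (right d) c)) (mem (move (right d) (move x c)))) (opp-opp d))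

    endDegrees-front : endDegrees (side c d) ≡ deg c (right d) ℕ.+ deg c (opp d)
    endDegrees-front = endDegrees-side c d

    endDegrees-left : endDegrees (side c (left d)) ≡ deg c d ℕ.+ deg c (right d)
    endDegrees-left = trans (endDegrees-side c (left d))
      (cong (λ x → deg c x ℕ.+ deg c (right d)) (left-right d))

    endDegrees-back : endDegrees (side c (opp d)) ≡ deg c (left d) ℕ.+ deg c d
    endDegrees-back = trans (endDegrees-side c (opp d))
      (cong₂ (λ x y → deg c (left x) ℕ.+ deg c y) (left-right d) (opp-opp d))

    endDegrees-right : endDegrees (side c (right d)) ≡ deg c (opp d) ℕ.+ deg c (left d)
    endDegrees-right = trans (endDegrees-side c (right d))
      (cong₂ (λ x y → deg c (left (left x)) ℕ.+ deg c (left y)) (left-right d) (left-right d))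

-- Chains as walks

-- Positions as natural numbers rather than elements of `Fin`, so that they can be shifted by the
-- length of a prefix.
data At {A : Set} : List A → ℕ → A → Set where
  here  : ∀ {x xs} → At (x ∷ xs) 0 x
  there : ∀ {x y xs k} → At xs k x → At (y ∷ xs) (suc k) x

At⇒lookup : ∀ {k} {x : A} → At xs k x → ∃[ i ] toℕ i ≡ k × lookup xs i ≡ x
At⇒lookup here       = zero , refl , refl
At⇒lookup (there at) = let i , i≡k , eq = At⇒lookup at in suc i , cong suc i≡k , eq

∈⇒At : ∀ {x : A} → x ∈ xs → ∃[ k ] At xs k x
∈⇒At (here refl) = 0 , here
∈⇒At (there x∈)  = let k , at = ∈⇒At x∈ in suc k , there at

At-++⁺ : ∀ pre {k} {x : A} → At xs k x → At (pre ++ xs) (length pre ℕ.+ k) x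
At-++⁺ []        at = at
At-++⁺ (_ ∷ pre) at = there (At-++⁺ pre at)

At-++⁻ : ∀ pre {k} {x : A} → At (pre ++ xs) (length pre ℕ.+ k) x → At xs k x
At-++⁻ []        at         = at
At-++⁻ (_ ∷ pre) (there at) = At-++⁻ pre at

Unique-++⁻ʳ : ∀ pre → Unique {A = A} (pre ++ xs) → Unique xs
Unique-++⁻ʳ []        xs!       = xs!
Unique-++⁻ʳ (_ ∷ pre) (_ ∷ xs!) = Unique-++⁻ʳ pre xs!

data Turn : Set where
  straight leftward rightward : Turn

_==_ : Turn → Turn → Bool
straight  == straight  = true
leftward  == leftward  = true
rightward == rightward = true
_         == _         = false

==⇒≡ : ∀ s t → (s == t) ≡ true → s ≡ t
==⇒≡ straight  straight  _ = refl
==⇒≡ leftward  leftward  _ = refl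
==⇒≡ rightward rightward _ = refl

==-refl : ∀ t → (t == t) ≡ true
==-refl straight  = refl
==-refl leftward  = refl
==-refl rightward = refl

infixr 9 _↻_
_↻_ : Turn → Dir → Dir
straight  ↻ d = d
leftward  ↻ d = left d
rightward ↻ d = right d

↻-injective : ∀ d s t → s ↻ d ≡ t ↻ d → s ≡ t
↻-injective d straight  straight  eq = refl
↻-injective d leftward  leftward  eq = refl
↻-injective d rightward rightward eq = refl
↻-injective eastward straight leftward ()
↻-injective northward straight leftward ()
↻-injective westward straight leftward ()
↻-injective southward straight leftward ()
↻-injective eastward straight rightward ()
↻-injective northward straight rightward ()
↻-injective westward straight rightward ()
↻-injective southward straight rightward ()
↻-injective eastward leftward straight ()
↻-injective northward leftward straight ()
↻-injective westward leftward straight ()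
↻-injective southward leftward straight ()
↻-injective eastward leftward rightward ()
↻-injective northward leftward rightward ()
↻-injective westward leftward rightward ()
↻-injective southward leftward rightward ()
↻-injective eastward rightward straight ()
↻-injective northward rightward straight ()
↻-injective westward rightward straight ()
↻-injective southward rightward straight ()
↻-injective eastward rightward leftward ()
↻-injective northward rightward leftward ()
↻-injective westward rightward leftward ()
↻-injective southward rightward leftward ()

left≢ : ∀ d → left d ≢ d
left≢ d eq with ↻-injective d leftward straight eq
... | ()

right≢ : ∀ d → right d ≢ d
right≢ d eq with ↻-injective d rightward straight eq
... | ()

↻≢opp : ∀ t d → t ↻ d ≢ opp d
↻≢opp straight  eastward ()
↻≢opp straight  northward ()
↻≢opp straight  westward ()
↻≢opp straight  southward ()
↻≢opp leftward  eastward ()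
↻≢opp leftward  northward ()
↻≢opp leftward  westward ()
↻≢opp leftward  southward ()
↻≢opp rightward eastward ()
↻≢opp rightward northward ()
↻≢opp rightward westward ()
↻≢opp rightward southward ()

turn-to : ∀ d e → e ≡ opp d ⊎ ∃[ t ] e ≡ t ↻ d
turn-to eastward eastward = inj₂ (straight , refl)
turn-to eastward northward = inj₂ (leftward , refl)
turn-to eastward westward = inj₁ refl
turn-to eastward southward = inj₂ (rightward , refl)
turn-to northward eastward = inj₂ (rightward , refl)
turn-to northward northward = inj₂ (straight , refl)
turn-to northward westward = inj₂ (leftward , refl)
turn-to northward southward = inj₁ refl
turn-to westward eastward = inj₁ refl
turn-to westward northward = inj₂ (rightward , refl)
turn-to westward westward = inj₂ (straight , refl)
turn-to westward southward = inj₂ (leftward , refl)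
turn-to southward eastward = inj₂ (leftward , refl)
turn-to southward northward = inj₁ refl
turn-to southward westward = inj₂ (rightward , refl)
turn-to southward southward = inj₂ (straight , refl)

walk : Dir → Cell → List Turn → List Cell
walk d c []       = []
walk d c (t ∷ ts) = move (t ↻ d) c ∷ walk (t ↻ d) (move (t ↻ d) c) ts

isExit : Turn → List Turn → Bool
isExit t []      = false
isExit t (s ∷ _) = t == s

module Chain {P : List Cell} (chain : IsPolyominoChain P) where

  open IsPolyominoChain chain public
  open IsPolyominoSystem isSystem public

  order : ∀ {i j x y} → At P i x → At P j y → Adjacent x y → j ≡ suc i ⊎ i ≡ suc j
  order atx aty adj with At⇒lookup atx | At⇒lookup aty
  ... | i , refl , refl | j , refl , refl = Equivalence.to (linear-order i j) adj

  consecutive : ∀ {i x y} → At P i x → At P (suc i) y → Adjacent x y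
  consecutive atx aty with At⇒lookup atx | At⇒lookup aty
  ... | i , refl , refl | j , j≡1+i , refl = Equivalence.from (linear-order i j) (inj₁ j≡1+i)

  At-unique : ∀ {i} {x y : Cell} {xs} → At xs i x → At xs i y → x ≡ y
  At-unique here      here      = refl
  At-unique (there a) (there b) = At-unique a b

  module _ {pre b c cs} (P≡ : P ≡ pre ++ b ∷ c ∷ cs) where

    private
      k : ℕ
      k = length pre

    at : ∀ j {x} → At (b ∷ c ∷ cs) j x → At P (j ℕ.+ k) x
    at j {x} a = subst₂ (λ xs i → At xs i x) (sym P≡) (ℕₚ.+-comm k j) (At-++⁺ pre a)

    at⁻ : ∀ j {x} → At P (j ℕ.+ k) x → At (b ∷ c ∷ cs) j x
    at⁻ j {x} a = At-++⁻ pre (subst₂ (λ xs i → At xs i x) P≡ (ℕₚ.+-comm j k) a)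

    suffix∈ : ∀ {x} → x ∈ b ∷ c ∷ cs → x ∈ P
    suffix∈ x∈ = subst (_ ∈_) (sym P≡) (∈-++⁺ʳ pre x∈)

    suffix-unique : Unique (b ∷ c ∷ cs)
    suffix-unique = Unique-++⁻ʳ pre (subst Unique P≡ unique)

    next-adjacent : Adjacent b c
    next-adjacent = consecutive (at 0 here) (at 1 (there here))

    neighbour : ∀ {x} → x ∈ P → Adjacent c x → x ≡ b ⊎ ∃[ cs′ ] cs ≡ x ∷ cs′
    neighbour x∈ adj with ∈⇒At x∈
    ... | i , atx with order (at 1 (there here)) atx adj
    ...   | inj₂ refl = inj₁ (At-unique atx (at 0 here))
    ...   | inj₁ refl = inj₂ (second (at⁻ 2 atx))
      where
      second : ∀ {x} → At (b ∷ c ∷ cs) 2 x → ∃[ cs′ ] cs ≡ x ∷ cs′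
      second (there (there here)) = _ , refl

  first-neighbour : ∀ {c cs} → P ≡ c ∷ cs → ∀ {x} → x ∈ P → Adjacent c x → ∃[ cs′ ] cs ≡ x ∷ cs′
  first-neighbour refl x∈ adj with ∈⇒At x∈
  ... | i , atx with order here atx adj
  ...   | inj₁ refl = second atx
    where
    second : ∀ {c cs x} → At (c ∷ cs) 1 x → ∃[ cs′ ] cs ≡ x ∷ cs′
    second (there here) = _ , refl

  not-adjacent : ∀ {pre b c e g cs} → P ≡ pre ++ b ∷ c ∷ e ∷ g ∷ cs → ¬ Adjacent b g
  not-adjacent {pre} P≡ adj with order (at {pre} P≡ 0 here) (at {pre} P≡ 3 (there (there (there here)))) adj
  ... | inj₁ eq = ℕₚ.m≢1+n+m _ {1} (sym (ℕₚ.suc-injective eq))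
  ... | inj₂ eq = ℕₚ.m≢1+n+m _ {3} eq

  -- Inductions run along a suffix while `P` stays fixed, since membership and degrees refer to the
  -- whole chain. The square just left behind joins the prefix.
  slide : ∀ pre {b : Cell} {cs} → P ≡ pre ++ b ∷ cs → P ≡ (pre ∷ʳ b) ++ cs
  slide pre P≡ = trans P≡ (sym (++-assoc pre _ _))

  as-walk : ∀ pre {b c} d cs → P ≡ pre ++ b ∷ c ∷ cs → c ≡ move d b → ∃[ ts ] cs ≡ walk d c ts
  as-walk pre d []       P≡ refl = [] , refl
  as-walk pre {b} {c} d (e ∷ cs) P≡ refl
    with Adjacent⇒move (next-adjacent {pre ∷ʳ b} (slide pre P≡))
  ... | d′ , refl with turn-to d d′
  -- Turning back would revisit `b`.
  ...   | inj₁ refl = ⊥-elim (b≢e (suffix-unique {pre} P≡) (sym (move-opp d b)))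
    where
    b≢e : ∀ {b c e : Cell} {cs} → Unique (b ∷ c ∷ e ∷ cs) → b ≢ e
    b≢e ((_ ∷ b≢e ∷ _) ∷ _) = b≢e
  ...   | inj₂ (t , refl) =
    let ts , cs≡ = as-walk (pre ∷ʳ b) (t ↻ d) cs (slide pre P≡) refl
    in t ∷ ts , cong (move (t ↻ d) c ∷_) cs≡

  module _ {pre b c d ts} (P≡ : P ≡ pre ++ b ∷ c ∷ walk d c ts) (c≡ : c ≡ move d b) where

    private
      b≡ : move (opp d) c ≡ b
      b≡ = trans (cong (move (opp d)) c≡) (move-opp d b)

    mem-back : mem P (move (opp d) c) ≡ true
    mem-back = ∈⇒mem P (subst (_∈ P) (sym b≡) (suffix∈ {pre} P≡ (here refl)))

    -- A square of `P` beside `c` is its predecessor or its successor, and no turn leads back to the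
    -- predecessor.
    mem-exit : ∀ t → mem P (move (t ↻ d) c) ≡ isExit t ts
    mem-exit t with move (t ↻ d) c ∈? P
    ... | yes x∈ with neighbour {pre} P≡ x∈ (move⇒Adjacent (t ↻ d))
    ...   | inj₁ x≡b = ⊥-elim (↻≢opp t d (move-direction (t ↻ d) (opp d) (trans x≡b (sym b≡))))
    ...   | inj₂ (cs , walk≡) = sym (exits ts walk≡)
      where
      exits : ∀ ts → walk d c ts ≡ move (t ↻ d) c ∷ cs → isExit t ts ≡ true
      exits (s ∷ ts) eq with ↻-injective d s t (move-direction (s ↻ d) (t ↻ d) (∷-injectiveˡ eq))
      ... | refl = ==-refl t
    mem-exit t | no x∉ = sym (blocked ts (suffix∈ {pre} P≡))
      where
      blocked : ∀ ts → (∀ {x} → x ∈ b ∷ c ∷ walk d c ts → x ∈ P) → isExit t ts ≡ false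
      blocked []       _ = refl
      blocked (s ∷ ts) ⊆P with t == s in eq
      ... | false = refl
      ... | true  = ⊥-elim (x∉ (⊆P (there (there (here (cong (λ t → move (t ↻ d) c) (==⇒≡ t s eq)))))))

  mem-first : ∀ {c d ts} → P ≡ c ∷ move d c ∷ walk d (move d c) ts → ∀ e → e ≢ d → mem P (move e c) ≡ false
  mem-first {c} {d} P≡ e e≢d = ∉⇒mem P λ x∈ → absurd (first-neighbour P≡ x∈ (move⇒Adjacent e))
    where
    absurd : ∀ {cs} → ∃[ cs′ ] move d c ∷ cs ≡ move e c ∷ cs′ → ⊥
    absurd (_ , eq) = e≢d (sym (move-direction d e (∷-injectiveˡ eq)))

  -- A square at the front-left corner would otherwise meet `c` in that corner alone, which
  -- `diagonal` forbids.
  mem-frontLeft-free : ∀ {c} d → c ∈ P → mem P (move d c) ≡ false → mem P (move (left d) c) ≡ false →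
    mem P (move (left d) (move d c)) ≡ false
  mem-frontLeft-free {c} d c∈ d∉ l∉ with move (left d) (move d c) ∈? P
  ... | no  _  = refl
  ... | yes x∈ with diagonal isSystem d c c∈ x∈
  ...   | inj₁ d∈ = trans (sym (∈⇒mem P d∈)) d∉
  ...   | inj₂ l∈ = trans (sym (∈⇒mem P l∈)) l∉

  mem-frontRight-free : ∀ {c} d → c ∈ P → mem P (move d c) ≡ false → mem P (move (right d) c) ≡ false →
    mem P (move (right d) (move d c)) ≡ false
  mem-frontRight-free {c} d c∈ d∉ r∉ = trans (cong (mem P) (sym (move-right-comm d c)))
    (subst (λ e → mem P (move e (move (right d) c)) ≡ false) (left-right d)
      (mem-frontLeft-free (right d) c∈ r∉ (subst (λ e → mem P (move e c) ≡ false) (sym (left-right d)) d∉)))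

-- Summation over the sides

dirs others : Dir → List Dir
others e = left e ∷ opp e ∷ right e ∷ []
dirs e   = e ∷ others e

∈dirs : ∀ e d → d ∈ dirs e
∈dirs e d with turn-to e d
... | inj₁ refl               = there (there (here refl))
... | inj₂ (straight  , refl) = here refl
... | inj₂ (leftward  , refl) = there (here refl)
... | inj₂ (rightward , refl) = there (there (there (here refl)))

dirs-unique : ∀ e → Unique (dirs e)
dirs-unique eastward = ((λ ()) ∷ (λ ()) ∷ (λ ()) ∷ []) ∷ ((λ ()) ∷ (λ ()) ∷ []) ∷ ((λ ()) ∷ []) ∷ [] ∷ []
dirs-unique northward = ((λ ()) ∷ (λ ()) ∷ (λ ()) ∷ []) ∷ ((λ ()) ∷ (λ ()) ∷ []) ∷ ((λ ()) ∷ []) ∷ [] ∷ []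
dirs-unique westward = ((λ ()) ∷ (λ ()) ∷ (λ ()) ∷ []) ∷ ((λ ()) ∷ (λ ()) ∷ []) ∷ ((λ ()) ∷ []) ∷ [] ∷ []
dirs-unique southward = ((λ ()) ∷ (λ ()) ∷ (λ ()) ∷ []) ∷ ((λ ()) ∷ (λ ()) ∷ []) ∷ ((λ ()) ∷ []) ∷ [] ∷ []

side-direction : ∀ c {d e} → side c d ≡ side c e → d ≡ e
side-direction c {d} {e} eq with side-≡ d e eq
... | inj₁ (_ , d≡e) = d≡e
... | inj₂ (c≡ , _)  = ⊥-elim (move≢ d c≡)

map-side-unique : ∀ c {ds} → Unique ds → Unique (map (side c) ds)
map-side-unique c = Unique-Properties.map⁺ (side-direction c)

figure-last : ∀ c d → figure (c ∷ []) ↭ map (side c) (dirs d)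
figure-last c d = unique-⊆⊇⇒↭ (figure-unique (c ∷ [])) (map-side-unique c (dirs-unique d)) ⊆ ⊇
  where
  ⊆ : ∀ {s} → s ∈ figure (c ∷ []) → s ∈ map (side c) (dirs d)
  ⊆ s∈ with ∈figure⁻ {c ∷ []} s∈
  ... | _ , here refl , s∈c with ∈sides⇒side c s∈c
  ...   | e , refl = ∈-map⁺ (side c) (∈dirs d e)
  ⊇ : ∀ {s} → s ∈ map (side c) (dirs d) → s ∈ figure (c ∷ [])
  ⊇ s∈ with ∈-map⁻ (side c) s∈
  ... | e , _ , refl = ∈figure⁺ {c ∷ []} (here refl) (side∈sides c e)

-- The side towards the next square is left to `cs`, so that each side is counted once. A square of
-- `cs` with any of the other three sides would be a second neighbour of `c`.
figure-∷ : ∀ c e cs → move e c ∈ cs → c ∉ cs → (∀ {x} → x ∈ cs → Adjacent c x → x ≡ move e c) →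
  figure (c ∷ cs) ↭ map (side c) (others e) ++ figure cs
figure-∷ c e cs next∈ c∉ only = unique-⊆⊇⇒↭ (figure-unique (c ∷ cs))
    (Unique-Properties.++⁺ (map-side-unique c others!) (figure-unique cs) apart) ⊆ ⊇
  where
  others! : Unique (others e)
  others! with _ ∷ u ← dirs-unique e = u
  e∉others : e ∉ others e
  e∉others e∈ with all ∷ _ ← dirs-unique e = All.lookup all e∈ refl
  apart : ∀ {s} → ¬ (s ∈ map (side c) (others e) × s ∈ figure cs)
  apart (s∈ , s∈fig) with ∈-map⁻ (side c) s∈ | ∈figure⁻ {cs} s∈fig
  ... | d , d∈ , refl | x , x∈ , s∈x with common-side (side∈sides c d) s∈x
  ...   | inj₁ refl = c∉ x∈
  ...   | inj₂ (d′ , refl , eq) with side-direction c eq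
  ...     | refl with move-direction d e (only x∈ (move⇒Adjacent d))
  ...       | refl = e∉others d∈
  ⊆ : ∀ {s} → s ∈ figure (c ∷ cs) → s ∈ map (side c) (others e) ++ figure cs
  ⊆ s∈ with ∈figure⁻ {c ∷ cs} s∈
  ... | x , there x∈ , s∈x = ∈-++⁺ʳ _ (∈figure⁺ {cs} x∈ s∈x)
  ... | _ , here refl , s∈c with ∈sides⇒side c s∈c
  ...   | d , refl with ∈dirs e d
  ...     | there d∈     = ∈-++⁺ˡ (∈-map⁺ (side c) d∈)
  ...     | here refl = ∈-++⁺ʳ _ (∈figure⁺ {cs} next∈
    (subst (_∈ sides (move e c)) (sym (side-move e c)) (side∈sides (move e c) (opp e))))
  ⊇ : ∀ {s} → s ∈ map (side c) (others e) ++ figure cs → s ∈ figure (c ∷ cs)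
  ⊇ s∈ with ∈-++⁻ (map (side c) (others e)) s∈
  ... | inj₁ s∈c with ∈-map⁻ (side c) s∈c
  ...   | d , _ , refl = ∈figure⁺ {c ∷ cs} (here refl) (side∈sides c d)
  ⊇ s∈ | inj₂ s∈fig with ∈figure⁻ {cs} s∈fig
  ...   | x , x∈ , s∈x = ∈figure⁺ {c ∷ cs} (there x∈) s∈x

-- Corner degrees and side weights in terms of turns

isKink : Turn → Bool
isKink straight  = false
isKink leftward  = true
isKink rightward = true

clash : Turn → Turn → Bool
clash leftward  leftward  = true
clash rightward rightward = true
clash _         _         = false

clashHead : Turn → List Turn → Bool
clashHead t []      = false
clashHead t (s ∷ _) = clash t s

-- Turns to the same side are never consecutive, nor separated by just one
-- straight square.
Zigzag : Turn → List Turn → Set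
Zigzag t []       = ⊤
Zigzag t (s ∷ ts) = clash t s ≡ false × (s ≡ straight → clashHead t ts ≡ false) × Zigzag s ts

-- Corner degrees of a square: `t` is the turn in the square before, `ts` starts with its own turn.
-- The unreduced sums repeat the shape of `cornerDegree`, so that known memberships can be
-- substituted directly.
backLeft backRight : Turn → List Turn → ℕ
backLeft  t ts = 2 ℕ.+ (bit (isExit leftward ts ∨ (leftward == t)) ℕ.+ 1)
backRight t ts = 2 ℕ.+ (1 ℕ.+ bit (isExit rightward ts ∨ (rightward == t)))

frontLeft frontRight : List Turn → ℕ
frontLeft []               = 2
frontLeft (straight ∷ ts)  = 2 ℕ.+ (1 ℕ.+ bit (isExit leftward ts))
frontLeft (leftward ∷ ts)  = 2 ℕ.+ (bit (isExit rightward ts) ℕ.+ 1)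
frontLeft (rightward ∷ ts) = 2
frontRight []               = 2
frontRight (straight ∷ ts)  = 2 ℕ.+ (bit (isExit rightward ts) ℕ.+ 1)
frontRight (leftward ∷ ts)  = 2
frontRight (rightward ∷ ts) = 2 ℕ.+ (1 ℕ.+ bit (isExit leftward ts))

module Summation {c ℓ} (M : CommutativeMonoid c ℓ) where

  open CommutativeMonoid M renaming (refl to ≈-refl; trans to ≈-trans; sym to ≈-sym)
  open Contributions M
  open CMSolver M using (solve; _⊜_; id) renaming (_⊕_ to _:∙_)

  sum : ∀ {A : Set} → List A → (A → Carrier) → Carrier
  sum xs f = foldr (λ a s → f a ∙ s) ε xs

  sum-↭ : ∀ {A : Set} {xs ys : List A} (f : A → Carrier) → xs ↭ ys → sum xs f ≈ sum ys f
  sum-↭ f _↭_.refl          = ≈-refl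
  sum-↭ f (_↭_.prep x p)    = ∙-congˡ (sum-↭ f p)
  sum-↭ f (_↭_.swap {xs} {ys} x y p) = ≈-trans (∙-congˡ (∙-congˡ (sum-↭ f p)))
    (solve 3 (λ a b s → a :∙ (b :∙ s) ⊜ b :∙ (a :∙ s)) ≈-refl (f x) (f y) (sum ys f))
  sum-↭ f (_↭_.trans p q)   = ≈-trans (sum-↭ f p) (sum-↭ f q)

  sum-++ : ∀ {A : Set} (f : A → Carrier) xs ys → sum (xs ++ ys) f ≈ sum xs f ∙ sum ys f
  sum-++ f []       ys = ≈-sym (identityˡ _)
  sum-++ f (x ∷ xs) ys = ≈-trans (∙-congˡ (sum-++ f xs ys)) (≈-sym (assoc _ _ _))

  module _ (f : ℕ → Carrier) where

    exitSides : Turn → Turn → List Turn → Carrier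
    exitSides t₋ straight  ts = let xs = straight ∷ ts in
      f (backLeft t₋ xs ℕ.+ frontLeft xs) ∙ (f (backRight t₋ xs ℕ.+ backLeft t₋ xs) ∙ (f (frontRight xs ℕ.+ backRight t₋ xs) ∙ ε))
    exitSides t₋ leftward  ts = let xs = leftward ∷ ts in
      f (backRight t₋ xs ℕ.+ backLeft t₋ xs) ∙ (f (frontRight xs ℕ.+ backRight t₋ xs) ∙ (f (frontLeft xs ℕ.+ frontRight xs) ∙ ε))
    exitSides t₋ rightward ts = let xs = rightward ∷ ts in
      f (frontLeft xs ℕ.+ frontRight xs) ∙ (f (backLeft t₋ xs ℕ.+ frontLeft xs) ∙ (f (backRight t₋ xs ℕ.+ backLeft t₋ xs) ∙ ε))

    private
      middle-first : ∀ a b c → a ∙ (b ∙ (c ∙ ε)) ≈ b ∙ (a ∙ c)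
      middle-first = solve 3 (λ a b c → a :∙ (b :∙ (c :∙ id)) ⊜ b :∙ (a :∙ c)) ≈-refl
      rotated : ∀ a b c → a ∙ (b ∙ (c ∙ ε)) ≈ b ∙ (c ∙ a)
      rotated = solve 3 (λ a b c → a :∙ (b :∙ (c :∙ id)) ⊜ b :∙ (c :∙ a)) ≈-refl
      direct : ∀ a b c → a ∙ (b ∙ (c ∙ ε)) ≈ a ∙ (b ∙ c)
      direct = solve 3 (λ a b c → a :∙ (b :∙ (c :∙ id)) ⊜ a :∙ (b :∙ c)) ≈-refl
      reversed : ∀ a b c → a ∙ (b ∙ (c ∙ ε)) ≈ c ∙ (b ∙ a)
      reversed = solve 3 (λ a b c → a :∙ (b :∙ (c :∙ id)) ⊜ c :∙ (b :∙ a)) ≈-refl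

    -- `inner` sees kinks but not their sides. `Zigzag` removes the cases where the side would
    -- matter: around a straight square, turns to the same side would give lateral weights at 8 and
    -- 6 instead of 7 and 7.
    exitSides≈inner : ∀ t₋ t ts → Zigzag t₋ (t ∷ ts) →
      exitSides t₋ t ts ≈ inner f (isKink t₋) (isKink t) (headBit (map isKink ts))
    exitSides≈inner straight  straight []               _ = middle-first _ _ _
    exitSides≈inner straight  straight (straight ∷ _)   _ = middle-first _ _ _
    exitSides≈inner straight  straight (leftward ∷ _)   _ = middle-first _ _ _
    exitSides≈inner straight  straight (rightward ∷ _)  _ = rotated _ _ _
    exitSides≈inner leftward  straight []               _ = middle-first _ _ _
    exitSides≈inner leftward  straight (straight ∷ _)   _ = middle-first _ _ _
    exitSides≈inner leftward  straight (leftward ∷ _)   (_ , s , _) with s refl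
    ... | ()
    exitSides≈inner leftward  straight (rightward ∷ _)  _ = middle-first _ _ _
    exitSides≈inner rightward straight []               _ = rotated _ _ _
    exitSides≈inner rightward straight (straight ∷ _)   _ = rotated _ _ _
    exitSides≈inner rightward straight (leftward ∷ _)   _ = rotated _ _ _
    exitSides≈inner rightward straight (rightward ∷ _)  (_ , s , _) with s refl
    ... | ()
    exitSides≈inner leftward  leftward  _               (() , _)
    exitSides≈inner rightward rightward _               (() , _)
    exitSides≈inner straight  leftward []               _ = direct _ _ _
    exitSides≈inner straight  leftward (straight ∷ _)   _ = direct _ _ _
    exitSides≈inner straight  leftward (rightward ∷ _)  _ = direct _ _ _
    exitSides≈inner straight  leftward (leftward ∷ _)   (_ , _ , () , _)
    exitSides≈inner rightward leftward []               _ = direct _ _ _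
    exitSides≈inner rightward leftward (straight ∷ _)   _ = direct _ _ _
    exitSides≈inner rightward leftward (rightward ∷ _)  _ = direct _ _ _
    exitSides≈inner rightward leftward (leftward ∷ _)   (_ , _ , () , _)
    exitSides≈inner straight  rightward []              _ = reversed _ _ _
    exitSides≈inner straight  rightward (straight ∷ _)  _ = reversed _ _ _
    exitSides≈inner straight  rightward (leftward ∷ _)  _ = reversed _ _ _
    exitSides≈inner straight  rightward (rightward ∷ _) (_ , _ , () , _)
    exitSides≈inner leftward  rightward []              _ = reversed _ _ _
    exitSides≈inner leftward  rightward (straight ∷ _)  _ = reversed _ _ _
    exitSides≈inner leftward  rightward (leftward ∷ _)  _ = reversed _ _ _
    exitSides≈inner leftward  rightward (rightward ∷ _) (_ , _ , () , _)

    lastSides : Turn → Carrier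
    lastSides t₋ = f 4 ∙ (f (backLeft t₋ [] ℕ.+ 2) ∙ (f (backRight t₋ [] ℕ.+ backLeft t₋ []) ∙ (f (2 ℕ.+ backRight t₋ []) ∙ ε)))

    lastSides≈lastSum : ∀ t₋ → lastSides t₋ ≈ lastSum f (isKink t₋)
    lastSides≈lastSum straight  = solve 4 (λ a b c d → a :∙ (b :∙ (c :∙ (d :∙ id))) ⊜ c :∙ (b :∙ (d :∙ a))) ≈-refl _ _ _ _
    lastSides≈lastSum leftward  = solve 4 (λ a b c d → a :∙ (b :∙ (c :∙ (d :∙ id))) ⊜ c :∙ (d :∙ (b :∙ a))) ≈-refl _ _ _ _
    lastSides≈lastSum rightward = solve 4 (λ a b c d → a :∙ (b :∙ (c :∙ (d :∙ id))) ⊜ c :∙ (b :∙ (d :∙ a))) ≈-refl _ _ _ _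

    firstSides : List Turn → Carrier
    firstSides ts = f (2 ℕ.+ frontLeft (straight ∷ ts)) ∙ (f 4 ∙ (f (frontRight (straight ∷ ts) ℕ.+ 2) ∙ ε))

    firstSides≈firstSum : ∀ ts → firstSides ts ≈ firstSum f (headBit (map isKink ts))
    firstSides≈firstSum []              = middle-first _ _ _
    firstSides≈firstSum (straight ∷ _)  = middle-first _ _ _
    firstSides≈firstSum (leftward ∷ _)  = rotated _ _ _
    firstSides≈firstSum (rightward ∷ _) = middle-first _ _ _

module _ {P : List Cell} (chain : IsPolyominoChain P) where

  open Chain chain

  -- Stated with the memberships as hypotheses, not with a position in the chain, so that it also
  -- covers the first square, which has no predecessor.
  module Front {c d} (c∈ : c ∈ P) (ts : List Turn)
    (exits : ∀ t → mem P (move (t ↻ d) c) ≡ isExit t ts)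
    (next  : ∀ {t ts′} → ts ≡ t ∷ ts′ → ∀ t′ → mem P (move (t′ ↻ t ↻ d) (move (t ↻ d) c)) ≡ isExit t′ ts′) where

    open Corners P c∈ d

    deg-frontLeft≡ : ∀ us → ts ≡ us → deg P c (right d) ≡ frontLeft us
    deg-frontLeft≡ [] refl = cornerDegree-cong P deg-frontLeft (exits leftward) (exits straight)
      (mem-frontLeft-free d c∈ (exits straight) (exits leftward))
    deg-frontLeft≡ (straight ∷ us) refl =
      cornerDegree-cong P deg-frontLeft (exits leftward) (exits straight) (next refl leftward)
    -- After a left turn, the front-left square is the one to the right of the next square.
    deg-frontLeft≡ (leftward ∷ us) refl =
      cornerDegree-cong P deg-frontLeft (exits leftward) (exits straight) (trans
        (sym (cong (mem P) (trans
          (cong (λ e → move e (move (left d) c)) (left-right d)) (move-left-comm d c))))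
        (next refl rightward))
    deg-frontLeft≡ (rightward ∷ us) refl = cornerDegree-cong P deg-frontLeft (exits leftward) (exits straight)
      (mem-frontLeft-free d c∈ (exits straight) (exits leftward))

    deg-frontRight≡ : ∀ us → ts ≡ us → deg P c (opp d) ≡ frontRight us
    deg-frontRight≡ [] refl = cornerDegree-cong P deg-frontRight (exits straight) (exits rightward)
      (mem-frontRight-free d c∈ (exits straight) (exits rightward))
    deg-frontRight≡ (straight ∷ us) refl =
      cornerDegree-cong P deg-frontRight (exits straight) (exits rightward) (next refl rightward)
    deg-frontRight≡ (leftward ∷ us) refl = cornerDegree-cong P deg-frontRight (exits straight) (exits rightward)
      (mem-frontRight-free d c∈ (exits straight) (exits rightward))
    deg-frontRight≡ (rightward ∷ us) refl =
      cornerDegree-cong P deg-frontRight (exits straight) (exits rightward) (trans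
        (sym (cong (mem P) (trans
          (cong (λ e → move e (move (right d) c)) (left-right d)) (move-right-comm d c))))
        (next refl leftward))

  -- In the frame of the new heading, the predecessor of `c` lies on the left exactly after a left
  -- turn. Otherwise the square on the left is an exit that was not taken.
  behind-left : ∀ pre {b c d} t {ts} → P ≡ pre ++ b ∷ c ∷ walk d c (t ∷ ts) → c ≡ move d b →
    mem P (move (left (t ↻ d)) c) ≡ (leftward == t)
  behind-left pre {c = c} {d} straight {ts} P≡ c≡ = mem-exit {pre} {ts = straight ∷ ts} P≡ c≡ leftward
  behind-left pre {c = c} {d} leftward {ts} P≡ c≡ = mem-back {pre} {ts = leftward ∷ ts} P≡ c≡
  behind-left pre {c = c} {d} rightward {ts} P≡ c≡ =
    trans (cong (λ e → mem P (move e c)) (left-right d)) (mem-exit {pre} {ts = rightward ∷ ts} P≡ c≡ straight)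

  behind-right : ∀ pre {b c d} t {ts} → P ≡ pre ++ b ∷ c ∷ walk d c (t ∷ ts) → c ≡ move d b →
    mem P (move (right (t ↻ d)) c) ≡ (rightward == t)
  behind-right pre {c = c} {d} straight {ts} P≡ c≡ = mem-exit {pre} {ts = straight ∷ ts} P≡ c≡ rightward
  behind-right pre {c = c} {d} leftward {ts} P≡ c≡ =
    trans (cong (λ e → mem P (move e c)) (left-right d)) (mem-exit {pre} {ts = leftward ∷ ts} P≡ c≡ straight)
  behind-right pre {c = c} {d} rightward {ts} P≡ c≡ =
    trans (cong (λ e → mem P (move (left (left e)) c)) (left-right d)) (mem-back {pre} {ts = rightward ∷ ts} P≡ c≡)

  -- t₋ is the turn at b.
  module Here pre {b c d} ts (P≡ : P ≡ pre ++ b ∷ c ∷ walk d c ts) (c≡ : c ≡ move d b) t₋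
    (left≡  : mem P (move (left d) b) ≡ (leftward == t₋))
    (right≡ : mem P (move (right d) b) ≡ (rightward == t₋)) where

    c∈ : c ∈ P
    c∈ = suffix∈ {pre} P≡ (there (here refl))

    back≡ : move (opp d) c ≡ b
    back≡ = trans (cong (move (opp d)) c≡) (move-opp d b)

    exits : ∀ t → mem P (move (t ↻ d) c) ≡ isExit t ts
    exits = mem-exit {pre} P≡ c≡

    back : mem P (move (opp d) c) ≡ true
    back = mem-back {pre} P≡ c≡

    next : ∀ {t ts′} → ts ≡ t ∷ ts′ → ∀ t′ → mem P (move (t′ ↻ t ↻ d) (move (t ↻ d) c)) ≡ isExit t′ ts′
    next refl = mem-exit {pre ∷ʳ b} (slide pre P≡) refl

    open Front c∈ ts exits next public
    open Corners P c∈ d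

    deg-backLeft≡ : deg P c d ≡ backLeft t₋ ts
    deg-backLeft≡ = cornerDegree-cong P deg-backLeft back (exits leftward) (trans (cong (λ x → mem P (move (left d) x)) back≡) left≡)

    deg-backRight≡ : deg P c (left d) ≡ backRight t₋ ts
    deg-backRight≡ = cornerDegree-cong P deg-backRight (exits rightward) back (trans (cong (λ x → mem P (move (right d) x)) back≡) right≡)

    front-sum : endDegrees P (side c d) ≡ frontLeft ts ℕ.+ frontRight ts
    front-sum = trans endDegrees-front (cong₂ ℕ._+_ (deg-frontLeft≡ ts refl) (deg-frontRight≡ ts refl))

    left-sum : endDegrees P (side c (left d)) ≡ backLeft t₋ ts ℕ.+ frontLeft ts
    left-sum = trans endDegrees-left (cong₂ ℕ._+_ deg-backLeft≡ (deg-frontLeft≡ ts refl))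

    back-sum : endDegrees P (side c (opp d)) ≡ backRight t₋ ts ℕ.+ backLeft t₋ ts
    back-sum = trans endDegrees-back (cong₂ ℕ._+_ deg-backRight≡ deg-backLeft≡)

    right-sum : endDegrees P (side c (right d)) ≡ frontRight ts ℕ.+ backRight t₋ ts
    right-sum = trans endDegrees-right (cong₂ ℕ._+_ (deg-frontRight≡ ts refl) deg-backRight≡)

  peel : ∀ pre {b c e cs} → P ≡ pre ++ b ∷ c ∷ move e c ∷ cs →
    figure (c ∷ move e c ∷ cs) ↭ map (side c) (others e) ++ figure (move e c ∷ cs)
  peel pre {b} {c} {e} {cs} P≡ = figure-∷ c e (move e c ∷ cs) (here refl) (c∉ (suffix-unique {pre} P≡)) only
    where
    c∉ : ∀ {b c : Cell} {cs} → Unique (b ∷ c ∷ cs) → c ∉ cs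
    c∉ (_ ∷ all ∷ _) c∈ = All.lookup all c∈ refl
    only : ∀ {x} → x ∈ move e c ∷ cs → Adjacent c x → x ≡ move e c
    only x∈ adj with neighbour {pre} P≡ (suffix∈ {pre} P≡ (there (there x∈))) adj
    ... | inj₂ (_ , refl) = refl
    ... | inj₁ refl = ⊥-elim (b∉ (suffix-unique {pre} P≡) x∈)
      where
      b∉ : ∀ {b c : Cell} {cs} → Unique (b ∷ c ∷ cs) → b ∉ cs
      b∉ ((_ ∷ all) ∷ _) b∈ = All.lookup all b∈ refl

  module _ {c ℓ} (M : CommutativeMonoid c ℓ) where

    open CommutativeMonoid M renaming (refl to ≈-refl; trans to ≈-trans; sym to ≈-sym)
    open Contributions M
    open Summation M
    open CMSolver M using (solve; _⊜_; id) renaming (_⊕_ to _:∙_)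

    module _ (f : ℕ → Carrier) where

      weight : Side → Carrier
      weight s = f (endDegrees P s)

      private
        f-cong : ∀ {m n} → m ≡ n → f m ≈ f n
        f-cong refl = ≈-refl

      -- The list of sides shrinks with the suffix, while `weight` keeps the degrees of the whole
      -- chain. The memberships beside `b` are all that is remembered of the prefix.
      sum-from : ∀ pre {b c d} ts → P ≡ pre ++ b ∷ c ∷ walk d c ts → c ≡ move d b → ∀ t₋ →
        mem P (move (left d) b) ≡ (leftward == t₋) → mem P (move (right d) b) ≡ (rightward == t₋) →
        Zigzag t₋ ts → sum (figure (c ∷ walk d c ts)) weight ≈ sumFrom f (isKink t₋) (map isKink ts)
      sum-from pre {b} {c} {d} [] P≡ c≡ t₋ bl br _ = ≈-trans (sum-↭ weight (figure-last c d))
        (≈-trans (∙-cong (f-cong front-sum) (∙-cong (f-cong left-sum) (∙-cong (f-cong back-sum) (∙-congʳ (f-cong right-sum)))))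
        (lastSides≈lastSum f t₋))
        where open Here pre [] P≡ c≡ t₋ bl br
      sum-from pre {b} {c} {d} (t ∷ ts) P≡ c≡ t₋ bl br zz = ≈-trans (sum-↭ weight (peel pre P≡))
        (≈-trans (sum-++ weight (map (side c) (others (t ↻ d))) (figure (move (t ↻ d) c ∷ walk (t ↻ d) (move (t ↻ d) c) ts)))
        (∙-cong (≈-trans (sides-sum t refl) (exitSides≈inner f t₋ t ts zz))
          (sum-from (pre ∷ʳ b) ts (slide pre P≡) refl t (behind-left pre t P≡ c≡) (behind-right pre t P≡ c≡) (proj₂ (proj₂ zz)))))
        where
        open Here pre (t ∷ ts) P≡ c≡ t₋ bl br
        sides-sum : ∀ s → s ≡ t → sum (map (side c) (others (s ↻ d))) weight ≈ exitSides f t₋ s ts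
        sides-sum straight  refl = ∙-cong (f-cong left-sum) (∙-cong (f-cong back-sum) (∙-congʳ (f-cong right-sum)))
        sides-sum leftward  refl = ∙-cong (f-cong back-sum) (∙-cong (f-cong right-sum)
          (∙-congʳ (f-cong (trans (cong (λ e → endDegrees P (side c e)) (left-right d)) front-sum))))
        sides-sum rightward refl = ∙-cong (f-cong (trans (cong (λ e → endDegrees P (side c e)) (left-right d)) front-sum))
          (∙-cong (f-cong (trans (cong (λ e → endDegrees P (side c (left e))) (left-right d)) left-sum))
          (∙-congʳ (f-cong (trans (cong (λ e → endDegrees P (side c (opp e))) (left-right d)) back-sum))))

      sum-figure : ∀ {c d} ts → P ≡ c ∷ move d c ∷ walk d (move d c) ts → Zigzag straight ts →
        sum (figure P) weight ≈ total f (map isKink ts)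
      sum-figure {c} {d} ts P≡ zz = ≈-trans (sum-↭ weight peel-first)
        (≈-trans (sum-++ weight (map (side c) (others d)) (figure cs))
        (∙-cong (≈-trans sides-sum (firstSides≈firstSum f ts))
          (sum-from [] ts P≡ refl straight (not-d (left≢ d)) (not-d (right≢ d)) zz)))
        where
        cs = move d c ∷ walk d (move d c) ts
        not-d : ∀ {e} → e ≢ d → mem P (move e c) ≡ false
        not-d = mem-first P≡ _
        back : mem P (move (opp d) c) ≡ false
        back = not-d (λ eq → ↻≢opp straight d (sym eq))
        c∈ : c ∈ P
        c∈ = suffix∈ {[]} P≡ (here refl)
        -- The first square is treated as if crossed straight ahead, hence the additional
        -- `straight`.
        exits : ∀ t → mem P (move (t ↻ d) c) ≡ isExit t (straight ∷ ts)
        exits straight  = ∈⇒mem P (suffix∈ {[]} P≡ (there (here refl)))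
        exits leftward  = not-d (left≢ d)
        exits rightward = not-d (right≢ d)
        next : ∀ {t ts′} → straight ∷ ts ≡ t ∷ ts′ →
          ∀ t′ → mem P (move (t′ ↻ t ↻ d) (move (t ↻ d) c)) ≡ isExit t′ ts′
        next refl = mem-exit {[]} P≡ refl
        open Front c∈ (straight ∷ ts) exits next
        open Corners P c∈ d
        end-left : deg P c d ≡ 2
        end-left rewrite deg-backLeft | back | not-d (left≢ d) | move-left-comm (left d) c
          | mem-frontLeft-free (left d) c∈ (not-d (left≢ d)) back = refl
        end-right : deg P c (left d) ≡ 2
        end-right rewrite deg-backRight | back | not-d (right≢ d)
          | mem-frontLeft-free (opp d) c∈ back (not-d (right≢ d)) = refl
        sides-sum : sum (map (side c) (others d)) weight ≈ firstSides f ts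
        sides-sum = ∙-cong (f-cong (trans endDegrees-left (cong₂ ℕ._+_ end-left (deg-frontLeft≡ (straight ∷ ts) refl))))
          (∙-cong (f-cong (trans endDegrees-back (cong₂ ℕ._+_ end-right end-left)))
          (∙-congʳ (f-cong (trans endDegrees-right (cong₂ ℕ._+_ (deg-frontRight≡ (straight ∷ ts) refl) end-right)))))
        peel-first : figure P ↭ map (side c) (others d) ++ figure cs
        peel-first = subst (λ xs → figure xs ↭ map (side c) (others d) ++ figure cs) (sym P≡)
          (figure-∷ c d cs (here refl) (c∉ (suffix-unique {[]} P≡)) only)
          where
          c∉ : ∀ {c : Cell} {cs} → Unique (c ∷ cs) → c ∉ cs
          c∉ (all ∷ _) c∈ = All.lookup all c∈ refl
          only : ∀ {x} → x ∈ cs → Adjacent c x → x ≡ move d c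
          only x∈ adj with first-neighbour P≡ (suffix∈ {[]} P≡ (there x∈)) adj
          ... | _ , refl = refl

-- Segments

module Exterior (P : List Cell) where

  ∉⇒Open : ∀ {c} d → c ∉ P → move d c ∉ P → Open P c (move d c)
  ∉⇒Open {c} d c∉ d∉ = side c d , side∈sides c d
    , subst (_∈ sides (move d c)) (sym (side-move d c)) (side∈sides (move d c) (opp d)) , undrawn
    where
    undrawn : side c d ∉ figure P
    undrawn s∈ with ∈figure⁻ {P} s∈
    ... | x , x∈ , s∈x with common-side (side∈sides c d) s∈x
    ...   | inj₁ refl = c∉ x∈
    ...   | inj₂ (e , refl , eq) with side-≡ d e eq
    ...     | inj₁ (_ , refl) = d∉ x∈
    ...     | inj₂ (c≡ , _)   = move≢ d c≡

  SameRegion-sym : ∀ {c d} → SameRegion P c d → SameRegion P d c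
  SameRegion-sym = Star-reverse λ (s , s∈c , s∈d , s∉) → s , s∈d , s∈c , s∉

  module _ (g : ℤ → Cell) (step : ∀ i → Open P (g i) (g (ℤ.suc i))) where

    private
      up : ∀ n i → SameRegion P (g i) (g (+ n ℤ.+ i))
      up zero    i = subst (λ k → SameRegion P (g i) (g k)) (sym (ℤₚ.+-identityˡ i)) nil
      up (suc n) i = up n i ◅◅ subst (λ k → SameRegion P (g (+ n ℤ.+ i)) (g k))
        (sym (ℤₚ.+-assoc (+ 1) (+ n) i)) (step (+ n ℤ.+ i) ◅ nil)

    line-connected : ∀ i j → SameRegion P (g i) (g j)
    line-connected i j with ℤₚ.≤-total i j
    ... | inj₁ i≤j = subst (λ k → SameRegion P (g i) (g k)) (∣j-i∣+i≡j i≤j) (up ℤ.∣ j ℤ.- i ∣ i)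
    ... | inj₂ j≤i = SameRegion-sym
      (subst (λ k → SameRegion P (g j) (g k)) (∣j-i∣+i≡j j≤i) (up ℤ.∣ i ℤ.- j ∣ j))

  -- Squares in one row, bounded on one side: walk along a free row to the free
  -- column before the first square.
  module _ (at : ℤ → ℤ → Cell) {u v} (at-u : ∀ a b → move u (at a b) ≡ at (ℤ.suc a) b)
           (at-v : ∀ a b → move v (at a b) ≡ at a (ℤ.suc b))
           (coordinates : ∀ c → ∃[ a ] ∃[ b ] c ≡ at a b)
           {a₀ b₀} (bounded : ∀ {a b} → at a b ∈ P → a₀ ℤ.≤ a × b ≡ b₀) where

    private
      open-u : ∀ {a b} → at a b ∉ P → at (ℤ.suc a) b ∉ P → Open P (at a b) (at (ℤ.suc a) b)
      open-u {a} {b} ∉₁ ∉₂ = subst (Open P (at a b)) (at-u a b) (∉⇒Open u ∉₁ (subst (_∉ P) (sym (at-u a b)) ∉₂))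

      open-v : ∀ {a b} → at a b ∉ P → at a (ℤ.suc b) ∉ P → Open P (at a b) (at a (ℤ.suc b))
      open-v {a} {b} ∉₁ ∉₂ = subst (Open P (at a b)) (at-v a b) (∉⇒Open v ∉₁ (subst (_∉ P) (sym (at-v a b)) ∉₂))

      free-row : ∀ {a b} → b ≢ b₀ → at a b ∉ P
      free-row b≢ ∈P = b≢ (proj₂ (bounded ∈P))

      free-column : ∀ {b} → at (ℤ.pred a₀) b ∉ P
      free-column ∈P = ℤₚ.<-irrefl refl (ℤₚ.i≤pred[j]⇒i<j (proj₁ (bounded ∈P)))

      from-row : ∀ {a b} → b ≢ b₀ → SameRegion P (at a b) (at (ℤ.pred a₀) (ℤ.suc b₀))
      from-row {a} {b} b≢ =
        line-connected (λ a → at a b) (λ a → open-u (free-row b≢) (free-row b≢)) a (ℤ.pred a₀)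
        ◅◅ line-connected (at (ℤ.pred a₀)) (λ b → open-v free-column free-column) b (ℤ.suc b₀)

      to-origin : ∀ {c} → c ∉ P → SameRegion P c (at (ℤ.pred a₀) (ℤ.suc b₀))
      to-origin {c} c∉ with coordinates c
      ... | a , b , refl with b ℤ.≟ b₀
      ...   | no  b≢   = from-row b≢
      ...   | yes refl = open-v c∉ (free-row 1+b≢b) ◅ from-row 1+b≢b
        where
        1+b≢b : ℤ.suc b ≢ b
        1+b≢b eq = i≢suc[i] (sym eq)

    row-exterior : ∀ {c d} → c ∉ P → d ∉ P → SameRegion P c d
    row-exterior c∉ d∉ = to-origin c∉ ◅◅ SameRegion-sym (to-origin d∉)

line : ℕ → Dir → Cell → List Cell
line zero    d c = []
line (suc n) d c = c ∷ line n d (move d c)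

pred-≤ : ∀ i → ℤ.pred i ℤ.≤ i
pred-≤ i = ℤₚ.i≤j⇒pred[i]≤j ℤₚ.≤-refl

lower : ℕ → ℤ → ℤ
lower zero    i = i
lower (suc n) i = lower n (ℤ.pred i)

lower-≤ : ∀ n i → lower n i ℤ.≤ i
lower-≤ zero    i = ℤₚ.≤-refl
lower-≤ (suc n) i = ℤₚ.≤-trans (lower-≤ n (ℤ.pred i)) (pred-≤ i)

line-E : ∀ n {x y a b} → (a , b) ∈ line n eastward (x , y) → x ℤ.≤ a × b ≡ y
line-E (suc n) (here refl) = ℤₚ.≤-refl , refl
line-E (suc n) {x} (there ∈P) = let le , eq = line-E n ∈P in ℤₚ.≤-trans (ℤₚ.i≤suc[i] x) le , eq

line-N : ∀ n {x y a b} → (b , a) ∈ line n northward (x , y) → y ℤ.≤ a × b ≡ x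
line-N (suc n) (here refl) = ℤₚ.≤-refl , refl
line-N (suc n) {_} {y} (there ∈P) = let le , eq = line-N n ∈P in ℤₚ.≤-trans (ℤₚ.i≤suc[i] y) le , eq

line-W : ∀ n {x y a b} → (a , b) ∈ line n westward (x , y) → lower n x ℤ.≤ a × b ≡ y
line-W (suc n) {x} (here refl) = lower-≤ (suc n) x , refl
line-W (suc n) (there ∈P) = line-W n ∈P

line-S : ∀ n {x y a b} → (b , a) ∈ line n southward (x , y) → lower n y ℤ.≤ a × b ≡ x
line-S (suc n) {_} {y} (here refl) = lower-≤ (suc n) y , refl
line-S (suc n) (there ∈P) = line-S n ∈P

-- A segment has to be a polyomino system by itself, so its complement must be a single region.
-- `lower n` bounds the rows that run in the negative direction.
line-exterior : ∀ n d x {b c} → b ∉ line n d x → c ∉ line n d x → SameRegion (line n d x) b c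
line-exterior n eastward x = Exterior.row-exterior (line n eastward x) _,_ {eastward} {northward} (λ _ _ → refl) (λ _ _ → refl)
  (λ (a , b) → a , b , refl) (line-E n)
line-exterior n westward x = Exterior.row-exterior (line n westward x) _,_ {eastward} {northward} (λ _ _ → refl) (λ _ _ → refl)
  (λ (a , b) → a , b , refl) (line-W n)
line-exterior n northward x = Exterior.row-exterior (line n northward x) (λ a b → b , a) {northward} {eastward} (λ _ _ → refl) (λ _ _ → refl)
  (λ (b , a) → a , b , refl) (line-N n)
line-exterior n southward x = Exterior.row-exterior (line n southward x) (λ a b → b , a) {northward} {eastward} (λ _ _ → refl) (λ _ _ → refl)
  (λ (b , a) → a , b , refl) (line-S n)

-- Sublists and sub-chains

Contains : List A → List A → Set
Contains xs ys = ∃[ pre ] ∃[ post ] xs ≡ pre ++ ys ++ post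

Infix⇒Contains : {xs ys : List A} → Infix _≡_ ys xs → Contains xs ys
Infix⇒Contains inf with toView inf
... | MkView pre eqs post with Pointwise-≡⇒≡ eqs
...   | refl = pre , post , refl

Contains⇒Infix : {xs ys : List A} → Contains xs ys → Infix _≡_ ys xs
Contains⇒Infix (pre , post , refl) = fromView (MkView pre (≡⇒Pointwise-≡ refl) post)

Contains-trans : {xs ys zs : List A} → Contains xs ys → Contains ys zs → Contains xs zs
Contains-trans {zs = zs} (p , q , refl) (u , v , refl) = p ++ u , v ++ q , (begin
  p ++ (u ++ zs ++ v) ++ q        ≡⟨ cong (p ++_) (++-assoc u (zs ++ v) q) ⟩
  p ++ u ++ (zs ++ v) ++ q        ≡⟨ cong (λ r → p ++ u ++ r) (++-assoc zs v q) ⟩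
  p ++ u ++ zs ++ v ++ q          ≡⟨ ++-assoc p u _ ⟨
  (p ++ u) ++ zs ++ v ++ q        ∎)
  where open ≡-Reasoning

At-lookup : (xs : List A) → ∀ i → At xs (toℕ i) (lookup xs i)
At-lookup (x ∷ xs) zero    = here
At-lookup (x ∷ xs) (suc i) = there (At-lookup xs i)

At-++ˡ : ∀ {xs} ys {k} {x : A} → At xs k x → At (xs ++ ys) k x
At-++ˡ ys here       = here
At-++ˡ ys (there at) = there (At-++ˡ ys at)

Unique-++⁻ˡ : ∀ xs {ys : List A} → Unique (xs ++ ys) → Unique xs
Unique-++⁻ˡ []       _          = []
Unique-++⁻ˡ (x ∷ xs) (all ∷ u) = All.tabulate (λ y∈ → All.lookup all (∈-++⁺ˡ y∈)) ∷ Unique-++⁻ˡ xs u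

constant⇒length≢2 : ∀ {y} {xs : List A} → Unique xs → (∀ {x} → x ∈ xs → x ≡ y) → length xs ≢ 2
constant⇒length≢2 {xs = _ ∷ _ ∷ []} ((x≢ ∷ _) ∷ _) const refl =
  x≢ (trans (const (here refl)) (sym (const (there (here refl)))))

linked-from-head : ∀ {x xs y} → Linked Adjacent (x ∷ xs) → y ∈ x ∷ xs → Star (λ a b → Adjacent a b × b ∈ x ∷ xs) x y
linked-from-head _           (here refl) = nil
linked-from-head (adj ∷ lnk) (there y∈) =
  (adj , there (here refl)) ◅ Star-map (map₂ there) (linked-from-head lnk y∈)

linked-to-head : ∀ {x xs y} → Linked Adjacent (x ∷ xs) → y ∈ x ∷ xs → Star (λ a b → Adjacent a b × b ∈ x ∷ xs) y x
linked-to-head _           (here refl) = nil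
linked-to-head (adj ∷ lnk) (there y∈) =
  Star-map (map₂ there) (linked-to-head lnk y∈) ◅◅ (Adjacent-sym adj , here refl) ◅ nil

module SubChain {P : List Cell} (chain : IsPolyominoChain P) where

  open Chain chain

  -- Connectedness of the outside is the only property not inherited from P.
  module _ {S pre post} (P≡ : P ≡ pre ++ S ++ post)
           (outside : ∀ {c d} → c ∉ S → d ∉ S → SameRegion S c d) where

    private
      atP : ∀ {k x} → At S k x → At P (length pre ℕ.+ k) x
      atP {k} {x} a = subst (λ xs → At xs (length pre ℕ.+ k) x) (sym P≡) (At-++⁺ pre (At-++ˡ post a))

      S-consecutive : ∀ {k x y} → At S k x → At S (suc k) y → Adjacent x y
      S-consecutive {k} {x} {y} a b =
        consecutive (atP a) (subst (λ j → At P j y) (ℕₚ.+-suc (length pre) k) (atP b))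

      linked : ∀ R → (∀ {k x y} → At R k x → At R (suc k) y → Adjacent x y) → Linked Adjacent R
      linked []          _  = []
      linked (x ∷ [])    _  = [-]
      linked (x ∷ y ∷ R) adj = adj here (there here) ∷ linked (y ∷ R) λ a b → adj (there a) (there b)

      S-linked : Linked Adjacent S
      S-linked = linked S S-consecutive

      S-unique : Unique S
      S-unique = Unique-++⁻ˡ S (Unique-++⁻ʳ pre (subst Unique P≡ unique))

      connected-list : ∀ R → Linked Adjacent R → ∀ {c d} → c ∈ R → d ∈ R → Star (λ a b → Adjacent a b × b ∈ R) c d
      connected-list (x ∷ R) lnk c∈ d∈ = linked-to-head lnk c∈ ◅◅ linked-from-head lnk d∈

    sub-chain : IsPolyominoChain S
    sub-chain = record
      { isSystem = record
        { unique    = S-unique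
        ; connected = connected-list S S-linked
        ; external  = outside
        }
      ; at-most-two = λ {c} c∈ → ℕₚ.≤-trans (fewer c) (at-most-two (subst (c ∈_) (sym P≡) (∈-++⁺ʳ pre (∈-++⁺ˡ c∈))))
      ; linear-order = λ i j → mk⇔ (to i j) (from i j)
      }
      where
      fewer : ∀ c → length (neighbours S c) ℕ.≤ length (neighbours P c)
      fewer c = begin
        length (neighbours S c)                                  ≤⟨ ℕₚ.m≤m+n _ _ ⟩
        length (neighbours S c) ℕ.+ length (neighbours post c)   ≡⟨ length-++ (neighbours S c) ⟨
        length (neighbours S c ++ neighbours post c)             ≡⟨ cong length (filter-++ (adjacent? c) S post) ⟨
        length (neighbours (S ++ post) c)                        ≤⟨ ℕₚ.m≤n+m _ _ ⟩
        length (neighbours pre c) ℕ.+ length (neighbours (S ++ post) c) ≡⟨ length-++ (neighbours pre c) ⟨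
        length (neighbours pre c ++ neighbours (S ++ post) c)    ≡⟨ cong length (filter-++ (adjacent? c) pre (S ++ post)) ⟨
        length (neighbours (pre ++ S ++ post) c)                 ≡⟨ cong (λ xs → length (neighbours xs c)) P≡ ⟨
        length (neighbours P c)                                  ∎
        where open ℕₚ.≤-Reasoning
      shift : ∀ {i j} → length pre ℕ.+ j ≡ suc (length pre ℕ.+ i) → j ≡ suc i
      shift {i} {j} eq = ℕₚ.+-cancelˡ-≡ (length pre) j (suc i) (trans eq (sym (ℕₚ.+-suc (length pre) i)))
      to : ∀ i j → Adjacent (lookup S i) (lookup S j) → toℕ j ≡ suc (toℕ i) ⊎ toℕ i ≡ suc (toℕ j)
      to i j adj = Sum.map shift shift (order (atP (At-lookup S i)) (atP (At-lookup S j)) adj)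
      adjacent : ∀ i j → toℕ j ≡ suc (toℕ i) → Adjacent (lookup S i) (lookup S j)
      adjacent i j eq = S-consecutive (At-lookup S i) (subst (λ k → At S k (lookup S j)) eq (At-lookup S j))
      from : ∀ i j → toℕ j ≡ suc (toℕ i) ⊎ toℕ i ≡ suc (toℕ j) → Adjacent (lookup S i) (lookup S j)
      from i j (inj₁ eq) = adjacent i j eq
      from i j (inj₂ eq) = Adjacent-sym (adjacent j i eq)

  neighbours-unique : ∀ c → Unique (neighbours P c)
  neighbours-unique c = Unique-Properties.filter⁺ (adjacent? c) unique

  last-neighbours : ∀ {pre b c} → P ≡ pre ++ b ∷ c ∷ [] → length (neighbours P c) ≢ 2
  last-neighbours {pre} {b} {c} P≡ = constant⇒length≢2 (neighbours-unique c) λ x∈ →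
    let x∈P , adj = ∈-filter⁻ (adjacent? c) {xs = P} x∈ in only (neighbour {pre} P≡ x∈P adj)
    where
    only : ∀ {x} → x ≡ b ⊎ (∃[ cs ] [] ≡ x ∷ cs) → x ≡ b
    only (inj₁ x≡b)      = x≡b
    only (inj₂ (_ , ()))

  first-neighbours : ∀ {c e cs} → P ≡ c ∷ e ∷ cs → length (neighbours P c) ≢ 2
  first-neighbours {c} {e} {cs} P≡ = constant⇒length≢2 (neighbours-unique c) λ x∈ →
    let x∈P , adj = ∈-filter⁻ (adjacent? c) {xs = P} x∈ in only (first-neighbour P≡ x∈P adj)
    where
    only : ∀ {x} → ∃[ cs′ ] e ∷ cs ≡ x ∷ cs′ → x ≡ e
    only (_ , refl) = refl

  inner-neighbours : ∀ {pre b c e cs} → P ≡ pre ++ b ∷ c ∷ e ∷ cs → length (neighbours P c) ≡ 2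
  inner-neighbours {pre} {b} {c} {e} {cs} P≡ =
    ↭-length (unique-⊆⊇⇒↭ (neighbours-unique c) ((b≢e (suffix-unique {pre} P≡) ∷ []) ∷ [] ∷ []) ⊆ ⊇)
    where
    b≢e : ∀ {b c e : Cell} {cs} → Unique (b ∷ c ∷ e ∷ cs) → b ≢ e
    b≢e ((_ ∷ b≢e ∷ _) ∷ _) = b≢e
    ⊆ : ∀ {x} → x ∈ neighbours P c → x ∈ b ∷ e ∷ []
    ⊆ x∈ with ∈-filter⁻ (adjacent? c) {xs = P} x∈
    ... | x∈P , adj with neighbour {pre} P≡ x∈P adj
    ...   | inj₁ refl       = here refl
    ...   | inj₂ (_ , refl) = there (here refl)
    ⊇ : ∀ {x} → x ∈ b ∷ e ∷ [] → x ∈ neighbours P c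
    ⊇ (here refl)         = ∈-filter⁺ (adjacent? c) (suffix∈ {pre} P≡ (here refl)) (Adjacent-sym (next-adjacent {pre} P≡))
    ⊇ (there (here refl)) = ∈-filter⁺ (adjacent? c) (suffix∈ {pre} P≡ (there (there (here refl))))
      (next-adjacent {pre ∷ʳ b} (slide pre P≡))

-- Linear chains and the ends of segments

Straight : Cell → Cell → Cell → Set
Straight b c e = ∃[ d ] c ≡ move d b × e ≡ move d c

∈corners⇒corner : ∀ P c {v} → v ∈ corners c → ∃[ d ] v ≡ corner P c d
∈corners⇒corner P c (here eq)                         = northward , eq
∈corners⇒corner P c (there (here eq))                 = westward , eq
∈corners⇒corner P c (there (there (here eq)))         = eastward , eq
∈corners⇒corner P c (there (there (there (here eq)))) = southward , eq

corner∈corners : ∀ P c d → corner P c d ∈ corners c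
corner∈corners P c northward = here refl
corner∈corners P c westward = there (here refl)
corner∈corners P c eastward = there (there (here refl))
corner∈corners P c southward = there (there (there (here refl)))

module _ {T : List Cell} (chain : IsPolyominoChain T) where

  open Chain chain
  open SubChain chain

  -- The front corner on the side away from the turn belongs to no other square.
  turn⇒kink : ∀ pre {b c d} t {ts} → T ≡ pre ++ b ∷ c ∷ walk d c (t ∷ ts) → c ≡ move d b → t ≢ straight → Kink T c
  turn⇒kink pre {b} {c} {d} t {ts} T≡ c≡ t≢ = (c∈ , inner-neighbours {pre} T≡) , outer-corner t refl
    where
    c∈ : c ∈ T
    c∈ = suffix∈ {pre} T≡ (there (here refl))
    next : ∀ {s ts′} → t ∷ ts ≡ s ∷ ts′ → ∀ t′ → mem T (move (t′ ↻ s ↻ d) (move (s ↻ d) c)) ≡ isExit t′ ts′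
    next refl = mem-exit {pre ∷ʳ b} (slide pre T≡) refl
    open Front chain c∈ (t ∷ ts) (mem-exit {pre} {ts = t ∷ ts} T≡ c≡) next
    outer-corner : ∀ s → s ≡ t → Any (λ v → degree (polyominoGraph T) v ≡ 2) (corners c)
    outer-corner straight  refl = ⊥-elim (t≢ refl)
    outer-corner leftward  refl = lose (corner∈corners T c (opp d)) (deg-frontRight≡ (leftward ∷ ts) refl)
    outer-corner rightward refl = lose (corner∈corners T c (right d)) (deg-frontLeft≡ (rightward ∷ ts) refl)

  no-kinks⇒straight : (∀ c → ¬ Kink T c) → ∀ {w x y} → Contains T (w ∷ x ∷ y ∷ []) → Straight w x y
  no-kinks⇒straight no-kink {w} {x} {y} (pre , post , T≡) with Adjacent⇒move (next-adjacent {pre} T≡)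
  ... | d , refl with as-walk pre d (y ∷ post) T≡ refl
  ...   | straight  ∷ ts , refl = d , refl , refl
  ...   | leftward  ∷ ts , refl = ⊥-elim (no-kink x (turn⇒kink pre leftward T≡ refl λ ()))
  ...   | rightward ∷ ts , refl = ⊥-elim (no-kink x (turn⇒kink pre rightward T≡ refl λ ()))

  line₂-linear : ∀ {d b} → Contains T (b ∷ move d b ∷ []) → IsLinearChain (b ∷ move d b ∷ [])
  line₂-linear {d} {b} (pre , post , T≡) = S-chain , no-kink
    where
    S₂ = b ∷ move d b ∷ []
    S-chain : IsPolyominoChain S₂
    S-chain = sub-chain {S₂} {pre} {post} T≡ (line-exterior 2 d b)
    no-kink : ∀ c → ¬ Kink S₂ c
    no-kink _ ((here refl , two) , _)         = SubChain.first-neighbours S-chain refl two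
    no-kink _ ((there (here refl) , two) , _) = SubChain.last-neighbours S-chain {[]} refl two

  line₃-linear : ∀ {d b} → Contains T (b ∷ move d b ∷ move d (move d b) ∷ []) →
    IsLinearChain (b ∷ move d b ∷ move d (move d b) ∷ [])
  line₃-linear {d} {b} (pre , post , T≡) = S-chain , no-kink
    where
    c = move d b
    S₃ = b ∷ c ∷ move d c ∷ []
    S-chain : IsPolyominoChain S₃
    S-chain = sub-chain {S₃} {pre} {post} T≡ (line-exterior 3 d b)
    open Here S-chain [] {b} {c} {d} (straight ∷ []) refl refl straight
      (Chain.mem-first S-chain {ts = straight ∷ []} refl (left d) (left≢ d))
      (Chain.mem-first S-chain {ts = straight ∷ []} refl (right d) (right≢ d))
    -- Every corner of the middle square is shared with exactly one of its neighbours, so none has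
    -- degree 2.
    three : ∀ {e} → e ∈ dirs d → deg S₃ c e ≡ 3
    three (here refl)                         = deg-backLeft≡
    three (there (here refl))                 = deg-backRight≡
    three (there (there (here refl)))         = deg-frontRight≡ (straight ∷ []) refl
    three (there (there (there (here refl)))) = deg-frontLeft≡ (straight ∷ []) refl
    3≢2 : 3 ≢ 2
    3≢2 ()
    no-kink : ∀ c → ¬ Kink S₃ c
    no-kink _ ((here refl , two) , _)                 = SubChain.first-neighbours S-chain refl two
    no-kink _ ((there (there (here refl)) , two) , _) = SubChain.last-neighbours S-chain {b ∷ []} refl two
    no-kink _ ((there (here refl) , _) , any) with find any
    ... | v , v∈ , deg≡2 with ∈corners⇒corner S₃ c v∈
    ...   | e , refl = 3≢2 (trans (sym (three (∈dirs d e))) deg≡2)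

-- The run cannot be prolonged in line. Both hold vacuously at an end of the chain, so terminal
-- squares and kinks are treated alike.
LeftEnd RightEnd : List Cell → Cell → Cell → Set
LeftEnd  P x y = ∀ {w} → Contains P (w ∷ x ∷ y ∷ []) → ¬ Straight w x y
RightEnd P x y = ∀ {z} → Contains P (x ∷ y ∷ z ∷ []) → ¬ Straight x y z

-- A larger linear chain contains one more square next to an end of `S`, and without kinks that
-- square is in line with the two squares there.
ends⇒segment : ∀ {P S x y rest ini y′ z′} → Contains P S → IsLinearChain S →
  S ≡ x ∷ y ∷ rest → S ≡ ini ++ y′ ∷ z′ ∷ [] → LeftEnd P x y → RightEnd P y′ z′ → IsSegment P S
ends⇒segment {P} {S} {x} {y} {rest} {ini} {y′} {z′} P∋S S-linear S≡ S≡′ left-end right-end =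
  Contains⇒Infix P∋S , S-linear , maximal
  where
  maximal : ∀ T → Infix _≡_ T P → IsLinearChain T → Infix _≡_ S T → T ≡ S
  maximal T T⊆P (T-chain , no-kink) S⊆T with Infix⇒Contains S⊆T
  ... | u , v , T≡ = trans T≡ (trans (cong₂ (λ u v → u ++ S ++ v) (u≡[] u T≡) (v≡[] v T≡)) (++-identityʳ S))
    where
    P∋T : Contains P T
    P∋T = Infix⇒Contains T⊆P
    u≡[] : ∀ u → T ≡ u ++ S ++ v → u ≡ []
    u≡[] u T≡ with initLast u
    ... | []       = refl
    ... | u′ ∷ʳ′ w = ⊥-elim (left-end (Contains-trans P∋T T∋) (no-kinks⇒straight T-chain no-kink T∋))
      where
      T∋ : Contains T (w ∷ x ∷ y ∷ [])
      T∋ = u′ , rest ++ v , trans T≡ (trans (++-assoc u′ (w ∷ []) (S ++ v)) (cong (λ s → u′ ++ w ∷ s ++ v) S≡))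
    v≡[] : ∀ v → T ≡ u ++ S ++ v → v ≡ []
    v≡[] []       _  = refl
    v≡[] (z ∷ v′) T≡ = ⊥-elim (right-end (Contains-trans P∋T T∋) (no-kinks⇒straight T-chain no-kink T∋))
      where
      T∋ : Contains T (y′ ∷ z′ ∷ z ∷ [])
      T∋ = u ++ ini , v′ , trans T≡ (trans (cong (λ s → u ++ s ++ z ∷ v′) S≡′)
        (trans (cong (u ++_) (++-assoc ini (y′ ∷ z′ ∷ []) (z ∷ v′))) (sym (++-assoc u ini _))))

module _ {P : List Cell} (chain : IsPolyominoChain P) {x y} (segment : IsSegment P (x ∷ y ∷ [])) where

  -- Three squares in line would form a linear chain that properly contains the pair.
  segment₂-leftEnd : LeftEnd P x y
  segment₂-leftEnd P∋ (d , refl , refl)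
    with proj₂ (proj₂ segment) _ (Contains⇒Infix P∋) (line₃-linear chain P∋) (Contains⇒Infix (_ ∷ [] , [] , refl))
  ... | ()

  segment₂-rightEnd : RightEnd P x y
  segment₂-rightEnd P∋ (d , refl , refl)
    with proj₂ (proj₂ segment) _ (Contains⇒Infix P∋) (line₃-linear chain P∋) (Contains⇒Infix ([] , _ ∷ [] , refl))
  ... | ()

two-steps≢ : ∀ d {b} → move d (move d b) ≢ b
two-steps≢ d {b} eq = ↻≢opp straight d (move-direction d (opp d)
  (trans (sym (move-opp d (move d b))) (cong (move (opp d)) eq)))

side-ends : ∀ P c d {Q : Point → Set} → Q (corner P c (right d)) → Q (corner P c (opp d)) →
  Q (proj₁ (side c d)) × Q (proj₂ (side c d))
side-ends P c eastward  r o = o , r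
side-ends P c northward r o = r , o
side-ends P c westward  r o = r , o
side-ends P c southward r o = o , r

-- A segment of length 2 consists of two consecutive squares, both closed by a
-- kink or by the end of the chain; k tells whether the current square is closed.
ShortFrom : Bool → List Bool → Set
ShortFrom k []        = k ≡ true
ShortFrom k (k′ ∷ ks) = (k ≡ true × k′ ≡ true) ⊎ ShortFrom k′ ks

isKink⇒≢straight : ∀ {t} → isKink t ≡ true → t ≢ straight
isKink⇒≢straight () refl

module _ {P : List Cell} (chain : IsPolyominoChain P) where

  open Chain chain
  open SubChain chain

  private
    ∈-Contains : ∀ {xs x} → Contains P xs → x ∈ xs → x ∈ P
    ∈-Contains (pre , post , P≡) x∈ = subst (_ ∈_) (sym P≡) (∈-++⁺ʳ pre (∈-++⁺ˡ x∈))

  turn⇒rightEnd : ∀ pre {b c d} t {ts} → P ≡ pre ++ b ∷ c ∷ walk d c (t ∷ ts) → c ≡ move d b →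
    t ≢ straight → RightEnd P b c
  turn⇒rightEnd pre {b} {c} {d} t {ts} P≡ c≡ t≢ P∋ (d′ , c≡′ , refl)
    with move-direction d′ d (trans (sym c≡′) c≡)
  ... | refl with trans (sym (∈⇒mem P (∈-Contains P∋ (there (there (here refl)))))) (mem-exit {pre} {ts = t ∷ ts} P≡ c≡ straight)
  ...   | eq = t≢ (sym (==⇒≡ straight t (sym eq)))

  turn⇒leftEnd : ∀ pre {b c d} t {ts} → P ≡ pre ++ b ∷ c ∷ walk d c (t ∷ ts) → c ≡ move d b →
    t ≢ straight → LeftEnd P c (move (t ↻ d) c)
  turn⇒leftEnd pre {b} {c} {d} t P≡ c≡ t≢ {w} P∋ (d′ , c≡′ , e≡)
    with neighbour {pre} P≡ (∈-Contains P∋ (here refl))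
           (Adjacent-sym (subst (Adjacent w) (sym c≡′) (move⇒Adjacent d′)))
  ... | inj₁ refl = t≢ (↻-injective d t straight
    (trans (move-direction (t ↻ d) d′ e≡) (move-direction d′ d (trans (sym c≡′) c≡))))
  ... | inj₂ (_ , refl) = two-steps≢ d′ (sym (trans c≡′ (cong (move d′) e≡)))

  first-leftEnd : ∀ {c e cs} → P ≡ c ∷ e ∷ cs → LeftEnd P c e
  first-leftEnd P≡ {w} P∋ (d , c≡ , e≡)
    with first-neighbour P≡ (∈-Contains P∋ (here refl))
           (Adjacent-sym (subst (Adjacent w) (sym c≡) (move⇒Adjacent d)))
  ... | _ , refl = two-steps≢ d (sym (trans c≡ (cong (move d) e≡)))

  last-rightEnd : ∀ {pre b c} → P ≡ pre ++ b ∷ c ∷ [] → RightEnd P b c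
  last-rightEnd {pre} P≡ P∋ (d , refl , refl)
    with neighbour {pre} P≡ (∈-Contains P∋ (there (there (here refl)))) (move⇒Adjacent d)
  ... | inj₁ eq = two-steps≢ d eq
  ... | inj₂ (_ , ())

  pair-segment : ∀ {pre b c d post} → P ≡ pre ++ b ∷ c ∷ post → c ≡ move d b → LeftEnd P b c → RightEnd P b c →
    ∃[ R ] IsSegment P R × length R ≡ 2
  pair-segment {pre} {b} {c} {d} {post} P≡ refl l r = b ∷ c ∷ [] ,
    ends⇒segment {ini = []} (pre , post , P≡) (line₂-linear chain (pre , post , P≡)) refl refl l r , refl

  short⇒segment : ∀ pre {b c d} ts k → P ≡ pre ++ b ∷ c ∷ walk d c ts → c ≡ move d b →
    (k ≡ true → LeftEnd P b c) → ShortFrom k (map isKink ts) → ∃[ R ] IsSegment P R × length R ≡ 2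
  short⇒segment pre []       k P≡ c≡ l k≡ = pair-segment {pre} P≡ c≡ (l k≡) (last-rightEnd {pre} P≡)
  short⇒segment pre (t ∷ ts) k P≡ c≡ l (inj₁ (k≡ , t≡)) =
    pair-segment {pre} P≡ c≡ (l k≡) (turn⇒rightEnd pre t P≡ c≡ (isKink⇒≢straight t≡))
  short⇒segment pre {b} (t ∷ ts) k P≡ c≡ l (inj₂ short) =
    short⇒segment (pre ∷ʳ b) ts (isKink t) (slide pre P≡) refl
      (λ t≡ → turn⇒leftEnd pre t P≡ c≡ (isKink⇒≢straight t≡)) short

  -- `q` is what lies between the current square and the pair. When it is used up, a straight step
  -- at either end would contradict `LeftEnd` or `RightEnd`, so both ends are closed.
  segment⇒short : ∀ {x y} → LeftEnd P x y → RightEnd P x y →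
    ∀ pre {b c d} ts k q {post} → P ≡ pre ++ b ∷ c ∷ walk d c ts → c ≡ move d b →
    b ∷ c ∷ walk d c ts ≡ q ++ x ∷ y ∷ post → (LeftEnd P b c → k ≡ true) → ShortFrom k (map isKink ts)
  segment⇒short l r pre ts k [] P≡ c≡ refl k≡ = closed ts P≡ r
    where
    closed : ∀ ts → P ≡ pre ++ _ ∷ _ ∷ walk _ _ ts → RightEnd P _ _ → ShortFrom k (map isKink ts)
    closed []              P≡ _ = k≡ l
    closed (straight ∷ ts) P≡ r = ⊥-elim (r (pre , _ , P≡) (_ , c≡ , refl))
    closed (leftward ∷ ts) P≡ _  = inj₁ (k≡ l , refl)
    closed (rightward ∷ ts) P≡ _ = inj₁ (k≡ l , refl)
  segment⇒short l r pre []       k (_ ∷ [])    P≡ c≡ () k≡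
  segment⇒short l r pre []       k (_ ∷ _ ∷ []) P≡ c≡ () k≡
  segment⇒short l r pre []       k (_ ∷ _ ∷ _ ∷ _) P≡ c≡ () k≡
  segment⇒short l r pre {b} {c} (t ∷ ts) k (_ ∷ q) P≡ c≡ eq k≡ = inj₂
    (segment⇒short l r (pre ∷ʳ b) ts (isKink t) q (slide pre P≡) refl (∷-injectiveʳ eq) (turned t P≡))
    where
    turned : ∀ t → P ≡ pre ++ b ∷ c ∷ walk _ c (t ∷ ts) → LeftEnd P c (move (t ↻ _) c) → isKink t ≡ true
    turned straight  P≡ l = ⊥-elim (l (pre , _ , P≡) (_ , c≡ , refl))
    turned leftward  P≡ l = refl
    turned rightward P≡ l = refl

  module _ (no-U : ∀ R → IsSegment P R → Internal P R → length R ≡ 3 →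
      ¬ Any (λ (u , v) → degree (polyominoGraph P) u ≡ 3 × degree (polyominoGraph P) v ≡ 3) (figure R)) where

    private
      -- The two kinks and the straight square between them form an internal segment of length 3.
      -- The offending edge is the side of the middle square away from the turns: neither turn adds
      -- a square at its ends.
      no-U-at : ∀ pre {a b d} t {ts} → P ≡ pre ++ a ∷ b ∷ walk d b (t ∷ straight ∷ t ∷ ts) → b ≡ move d a →
        t ≢ straight → ∀ e → let c = move (t ↻ d) b in
        deg P c (right e) ≡ 3 → deg P c (opp e) ≡ 3 → ⊥
      no-U-at pre {a} {b} {d} t {ts} P≡ b≡ t≢ e r≡3 o≡3 =
        no-U R segment internal refl
          (lose (∈figure⁺ {R} (there (here refl)) (side∈sides c e))
            (side-ends P c e {λ v → degree (polyominoGraph P) v ≡ 3} r≡3 o≡3))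
        where
        c  = move (t ↻ d) b
        c′ = move (t ↻ d) c
        R  = b ∷ c ∷ c′ ∷ []
        P≡₁ = slide pre P≡
        P≡₂ = slide (pre ∷ʳ a) P≡₁
        P∋R : Contains P R
        P∋R = pre ∷ʳ a , _ , P≡₁
        segment : IsSegment P R
        segment = ends⇒segment {ini = b ∷ []} P∋R (line₃-linear chain P∋R) refl refl
          (turn⇒leftEnd pre t {straight ∷ t ∷ ts} P≡ b≡ t≢) (turn⇒rightEnd ((pre ∷ʳ a) ∷ʳ b) t P≡₂ refl t≢)
        not-terminal : ∀ {x} → length (neighbours P x) ≡ 2 → ¬ Terminal P x
        not-terminal two (_ , one) with trans (sym two) one
        ... | ()
        internal : Internal P R
        internal (here term) = not-terminal (inner-neighbours {pre} P≡) term
        internal (there (here term)) = not-terminal (inner-neighbours {pre ∷ʳ a} P≡₁) term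
        internal (there (there (here term))) = not-terminal (inner-neighbours {(pre ∷ʳ a) ∷ʳ b} P≡₂) term

      no-U-left : ∀ pre {a b d ts} → P ≡ pre ++ a ∷ b ∷ walk d b (leftward ∷ straight ∷ leftward ∷ ts) → b ≢ move d a
      no-U-left pre {a} {b} {d} {ts} P≡ b≡ = no-U-at pre leftward P≡ b≡ (λ ()) (right e)
          (subst (λ x → deg P (move e b) (left (left x)) ≡ 3) (sym (left-right e)) (deg-frontRight≡ (straight ∷ leftward ∷ ts) refl))
          (subst (λ x → deg P (move e b) (left x) ≡ 3) (sym (left-right e)) deg-backRight≡)
        where
        e = left d
        open Here chain (pre ∷ʳ a) (straight ∷ leftward ∷ ts) (slide pre P≡) refl leftward
          (behind-left chain pre leftward {straight ∷ leftward ∷ ts} P≡ b≡)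
          (behind-right chain pre leftward {straight ∷ leftward ∷ ts} P≡ b≡)

      no-U-right : ∀ pre {a b d ts} → P ≡ pre ++ a ∷ b ∷ walk d b (rightward ∷ straight ∷ rightward ∷ ts) → b ≢ move d a
      no-U-right pre {a} {b} {d} {ts} P≡ b≡ = no-U-at pre rightward P≡ b≡ (λ ()) (left e)
          (subst (λ x → deg P (move e b) x ≡ 3) (sym (left-right e)) deg-backLeft≡)
          (deg-frontLeft≡ (straight ∷ rightward ∷ ts) refl)
        where
        e = right d
        open Here chain (pre ∷ʳ a) (straight ∷ rightward ∷ ts) (slide pre P≡) refl rightward
          (behind-left chain pre rightward {straight ∷ rightward ∷ ts} P≡ b≡)
          (behind-right chain pre rightward {straight ∷ rightward ∷ ts} P≡ b≡)

      -- Two consecutive equal turns close up a block of four squares, whose last square would be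
      -- adjacent to the first, three positions earlier.
      no-block : ∀ pre {a b d} t {ts} → P ≡ pre ++ a ∷ b ∷ walk d b (t ∷ t ∷ ts) → b ≡ move d a → t ≡ straight
      no-block pre straight P≡ _ = refl
      no-block pre {a} {b} {d} leftward P≡ refl = ⊥-elim (not-adjacent {pre} P≡ (subst (Adjacent a)
        (sym (trans (sym (move-left-comm (left d) b)) (cong (move (left d)) (move-opp d a)))) (move⇒Adjacent (left d))))
      no-block pre {a} {b} {d} rightward P≡ refl = ⊥-elim (not-adjacent {pre} P≡ (subst (Adjacent a)
        (sym (trans (cong (λ e → move (left (left e)) (move (right d) b)) (left-right d))
          (trans (move-left-comm (opp d) b) (cong (move (right d)) (move-opp d a))))) (move⇒Adjacent (right d))))

    zigzag-from : ∀ pre {a b d} t ts → P ≡ pre ++ a ∷ b ∷ walk d b (t ∷ ts) → b ≡ move d a → Zigzag t ts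
    zigzag-from pre t [] P≡ b≡ = tt
    zigzag-from pre {a} {b} {d} t (s ∷ ts) P≡ b≡ =
      no-clash t s P≡ , no-U-turn t s ts P≡ , zigzag-from (pre ∷ʳ a) s ts (slide pre P≡) refl
      where
      no-clash : ∀ t s → P ≡ pre ++ a ∷ b ∷ walk d b (t ∷ s ∷ ts) → clash t s ≡ false
      no-clash straight  _         _  = refl
      no-clash leftward  straight  _  = refl
      no-clash leftward  rightward _  = refl
      no-clash rightward straight  _  = refl
      no-clash rightward leftward  _  = refl
      no-clash leftward  leftward  P≡ with no-block pre leftward P≡ b≡
      ... | ()
      no-clash rightward rightward P≡ with no-block pre rightward P≡ b≡
      ... | ()
      no-U-turn : ∀ t s us → P ≡ pre ++ a ∷ b ∷ walk d b (t ∷ s ∷ us) → s ≡ straight → clashHead t us ≡ false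
      no-U-turn t         .straight []               _  refl = refl
      no-U-turn straight  .straight (_ ∷ _)          _  refl = refl
      no-U-turn leftward  .straight (straight ∷ _)   _  refl = refl
      no-U-turn leftward  .straight (rightward ∷ _)  _  refl = refl
      no-U-turn rightward .straight (straight ∷ _)   _  refl = refl
      no-U-turn rightward .straight (leftward ∷ _)   _  refl = refl
      no-U-turn leftward  .straight (leftward ∷ _)   P≡ refl = ⊥-elim (no-U-left pre P≡ b≡)
      no-U-turn rightward .straight (rightward ∷ _)  P≡ refl = ⊥-elim (no-U-right pre P≡ b≡)

    zigzag : ∀ {c d} ts → P ≡ c ∷ move d c ∷ walk d (move d c) ts → Zigzag straight ts
    zigzag []       P≡ = tt
    zigzag (t ∷ ts) P≡ = refl , (λ _ → free ts) , zigzag-from [] t ts P≡ refl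
      where
      free : ∀ ts → clashHead straight ts ≡ false
      free []      = refl
      free (_ ∷ _) = refl

module _ {c ℓ} (G : AbelianGroup c ℓ) where

  open AbelianGroup G hiding (_-_) renaming (refl to ≈-refl; sym to ≈-sym; trans to ≈-trans)
  open Mult monoid renaming (_×_ to _·ᴳ_)
  open CMSolver commutativeMonoid using (solve; _⊜_; id) renaming (_⊕_ to _:∙_)

  -- The equation for the exponent yields only the double of the wanted one. Halving is impossible
  -- in a general abelian group and is left to `double-cancel-≤`.
  doubled-equation : ∀ {x y z t} → t ≈ 6 ·ᴳ y → (2 ·ᴳ x ∙ t ⁻¹) ∙ 4 ·ᴳ z ≈ ε →
    (x ∙ 2 ·ᴳ z) ∙ (x ∙ 2 ·ᴳ z) ≈ (3 ·ᴳ y) ∙ (3 ·ᴳ y)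
  doubled-equation {x} {y} {z} {t} t≈ eq = ≈-trans
    (solve 2 (λ x z → (x :∙ (z :∙ (z :∙ id))) :∙ (x :∙ (z :∙ (z :∙ id)))
      ⊜ id :∙ ((x :∙ (x :∙ id)) :∙ (z :∙ (z :∙ (z :∙ (z :∙ id)))))) ≈-refl x z)
    (≈-trans (∙-congʳ (≈-sym (inverseʳ t)))
    (≈-trans (solve 4 (λ t t⁻ x z → (t :∙ t⁻) :∙ (x :∙ z) ⊜ t :∙ ((x :∙ t⁻) :∙ z)) ≈-refl t (t ⁻¹) (2 ·ᴳ x) (4 ·ᴳ z))
    (≈-trans (∙-cong t≈ eq)
    (solve 1 (λ y → (y :∙ (y :∙ (y :∙ (y :∙ (y :∙ (y :∙ id)))))) :∙ id
      ⊜ (y :∙ (y :∙ (y :∙ id))) :∙ (y :∙ (y :∙ (y :∙ id)))) ≈-refl y))))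

-- The bound

length-walk : ∀ d c ts → length (walk d c ts) ≡ length ts
length-walk d c []       = refl
length-walk d c (t ∷ ts) = cong suc (length-walk (t ↻ d) (move (t ↻ d) c) ts)

length-kinks : ∀ {c d B} ts → B ≡ c ∷ move d c ∷ walk d (move d c) ts →
  suc (suc (length (map isKink ts))) ≡ length B
length-kinks {c} {d} ts refl = cong (λ n → suc (suc n)) (trans (length-map isKink ts) (sym (length-walk d (move d c) ts)))

-- The operations are separate parameters because comparing expressions in ℝ up
-- to unfolding is infeasible: instances must agree with the goal syntactically.
module _ {c ℓ} {C : Set c} {_≈_ : C → C → Set ℓ} {_∙_ : C → C → C} {ε : C} {_⁻¹ : C → C}
         (isAbelianGroup : IsAbelianGroup _≈_ _∙_ ε _⁻¹) where

  private
    G : AbelianGroup c ℓ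
    G = record { isAbelianGroup = isAbelianGroup }

  open AbelianGroup G using (monoid; commutativeMonoid; ∙-congʳ) renaming (trans to ≈-trans)
  open Mult monoid using () renaming (_×_ to _×ᴳ_)
  open Loss _∙_ ε

  chain-sum : (f : ℕ → C) (_·ᴳ_ : ℕ → C → C) (_⊖_ : C → C → C) →
    _·ᴳ_ ≡ _×ᴳ_ → (∀ x y → x ⊖ y ≡ x ∙ (y ⁻¹)) → (f 5 ∙ (2 ·ᴳ f 7)) ≈ (3 ·ᴳ f 6) →
    ∀ {c d B} ts → (chain : IsPolyominoChain B) → B ≡ c ∷ move d c ∷ walk d (move d c) ts → Zigzag straight ts →
    ∀ n → length B ≡ n → ∀ x → x ≡ foldr (λ s y → f (endDegrees B s) ∙ y) ε (figure B) →
    (x ∙ loss (f 6 ⊖ f 7) ((f 6 ⊖ f 7) ∙ (f 7 ⊖ f 8)) (map isKink ts))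
    ≈ (((3 ℕ.* n) ·ᴳ f 6) ∙ ((((2 ·ᴳ f 4) ∙ (2 ·ᴳ f 5)) ∙ f 6) ⊖ (4 ·ᴳ f 7)))
  chain-sum f _ _⊖_ refl ⊖≡ eq {c} {d} {B} ts chain B≡ zz _ refl _ refl
    rewrite ⊖≡ (f 6) (f 7) | ⊖≡ (f 7) (f 8) | ⊖≡ (((2 ×ᴳ f 4) ∙ (2 ×ᴳ f 5)) ∙ f 6) (4 ×ᴳ f 7)
    | sym (length-kinks ts B≡) =
    ≈-trans (∙-congʳ (sum-figure chain commutativeMonoid f ts B≡ zz)) (total+loss≈bound G f eq (map isKink ts))

-- The sign of the loss and the equality case

0<x⇒0<x+y : ∀ x y → 0ᴿ < x → 0ᴿ ≤ y → 0ᴿ < x + y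
0<x⇒0<x+y x y (q , 0<q , lq) 0≤y with L-open x lq
... | q′ , q<q′ , lq′ = q , 0<q , q′ , q ℚ.- q′ , lq′ , 0≤y (p<q⇒p-q<0 q<q′) , p+q-p q′ q

x<y⇒0<y-x : ∀ x y → x < y → 0ᴿ < y - x
x<y⇒0<y-x x y (q , uq , lq) with L-open y lq
... | q′ , q<q′ , lq′ = q′ ℚ.- q , 0<- q<q′ , q′ , ℚ.- q , lq′ , subst (U x) (sym (neg-neg q)) uq , refl

open Loss _+_ 0ᴿ

module _ (u v : ℝ) (0<u : 0ᴿ < u) (0<v : 0ᴿ < v) where

  private
    Sign : Set → ℝ → Set
    Sign Short x = (Short × 0ᴿ < x) ⊎ (¬ Short × x ≃ 0ᴿ)

    0≤ : ∀ {A} x → Sign A x → 0ᴿ ≤ x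
    0≤ x (inj₁ (_ , 0<x))       = <⇒≤ 0ᴿ x 0<x
    0≤ x (inj₂ (_ , _ , 0≤x)) = 0≤x

    Sign-0+ : ∀ {A B : Set} x → (A → B) → (B → A) → Sign A x → Sign B (0ᴿ + x)
    Sign-0+ x to from (inj₁ (a , q , 0<q , lq)) = inj₁ (to a , q , 0<q , +-identityˡ-≥ x lq)
    Sign-0+ x to from (inj₂ (¬a , x≤0 , 0≤x)) =
      inj₂ ((λ b → ¬a (from b)) , (λ l → x≤0 (+-identityˡ-≤ x l)) , (λ l → +-identityˡ-≥ x (0≤x l)))

  lossFrom-sign : ∀ k ks → Sign (ShortFrom k ks) (lossFrom u v k ks)
  lossFrom-sign true  []           = inj₁ (refl , 0<u)
  lossFrom-sign false []           = inj₂ ((λ ()) , (λ l → l) , (λ l → l))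
  lossFrom-sign true  (true ∷ ks)  = inj₁ (inj₁ (refl , refl) ,
    0<x⇒0<x+y v (lossFrom u v true ks) 0<v (0≤ (lossFrom u v true ks) (lossFrom-sign true ks)))
  lossFrom-sign true  (false ∷ ks) =
    Sign-0+ (lossFrom u v false ks) inj₂ (λ { (inj₂ s) → s ; (inj₁ (_ , ())) }) (lossFrom-sign false ks)
  lossFrom-sign false (k ∷ ks)     =
    Sign-0+ (lossFrom u v k ks) inj₂ (λ { (inj₂ s) → s ; (inj₁ (() , _)) }) (lossFrom-sign k ks)

  -- The initial `true` says that the first square is closed by the end of the chain. The word must
  -- be nonempty: `ShortFrom true []` holds, but the loss of `[]` is zero.
  loss-sign : ∀ k ks → Sign (ShortFrom true (k ∷ ks)) (loss u v (k ∷ ks))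
  loss-sign true  ks = inj₁ (inj₁ (refl , refl) , 0<x⇒0<x+y u (lossFrom u v false (true ∷ ks)) 0<u
    (0≤ (lossFrom u v false (true ∷ ks)) (lossFrom-sign false (true ∷ ks))))
  loss-sign false ks = Sign-0+ (lossFrom u v false (false ∷ ks)) (λ { (inj₂ s) → inj₂ s ; (inj₁ (() , _)) })
    (λ { (inj₂ s) → inj₂ s ; (inj₁ (_ , ())) }) (lossFrom-sign false (false ∷ ks))

  dichotomy : ∀ {A : Set} x ℓ b → x + ℓ ≃ b → Sign A ℓ → (x ≤ b) × ((x ≃ b) ⇔ (¬ A))
  dichotomy {A} x ℓ b (x+ℓ≤b , b≤x+ℓ) (inj₂ (¬a , ℓ≤0 , 0≤ℓ)) = x≤b , mk⇔ (λ _ → ¬a) equal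
    where
    x≤b : x ≤ b
    x≤b l = x+ℓ≤b (+-mono-≤ x x 0ᴿ ℓ (λ l → l) 0≤ℓ (+-comm-≤ 0ᴿ x (+-identityˡ-≥ x l)))
    b≤x : b ≤ x
    b≤x l = +-identityˡ-≤ x (+-comm-≤ x 0ᴿ (+-mono-≤ x x ℓ 0ᴿ (λ l → l) ℓ≤0 (b≤x+ℓ l)))
    equal : ¬ A → x ≃ b
    equal _ = x≤b , b≤x
  dichotomy {A} x ℓ b (x+ℓ≤b , b≤x+ℓ) (inj₁ (a , 0<ℓ)) =
    (λ l → x+ℓ≤b (+-mono-≤ x x 0ᴿ ℓ (λ l → l) (<⇒≤ 0ᴿ ℓ 0<ℓ) (+-comm-≤ 0ᴿ x (+-identityˡ-≥ x l))))
    , mk⇔ unequal (λ ¬a → ⊥-elim (¬a a))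
    where
    ℓ≤0 : b ≤ x → ℓ ≤ 0ᴿ
    ℓ≤0 b≤x l = +-inverseʳ-≤ x (+-comm-≤ (- x) x (+-mono-≤ (- x) (- x) (x + ℓ) x (λ l → l) (λ l → b≤x (x+ℓ≤b l))
      (+-assoc-≤ (- x) x ℓ (+-mono-≤ 0ᴿ (- x + x) ℓ ℓ
        (λ l → +-comm-≤ x (- x) (+-inverseʳ-≥ x l)) (λ l → l) (+-identityˡ-≥ ℓ l)))))
    unequal : x ≃ b → ¬ A
    unequal (_ , b≤x) _ = <⇒≱ 0ᴿ ℓ 0<ℓ (ℓ≤0 b≤x)

loss-decides : ∀ {A : Set} u z x b → 0ᴿ < u → 0ᴿ < z → ∀ k ks →
  (ShortFrom true (k ∷ ks) → A) → (A → ShortFrom true (k ∷ ks)) →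
  x + loss u (u + z) (k ∷ ks) ≃ b → (x ≤ b) × ((x ≃ b) ⇔ (¬ A))
loss-decides {A} u z x b 0<u 0<z k ks to from eq =
  dichotomy u v 0<u 0<v x (loss u v (k ∷ ks)) b eq (translate {loss u v (k ∷ ks)} (loss-sign u v 0<u 0<v k ks))
  where
  v : ℝ
  v = u + z
  0<v : 0ᴿ < v
  0<v = 0<x⇒0<x+y u z 0<u (<⇒≤ 0ᴿ z 0<z)
  translate : ∀ {ℓ} → (ShortFrom true (k ∷ ks) × 0ᴿ < ℓ) ⊎ (¬ ShortFrom true (k ∷ ks) × ℓ ≃ 0ᴿ) →
    (A × 0ᴿ < ℓ) ⊎ (¬ A × ℓ ≃ 0ᴿ)
  translate (inj₁ (s , 0<ℓ))  = inj₁ (to s , 0<ℓ)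
  translate (inj₂ (¬s , ℓ≃0)) = inj₂ ((λ a → ¬s (from a)) , ℓ≃0)

foldr-congˡ : ∀ {a c} {A : Set a} {C : Set c} (_∙_ : C → C → C) (ε : C) (f g : A → C) → (∀ a → f a ≡ g a) →
  ∀ xs → foldr (λ a x → f a ∙ x) ε xs ≡ foldr (λ a x → g a ∙ x) ε xs
foldr-congˡ _∙_ ε f g f≡g = foldr-cong (λ a x → cong (_∙ x) (f≡g a)) refl

χ≡ : ∀ α B → χ α (polyominoGraph B) ≡ foldr (λ s x → endDegrees B s ^ℝ α + x) 0ᴿ (figure B)
χ≡ α B = foldr-congˡ _+_ 0ᴿ
  (λ (p , q) → (Graph.degree (polyominoGraph B) p ℕ.+ Graph.degree (polyominoGraph B) q) ^ℝ α)
  (λ s → endDegrees B s ^ℝ α) (λ s → cong (_^ℝ α) {x = endDegrees B s} refl) (figure B)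

1≤ : ∀ n → 1ℚ ℚ.≤ fromℤ (+ suc n)
1≤ n = ℚ.*≤* (ℤ.+≤+ (ℕ.s≤s ℕ.z≤n))

module _ (α : ℝ) (α<-1 : U α (-[1+ 0 ] / 1)) where

  ^ℝ-antimono-< : ∀ m n → fromℤ (+ suc m) ℚ.< fromℤ (+ suc n) → suc n ^ℝ α < suc m ^ℝ α
  ^ℝ-antimono-< m n m<n = power-antimono-< (fromℤ (+ suc m)) (fromℤ (+ suc n)) (1≤ m) (1≤ n) m<n α α<-1

  module _ (root : 2 · 5 ^ℝ α - 6 ^ℝ (α + fromℚ 1ℚ) + 4 · 7 ^ℝ α ≃ 0ᴿ) where

    halved : 5 ^ℝ α + 2 · 7 ^ℝ α ≃ 3 · 6 ^ℝ α
    halved = double-cancel-≤ (5 ^ℝ α + 2 · 7 ^ℝ α) (3 · 6 ^ℝ α) (proj₁ doubled)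
           , double-cancel-≤ (3 · 6 ^ℝ α) (5 ^ℝ α + 2 · 7 ^ℝ α) (proj₂ doubled)
      where
      doubled : (5 ^ℝ α + 2 · 7 ^ℝ α) + (5 ^ℝ α + 2 · 7 ^ℝ α) ≃ 3 · 6 ^ℝ α + 3 · 6 ^ℝ α
      doubled = doubled-equation ℝ-+-abelianGroup {5 ^ℝ α} {6 ^ℝ α} {7 ^ℝ α} {6 ^ℝ (α + fromℚ 1ℚ)} (power-suc 5 (1≤ 5) α) root

    0<u : 0ᴿ < 6 ^ℝ α - 7 ^ℝ α
    0<u = x<y⇒0<y-x (7 ^ℝ α) (6 ^ℝ α) (^ℝ-antimono-< 5 6 (from-yes (fromℤ (+ 6) ℚ.<? fromℤ (+ 7))))

    0<z : 0ᴿ < 7 ^ℝ α - 8 ^ℝ α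
    0<z = x<y⇒0<y-x (8 ^ℝ α) (7 ^ℝ α) (^ℝ-antimono-< 6 7 (from-yes (fromℤ (+ 7) ℚ.<? fromℤ (+ 8))))

    chain-bound : ∀ {c d B} t ts → B ≡ c ∷ move d c ∷ walk d (move d c) (t ∷ ts) → ∀ n → Ω n B →
      let bound = (3 ℕ.* n) · 6 ^ℝ α + (2 · 4 ^ℝ α + 2 · 5 ^ℝ α + 6 ^ℝ α - 4 · 7 ^ℝ α) in
      (χ α (polyominoGraph B) ≤ bound)
      × ((χ α (polyominoGraph B) ≃ bound) ⇔ (¬ (∃[ R ] IsSegment B R × length R ≡ 2)))
    chain-bound {c} {d} {B} t ts B≡ n (chain , length≡n , no-U) = loss-decides
      (6 ^ℝ α - 7 ^ℝ α) (7 ^ℝ α - 8 ^ℝ α) (χ α (polyominoGraph B))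
      ((3 ℕ.* n) · 6 ^ℝ α + (2 · 4 ^ℝ α + 2 · 5 ^ℝ α + 6 ^ℝ α - 4 · 7 ^ℝ α))
      0<u 0<z (isKink t) (map isKink ts) to from
      (chain-sum (AbelianGroup.isAbelianGroup ℝ-+-abelianGroup) (_^ℝ α) _·_ _-_ refl (λ _ _ → refl) halved
        (t ∷ ts) chain B≡ (zigzag chain no-U (t ∷ ts) B≡) n length≡n (χ α (polyominoGraph B)) (χ≡ α B))
      where
      open Chain chain
      Short : Set
      Short = ∃[ R ] IsSegment B R × length R ≡ 2
      to : ShortFrom true (map isKink (t ∷ ts)) → Short
      to = short⇒segment chain [] (t ∷ ts) true B≡ refl (λ _ → first-leftEnd chain B≡)
      from : Short → ShortFrom true (map isKink (t ∷ ts))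
      from (x ∷ y ∷ [] , segment , refl) =
        let pre , post , B≡′ = Infix⇒Contains (proj₁ segment)
        in segment⇒short chain (segment₂-leftEnd chain segment) (segment₂-rightEnd chain segment)
             [] (t ∷ ts) true pre B≡ refl (trans (sym B≡) B≡′) (λ _ → refl)

long-walk : ∀ {B} → IsPolyominoChain B → 3 ℕ.≤ length B →
  ∃[ c ] ∃[ d ] ∃[ t ] ∃[ ts ] B ≡ c ∷ move d c ∷ walk d (move d c) (t ∷ ts)
long-walk {c ∷ b ∷ cs} chain 3≤ with Adjacent⇒move (Chain.next-adjacent chain {[]} refl)
... | d , refl with Chain.as-walk chain [] d cs refl refl
...   | t ∷ ts , refl = c , d , t , ts , refl
...   | []     , refl with 3≤
...     | ℕ.s≤s (ℕ.s≤s ())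
long-walk {[]}     _ ()
long-walk {_ ∷ []} _ (ℕ.s≤s ())

proposition2p6 :
    (α : ℝ) →
    fromℚ (-[1+ 309997 ] / 100000) < α →
    α < fromℚ (-[1+ 309995 ] / 100000) →
    2 · 5 ^ℝ α - 6 ^ℝ (α + fromℚ 1ℚ) + 4 · 7 ^ℝ α ≃ fromℚ (+ 0 / 1) →
    (n : ℕ) → 3 ℕ.≤ n →
    (B : List Cell) → Ω n B →
    let bound = (3 ℕ.* n) · 6 ^ℝ α
                + (2 · 4 ^ℝ α + 2 · 5 ^ℝ α + 6 ^ℝ α - 4 · 7 ^ℝ α)
    in
    (χ α (polyominoGraph B) ≤ bound)
    × ((χ α (polyominoGraph B) ≃ bound) ⇔ (¬ (∃[ S ] IsSegment B S × length S ≡ 2)))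
proposition2p6 α _ (q , α<q , q<r) root n 3≤n B Ω-B@(chain , length≡n , _) =
  let c , d , t , ts , B≡ = long-walk chain (subst (3 ℕ.≤_) (sym length≡n) 3≤n)
  in chain-bound α α<-1 root t ts B≡ n Ω-B
  where
  α<-1 : U α (-[1+ 0 ] / 1)
  -- `-[1+ 309995 ]` is -309996, and `99999` is one less than the denominator: -3.09996 is compared
  -- with -1 by cross-multiplication.
  α<-1 = U-up α (ℚₚ.<-trans q<r (⇒/< { -[1+ 309995 ] } {0} { -[1+ 0 ] } {99999}
    (from-yes (-[1+ 309995 ] ℤ.* + 1 ℤ.<? -[1+ 0 ] ℤ.* + 100000)))) α<q
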